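{- Let $n\in\mathbb{Z}_{>0}$, let $q,t^{\frac12}\in\mathbb{C}^\times$, and let $\mathbf{1}_0,\varepsilon_0$ be the bosonic and fermionic symmetrizers acting on $\mathbb{C}[X]=\mathbb{C}[x_1^{\pm1},\ldots,x_n^{\pm1}]$ (defined in the context). Then $$\mathbf{1}_0\mathbb{C}[X]=\mathbb{C}[X]^{\mathrm{Bos}}=\mathbb{C}[X]^{S_n}\qquad\text{and}\qquad \varepsilon_0\mathbb{C}[X]=\mathbb{C}[X]^{\mathrm{Fer}}=A_\rho \mathbb{C}[X]^{S_n}.$$ Moreover, there are $\mathbb{C}[X]^{S_n}$-module isomorphisms $$\mathbb{C}[X]^{S_n}\to \mathbb{C}[X]^{\det},\ f\mapsto a_\rho f,\qquad\text{and}\qquad \mathbb{C}[X]^{\mathrm{Bos}}\to \mathbb{C}[X]^{\mathrm{Fer}},\ f\mapsto A_\rho f,$$ where $$a_\rho=\prod_{1\le i<j\le n}(x_j-x_i)\qquad\text{and}\qquad A_\rho=\prod_{1\le i<j\le n}(x_j-tx_i).$$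
   Context: Let $q,t^{\frac12}\in\mathbb{C}^\times=\mathbb{C}\setminus\{0\}$, $t=(t^{\frac12})^2$, and $\mathbb{C}[X]=\mathbb{C}[x_1^{\pm1},\ldots,x_n^{\pm1}]$. The symmetric group $S_n$ acts on $\mathbb{C}[X]$ by permuting the variables; $s_i$ is the transposition $(i,i+1)$, $\ell$ is the length function on $S_n$ and $w_0$ is the longest element. For $i\in\{1,\ldots,n-1\}$ define the operator $T_i:\mathbb{C}[X]\to\mathbb{C}[X]$ by $$T_if=-t^{ -\frac12}f+(1+s_i)\left(\frac{t^{ -\frac12}-t^{\frac12}x_i^{ -1}x_{i+1}}{1-x_i^{ -1}x_{i+1}}f\right).$$ For $w\in S_n$ with reduced word $w=s_{i_1}\cdots s_{i_\ell}$ put $T_w=T_{i_1}\cdots T_{i_\ell}$ (independent of the reduced word). Define $$\mathbf{1}_0=\sum_{w\in S_n}t^{\frac12(\ell(w)-\ell(w_0))}T_w,\qquad \varepsilon_0=\sum_{w\in S_n}(-t^{ -\frac12})^{\ell(w)-\ell(w_0)}T_w .$$ Define subspaces of $\mathbb{C}[X]$ (conditions for all $i\in\{1,\ldots,n-1\}$): $\mathbb{C}[X]^{S_n}=\{f: s_if=f\}$, $\mathbb{C}[X]^{\det}=\{f: s_if=-f\}$, $\mathbb{C}[X]^{\mathrm{Bos}}=\{f: T_if=t^{\frac12}f\}$, $\mathbb{C}[X]^{\mathrm{Fer}}=\{f: T_if=-t^{ -\frac12}f\}$.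
   Formalization: Adds the hypothesis that 1+t+…+t^{k-1} is nonzero (invertible) for 1≤k≤n; without it the claim fails, e.g. n=2, t=−1: the image of 1_0 is (x_1+x_2)C[X]^{S_2}, which omits the bosonic element 1. -}

module Defs where

module ComplexNumbers where

  open import Level using (0ℓ)
  open import Algebra.Bundles using (CommutativeRing)
  open import Algebra.Definitions using (Invertible)
  open import Data.Nat.Base as ℕ using (ℕ)
  import Data.Nat.Properties as ℕ
  open import Data.Product using (∃; Σ-syntax; _×_; _,_; proj₁; proj₂)
  open import Data.Rational.Base as ℚ using (ℚ; 0ℚ; 1ℚ; ½; ∣_∣; 1/_; Positive; NonNegative; positive)
  import Data.Rational.Properties as ℚ
  open import Data.Rational.Solver using (module +-*-Solver)
  open import Relation.Binary.Bundles using (Setoid)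
  open import Relation.Binary.PropositionalEquality
    using (_≡_; refl; sym; trans; cong; cong₂; subst; subst₂)

  record ℝ : Set where
    no-eta-equality
    field
      seq    : ℕ → ℚ
      cauchy : ∀ ε → 0ℚ ℚ.< ε → ∃ λ N → ∀ k l → N ℕ.≤ k → N ℕ.≤ l →
               ∣ seq k ℚ.- seq l ∣ ℚ.< ε

  open ℝ

  record _≈ʳ_ (x y : ℝ) : Set where
    no-eta-equality
    pattern
    constructor mk≈ʳ
    field
      close : ∀ ε → 0ℚ ℚ.< ε → ∃ λ N → ∀ k → N ℕ.≤ k → ∣ seq x k ℚ.- seq y k ∣ ℚ.< ε

  open _≈ʳ_

  private
    -- Eventual smallness of a family indexed by a set with a notion of
    -- "being at least N"; used with I = ℕ and I = ℕ × ℕ.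
    module Null (I : Set) (_≽_ : I → ℕ → Set)
                (weaken : ∀ {i M N} → M ℕ.≤ N → i ≽ N → i ≽ M) where

      IsNull : (I → ℚ) → Set
      IsNull z = ∀ ε → 0ℚ ℚ.< ε → ∃ λ N → ∀ i → i ≽ N → ∣ z i ∣ ℚ.< ε

      Bounded : (I → ℚ) → Set
      Bounded b = ∃ λ B → 0ℚ ℚ.< B × ∃ λ N → ∀ i → i ≽ N → ∣ b i ∣ ℚ.< B

      null-resp : ∀ {y z} → (∀ i → y i ≡ z i) → IsNull y → IsNull z
      null-resp eq ny ε ε>0 with ny ε ε>0
      ... | N , p = N , λ i h → subst (λ a → ∣ a ∣ ℚ.< ε) (eq i) (p i h)

      half+half : ∀ ε → ½ ℚ.* ε ℚ.+ ½ ℚ.* ε ≡ ε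
      half+half ε = solve 1 (λ e → con ½ :* e :+ con ½ :* e := e) refl ε
        where open +-*-Solver

      *-pos : ∀ {a b} → 0ℚ ℚ.< a → 0ℚ ℚ.< b → 0ℚ ℚ.< a ℚ.* b
      *-pos {a} {b} a>0 b>0 = subst (ℚ._< a ℚ.* b) (ℚ.*-zeroʳ a)
        (ℚ.*-monoʳ-<-pos a {{positive a>0}} b>0)

      null-+ : ∀ {y z} → IsNull y → IsNull z → IsNull (λ i → y i ℚ.+ z i)
      null-+ {y} {z} ny nz ε ε>0 with ny (½ ℚ.* ε) (*-pos (ℚ.positive⁻¹ ½) ε>0)
                                    | nz (½ ℚ.* ε) (*-pos (ℚ.positive⁻¹ ½) ε>0)
      ... | M , p | N , q = M ℕ.⊔ N , λ i h →
        ℚ.≤-<-trans (ℚ.∣p+q∣≤∣p∣+∣q∣ (y i) (z i))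
          (subst (∣ y i ∣ ℚ.+ ∣ z i ∣ ℚ.<_) (half+half ε)
            (ℚ.+-mono-< (p i (weaken (ℕ.m≤m⊔n M N) h)) (q i (weaken (ℕ.m≤n⊔m M N) h))))

      null-neg : ∀ {z} → IsNull z → IsNull (λ i → ℚ.- z i)
      null-neg {z} nz ε ε>0 with nz ε ε>0
      ... | N , p = N , λ i h → subst (ℚ._< ε) (sym (ℚ.∣-p∣≡∣p∣ (z i))) (p i h)

      null-* : ∀ {b z} → Bounded b → IsNull z → IsNull (λ i → b i ℚ.* z i)
      null-* {b} {z} (B , B>0 , M , p) nz ε ε>0 = M ℕ.⊔ N , bound
        where
        instance
          B-pos : Positive B
          B-pos = positive B>0
          B≢0 : ℚ.NonZero B
          B≢0 = ℚ.pos⇒nonZero B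
        δ = (1/ B) ℚ.* ε
        δ>0 : 0ℚ ℚ.< δ
        δ>0 = *-pos (ℚ.positive⁻¹ (1/ B) {{ℚ.1/pos⇒pos B}}) ε>0
        N = proj₁ (nz δ δ>0)
        Bδ≡ε : B ℚ.* δ ≡ ε
        Bδ≡ε = trans (sym (ℚ.*-assoc B (1/ B) ε))
                 (trans (cong (ℚ._* ε) (ℚ.*-inverseʳ B)) (ℚ.*-identityˡ ε))
        bound : ∀ i → i ≽ (M ℕ.⊔ N) → ∣ b i ℚ.* z i ∣ ℚ.< ε
        bound i h = subst₂ ℚ._<_ (sym (ℚ.∣p*q∣≡∣p∣*∣q∣ (b i) (z i))) Bδ≡ε
          (ℚ.≤-<-trans
            (ℚ.*-monoʳ-≤-nonNeg ∣ z i ∣ {{ℚ.∣-∣-nonNeg (z i)}}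
              (ℚ.<⇒≤ (p i (weaken (ℕ.m≤m⊔n M N) h))))
            (ℚ.*-monoʳ-<-pos B (proj₂ (nz δ δ>0) i (weaken (ℕ.m≤n⊔m M N) h))))

    module N₁ = Null ℕ (λ k N → N ℕ.≤ k) ℕ.≤-trans
    module N₂ = Null (ℕ × ℕ) (λ kl N → N ℕ.≤ proj₁ kl × N ℕ.≤ proj₂ kl)
                     (λ M≤N (p , q) → ℕ.≤-trans M≤N p , ℕ.≤-trans M≤N q)

    gap : (ℕ → ℚ) → ℕ × ℕ → ℚ
    gap x (k , l) = x k ℚ.- x l

    toNull : ∀ x → N₂.IsNull (gap (seq x))
    toNull x ε ε>0 with cauchy x ε ε>0
    ... | N , p = N , λ (k , l) (h , h′) → p k l h h′

    fromNull : (x : ℕ → ℚ) → N₂.IsNull (gap x) → ∀ ε → 0ℚ ℚ.< ε → ∃ λ N → ∀ k l → N ℕ.≤ k → N ℕ.≤ l →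
               ∣ x k ℚ.- x l ∣ ℚ.< ε
    fromNull x nx ε ε>0 = proj₁ (nx ε ε>0) , λ k l h h′ → proj₂ (nx ε ε>0) (k , l) (h , h′)

    ∣∣-shift : ∀ a b {c} → ∣ a ℚ.- b ∣ ℚ.< c → ∣ a ∣ ℚ.< c ℚ.+ ∣ b ∣
    ∣∣-shift a b {c} p = ℚ.≤-<-trans
      (subst (λ u → ∣ u ∣ ℚ.≤ ∣ a ℚ.- b ∣ ℚ.+ ∣ b ∣) (cancel a b) (ℚ.∣p+q∣≤∣p∣+∣q∣ (a ℚ.- b) b))
      (ℚ.+-monoˡ-< ∣ b ∣ {∣ a ℚ.- b ∣} {c} p)
      where
      cancel : ∀ a b → a ℚ.- b ℚ.+ b ≡ a
      cancel = solve 2 (λ a b → a :- b :+ b := a) refl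
        where open +-*-Solver

    +∣∣-pos : ∀ {c} b → 0ℚ ℚ.< c → 0ℚ ℚ.< c ℚ.+ ∣ b ∣
    +∣∣-pos {c} b c>0 = ℚ.positive⁻¹ (c ℚ.+ ∣ b ∣)
      {{ℚ.pos+nonNeg⇒pos c {{positive c>0}} ∣ b ∣ {{ℚ.∣-∣-nonNeg b}}}}

    abstract
      bounded : ∀ x → ∃ λ B → 0ℚ ℚ.< B × ∃ λ N → ∀ k → N ℕ.≤ k → ∣ seq x k ∣ ℚ.< B
      bounded x with cauchy x 1ℚ (ℚ.positive⁻¹ 1ℚ)
      ... | N , p = 1ℚ ℚ.+ ∣ seq x N ∣ , +∣∣-pos (seq x N) (ℚ.positive⁻¹ 1ℚ)
                  , N , λ k h → ∣∣-shift (seq x k) (seq x N) (p k N h ℕ.≤-refl)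

    bounded₁ : ∀ x → N₂.Bounded (λ kl → seq x (proj₁ kl))
    bounded₁ x = let B , B>0 , N , p = bounded x in B , B>0 , N , λ (k , _) (h , _) → p k h

    bounded₂ : ∀ x → N₂.Bounded (λ kl → seq x (proj₂ kl))
    bounded₂ x = let B , B>0 , N , p = bounded x in B , B>0 , N , λ (_ , l) (_ , h) → p l h

    small : ∀ {a b ε} → a ≡ b → 0ℚ ℚ.< ε → ∣ a ℚ.- b ∣ ℚ.< ε
    small {a} {.a} {ε} refl ε>0 = subst (ℚ._< ε) (sym (cong ∣_∣ (ℚ.+-inverseʳ a))) ε>0

    from≡ : ∀ {x y} → (∀ k → seq x k ≡ seq y k) → x ≈ʳ y
    from≡ {x} {y} eq = mk≈ʳ λ ε ε>0 → 0 , λ k _ → small {seq x k} {seq y k} {ε} (eq k) ε>0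

  fromℚ : ℚ → ℝ
  seq    (fromℚ a) _ = a
  cauchy (fromℚ a) ε ε>0 = 0 , λ _ _ _ _ → small {a} {a} {ε} refl ε>0

  infixl 6 _+ʳ_ _-ʳ_
  infixl 7 _*ʳ_

  _+ʳ_ : ℝ → ℝ → ℝ
  seq    (x +ʳ y) k = seq x k ℚ.+ seq y k
  cauchy (x +ʳ y) = fromNull (λ k → seq x k ℚ.+ seq y k)
    (N₂.null-resp (λ (k , l) → regroup (seq x k) (seq x l) (seq y k) (seq y l))
      (N₂.null-+ (toNull x) (toNull y)))
    where
    regroup : ∀ a b c d → (a ℚ.- b) ℚ.+ (c ℚ.- d) ≡ (a ℚ.+ c) ℚ.- (b ℚ.+ d)
    regroup = solve 4 (λ a b c d → (a :- b) :+ (c :- d) := (a :+ c) :- (b :+ d)) refl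
      where open +-*-Solver

  -ʳ_ : ℝ → ℝ
  seq    (-ʳ x) k = ℚ.- seq x k
  cauchy (-ʳ x) = fromNull (λ k → ℚ.- seq x k)
    (N₂.null-resp (λ (k , l) → regroup (seq x k) (seq x l)) (N₂.null-neg (toNull x)))
    where
    regroup : ∀ a b → ℚ.- (a ℚ.- b) ≡ ℚ.- a ℚ.- ℚ.- b
    regroup = solve 2 (λ a b → :- (a :- b) := :- a :- :- b) refl
      where open +-*-Solver

  _-ʳ_ : ℝ → ℝ → ℝ
  x -ʳ y = x +ʳ (-ʳ y)

  _*ʳ_ : ℝ → ℝ → ℝ
  seq    (x *ʳ y) k = seq x k ℚ.* seq y k
  cauchy (x *ʳ y) = fromNull (λ k → seq x k ℚ.* seq y k)
    (N₂.null-resp (λ (k , l) → regroup (seq x k) (seq x l) (seq y k) (seq y l))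
      (N₂.null-+ (N₂.null-* (bounded₁ x) (toNull y)) (N₂.null-* (bounded₂ y) (toNull x))))
    where
    regroup : ∀ a b c d → a ℚ.* (c ℚ.- d) ℚ.+ d ℚ.* (a ℚ.- b) ≡ a ℚ.* c ℚ.- b ℚ.* d
    regroup = solve 4 (λ a b c d → a :* (c :- d) :+ d :* (a :- b) := a :* c :- b :* d) refl
      where open +-*-Solver

  private
    ≈ʳ-refl : ∀ {x} → x ≈ʳ x
    ≈ʳ-refl = from≡ λ _ → refl

    ≈ʳ-sym : ∀ {x y} → x ≈ʳ y → y ≈ʳ x
    ≈ʳ-sym {x} {y} p = mk≈ʳ (N₁.null-resp (λ k → flip-sub (seq x k) (seq y k)) (N₁.null-neg (close p)))
      where
      flip-sub : ∀ a b → ℚ.- (a ℚ.- b) ≡ b ℚ.- a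
      flip-sub = solve 2 (λ a b → :- (a :- b) := b :- a) refl
        where open +-*-Solver

    ≈ʳ-trans : ∀ {x y z} → x ≈ʳ y → y ≈ʳ z → x ≈ʳ z
    ≈ʳ-trans {x} {y} {z} p q = mk≈ʳ (N₁.null-resp (λ k → telescope (seq x k) (seq y k) (seq z k))
                                      (N₁.null-+ (close p) (close q)))
      where
      telescope : ∀ a b c → (a ℚ.- b) ℚ.+ (b ℚ.- c) ≡ a ℚ.- c
      telescope = solve 3 (λ a b c → (a :- b) :+ (b :- c) := a :- c) refl
        where open +-*-Solver

    +ʳ-cong : ∀ {x x′ y y′} → x ≈ʳ x′ → y ≈ʳ y′ → (x +ʳ y) ≈ʳ (x′ +ʳ y′)
    +ʳ-cong {x} {x′} {y} {y′} p q = mk≈ʳ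
      (N₁.null-resp (λ k → regroup (seq x k) (seq x′ k) (seq y k) (seq y′ k))
        (N₁.null-+ (close p) (close q)))
      where
      regroup : ∀ a b c d → (a ℚ.- b) ℚ.+ (c ℚ.- d) ≡ (a ℚ.+ c) ℚ.- (b ℚ.+ d)
      regroup = solve 4 (λ a b c d → (a :- b) :+ (c :- d) := (a :+ c) :- (b :+ d)) refl
        where open +-*-Solver

    -ʳ-cong : ∀ {x y} → x ≈ʳ y → (-ʳ x) ≈ʳ (-ʳ y)
    -ʳ-cong {x} {y} p = mk≈ʳ (N₁.null-resp (λ k → regroup (seq x k) (seq y k)) (N₁.null-neg (close p)))
      where
      regroup : ∀ a b → ℚ.- (a ℚ.- b) ≡ ℚ.- a ℚ.- ℚ.- b
      regroup = solve 2 (λ a b → :- (a :- b) := :- a :- :- b) refl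
        where open +-*-Solver

    *ʳ-cong : ∀ {x x′ y y′} → x ≈ʳ x′ → y ≈ʳ y′ → (x *ʳ y) ≈ʳ (x′ *ʳ y′)
    *ʳ-cong {x} {x′} {y} {y′} p q = mk≈ʳ
      (N₁.null-resp (λ k → regroup (seq x k) (seq x′ k) (seq y k) (seq y′ k))
        (N₁.null-+ (N₁.null-* (bounded x) (close q)) (N₁.null-* (bounded y′) (close p))))
      where
      regroup : ∀ a b c d → a ℚ.* (c ℚ.- d) ℚ.+ d ℚ.* (a ℚ.- b) ≡ a ℚ.* c ℚ.- b ℚ.* d
      regroup = solve 4 (λ a b c d → a :* (c :- d) :+ d :* (a :- b) := a :* c :- b :* d) refl
        where open +-*-Solver

  record ℂ : Set where
    no-eta-equality
    field
      re im : ℝ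

  open ℂ

  record _≈ᶜ_ (z w : ℂ) : Set where
    no-eta-equality
    pattern
    constructor _,_
    field
      re≈ : re z ≈ʳ re w
      im≈ : im z ≈ʳ im w

  open _≈ᶜ_

  0ᶜ 1ᶜ : ℂ
  re 0ᶜ = fromℚ 0ℚ
  im 0ᶜ = fromℚ 0ℚ
  re 1ᶜ = fromℚ 1ℚ
  im 1ᶜ = fromℚ 0ℚ

  _+ᶜ_ _*ᶜ_ : ℂ → ℂ → ℂ
  re (z +ᶜ w) = re z +ʳ re w
  im (z +ᶜ w) = im z +ʳ im w
  re (z *ᶜ w) = re z *ʳ re w -ʳ im z *ʳ im w
  im (z *ᶜ w) = re z *ʳ im w +ʳ im z *ʳ re w

  -ᶜ_ : ℂ → ℂ
  re (-ᶜ z) = -ʳ re z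
  im (-ᶜ z) = -ʳ im z

  private
    module Laws where
      open +-*-Solver

      *a-re : ∀ a b c d e f → (a ℚ.* c ℚ.- b ℚ.* d) ℚ.* e ℚ.- (a ℚ.* d ℚ.+ b ℚ.* c) ℚ.* f
            ≡ a ℚ.* (c ℚ.* e ℚ.- d ℚ.* f) ℚ.- b ℚ.* (c ℚ.* f ℚ.+ d ℚ.* e)
      *a-re = solve 6 (λ a b c d e f → (a :* c :- b :* d) :* e :- (a :* d :+ b :* c) :* f
            := a :* (c :* e :- d :* f) :- b :* (c :* f :+ d :* e)) refl

      *a-im : ∀ a b c d e f → (a ℚ.* c ℚ.- b ℚ.* d) ℚ.* f ℚ.+ (a ℚ.* d ℚ.+ b ℚ.* c) ℚ.* e
            ≡ a ℚ.* (c ℚ.* f ℚ.+ d ℚ.* e) ℚ.+ b ℚ.* (c ℚ.* e ℚ.- d ℚ.* f)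
      *a-im = solve 6 (λ a b c d e f → (a :* c :- b :* d) :* f :+ (a :* d :+ b :* c) :* e
            := a :* (c :* f :+ d :* e) :+ b :* (c :* e :- d :* f)) refl

      1l-re : ∀ a b → 1ℚ ℚ.* a ℚ.- 0ℚ ℚ.* b
            ≡ a
      1l-re = solve 2 (λ a b → con 1ℚ :* a :- con 0ℚ :* b
            := a) refl

      1l-im : ∀ a b → 1ℚ ℚ.* b ℚ.+ 0ℚ ℚ.* a
            ≡ b
      1l-im = solve 2 (λ a b → con 1ℚ :* b :+ con 0ℚ :* a
            := b) refl

      dl-re : ∀ a b c d e f → a ℚ.* (c ℚ.+ e) ℚ.- b ℚ.* (d ℚ.+ f)
            ≡ (a ℚ.* c ℚ.- b ℚ.* d) ℚ.+ (a ℚ.* e ℚ.- b ℚ.* f)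
      dl-re = solve 6 (λ a b c d e f → a :* (c :+ e) :- b :* (d :+ f)
            := (a :* c :- b :* d) :+ (a :* e :- b :* f)) refl

      dl-im : ∀ a b c d e f → a ℚ.* (d ℚ.+ f) ℚ.+ b ℚ.* (c ℚ.+ e)
            ≡ (a ℚ.* d ℚ.+ b ℚ.* c) ℚ.+ (a ℚ.* f ℚ.+ b ℚ.* e)
      dl-im = solve 6 (λ a b c d e f → a :* (d :+ f) :+ b :* (c :+ e)
            := (a :* d :+ b :* c) :+ (a :* f :+ b :* e)) refl

      *c-re : ∀ a b c d → a ℚ.* c ℚ.- b ℚ.* d
            ≡ c ℚ.* a ℚ.- d ℚ.* b
      *c-re = solve 4 (λ a b c d → a :* c :- b :* d
            := c :* a :- d :* b) refl

      *c-im : ∀ a b c d → a ℚ.* d ℚ.+ b ℚ.* c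
            ≡ c ℚ.* b ℚ.+ d ℚ.* a
      *c-im = solve 4 (λ a b c d → a :* d :+ b :* c
            := c :* b :+ d :* a) refl

    module ℂ-laws where
      open Laws
      a b : ℂ → ℕ → ℚ
      a z k = seq (re z) k
      b z k = seq (im z) k

      ≈ᶜ-refl : ∀ {z} → z ≈ᶜ z
      ≈ᶜ-refl = ≈ʳ-refl , ≈ʳ-refl

      ≈ᶜ-sym : ∀ {z w} → z ≈ᶜ w → w ≈ᶜ z
      ≈ᶜ-sym (p , q) = ≈ʳ-sym p , ≈ʳ-sym q

      ≈ᶜ-trans : ∀ {z w v} → z ≈ᶜ w → w ≈ᶜ v → z ≈ᶜ v
      ≈ᶜ-trans (p , q) (p′ , q′) = ≈ʳ-trans p p′ , ≈ʳ-trans q q′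

      +ᶜ-cong : ∀ {z z′ w w′} → z ≈ᶜ z′ → w ≈ᶜ w′ → (z +ᶜ w) ≈ᶜ (z′ +ᶜ w′)
      +ᶜ-cong (p , q) (p′ , q′) = +ʳ-cong p p′ , +ʳ-cong q q′

      -ᶜ-cong : ∀ {z w} → z ≈ᶜ w → (-ᶜ z) ≈ᶜ (-ᶜ w)
      -ᶜ-cong (p , q) = -ʳ-cong p , -ʳ-cong q

      *ᶜ-cong : ∀ {z z′ w w′} → z ≈ᶜ z′ → w ≈ᶜ w′ → (z *ᶜ w) ≈ᶜ (z′ *ᶜ w′)
      *ᶜ-cong (p , q) (p′ , q′) = +ʳ-cong (*ʳ-cong p p′) (-ʳ-cong (*ʳ-cong q q′))
                                , +ʳ-cong (*ʳ-cong p q′) (*ʳ-cong q p′)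

      +ᶜ-assoc : ∀ x y z → ((x +ᶜ y) +ᶜ z) ≈ᶜ (x +ᶜ (y +ᶜ z))
      +ᶜ-assoc x y z = from≡ (λ k → ℚ.+-assoc (a x k) (a y k) (a z k))
                     , from≡ (λ k → ℚ.+-assoc (b x k) (b y k) (b z k))

      +ᶜ-comm : ∀ x y → (x +ᶜ y) ≈ᶜ (y +ᶜ x)
      +ᶜ-comm x y = from≡ (λ k → ℚ.+-comm (a x k) (a y k)) , from≡ (λ k → ℚ.+-comm (b x k) (b y k))

      +ᶜ-identityˡ : ∀ x → (0ᶜ +ᶜ x) ≈ᶜ x
      +ᶜ-identityˡ x = from≡ (λ k → ℚ.+-identityˡ (a x k)) , from≡ (λ k → ℚ.+-identityˡ (b x k))

      -ᶜ-inverseˡ : ∀ x → ((-ᶜ x) +ᶜ x) ≈ᶜ 0ᶜ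
      -ᶜ-inverseˡ x = from≡ (λ k → ℚ.+-inverseˡ (a x k)) , from≡ (λ k → ℚ.+-inverseˡ (b x k))

      *ᶜ-assoc : ∀ x y z → ((x *ᶜ y) *ᶜ z) ≈ᶜ (x *ᶜ (y *ᶜ z))
      *ᶜ-assoc x y z = from≡ (λ k → *a-re (a x k) (b x k) (a y k) (b y k) (a z k) (b z k))
                     , from≡ (λ k → *a-im (a x k) (b x k) (a y k) (b y k) (a z k) (b z k))

      *ᶜ-comm : ∀ x y → (x *ᶜ y) ≈ᶜ (y *ᶜ x)
      *ᶜ-comm x y = from≡ (λ k → *c-re (a x k) (b x k) (a y k) (b y k))
                  , from≡ (λ k → *c-im (a x k) (b x k) (a y k) (b y k))

      *ᶜ-identityˡ : ∀ x → (1ᶜ *ᶜ x) ≈ᶜ x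
      *ᶜ-identityˡ x = from≡ (λ k → 1l-re (a x k) (b x k)) , from≡ (λ k → 1l-im (a x k) (b x k))

      *ᶜ-distribˡ : ∀ x y z → (x *ᶜ (y +ᶜ z)) ≈ᶜ ((x *ᶜ y) +ᶜ (x *ᶜ z))
      *ᶜ-distribˡ x y z = from≡ (λ k → dl-re (a x k) (b x k) (a y k) (b y k) (a z k) (b z k))
                        , from≡ (λ k → dl-im (a x k) (b x k) (a y k) (b y k) (a z k) (b z k))

      ≈ᶜ-setoid : Setoid 0ℓ 0ℓ
      ≈ᶜ-setoid = record { Carrier = ℂ ; _≈_ = _≈ᶜ_ ; isEquivalence = record { refl = ≈ᶜ-refl ; sym = ≈ᶜ-sym ; trans = ≈ᶜ-trans } }

  ℂ-commutativeRing : CommutativeRing 0ℓ 0ℓ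
  ℂ-commutativeRing = record
    { Carrier = ℂ
    ; _≈_ = _≈ᶜ_ ; _+_ = _+ᶜ_ ; _*_ = _*ᶜ_ ; -_ = -ᶜ_ ; 0# = 0ᶜ ; 1# = 1ᶜ
    ; isCommutativeRing = record
      { isRing = record
        { +-isAbelianGroup = record
          { isGroup = record
            { isMonoid = record
              { isSemigroup = record
                { isMagma = record { isEquivalence = Setoid.isEquivalence ≈ᶜ-setoid ; ∙-cong = +ᶜ-cong }
                ; assoc = +ᶜ-assoc
                }
              ; identity = comm∧idˡ⇒id +ᶜ-comm +ᶜ-identityˡ
              }
            ; inverse = comm∧invˡ⇒inv +ᶜ-comm -ᶜ-inverseˡ
            ; ⁻¹-cong = -ᶜ-cong
            }
          ; comm = +ᶜ-comm
          }
        ; *-cong = *ᶜ-cong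
        ; *-assoc = *ᶜ-assoc
        ; *-identity = comm∧idˡ⇒id *ᶜ-comm *ᶜ-identityˡ
        ; distrib = comm∧distrˡ⇒distr +ᶜ-cong *ᶜ-comm *ᶜ-distribˡ
        }
      ; *-comm = *ᶜ-comm
      }
    }
    where
    open ℂ-laws
    open import Algebra.Consequences.Setoid ≈ᶜ-setoid

  -- z ≠ 0 in the positive sense: equality of complex numbers is undecidable, and
  -- the negation of z ≈ᶜ 0ᶜ would not provide an inverse.
  ℂˣ : ℂ → Set
  ℂˣ = Invertible _≈ᶜ_ 1ᶜ _*ᶜ_

module SymmetricGroup where

  open import Data.Bool.Base using (Bool; true; false; if_then_else_)
  open import Data.Fin.Base as Fin using (Fin; zero; suc; inject₁; toℕ; punchIn)
  import Data.Fin.Properties as Fin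
  open import Data.Fin.Permutation as Perm using (Permutation′; _⟨$⟩ʳ_; _⟨$⟩ˡ_)
  open import Data.List.Base as List using (List; []; _∷_; _++_; map; concatMap; foldr; length; filter; allFin)
  import Data.List.Properties as List
  open import Data.Nat.Base as ℕ using (ℕ; zero; suc; _+_)
  import Data.Nat.Properties as ℕ
  open import Data.Nat.Base using (_!)
  open import Data.List.Relation.Unary.Any as Any using (Any; here; there)
  import Data.List.Relation.Unary.Any.Properties as Any
  open import Data.List.Membership.Propositional.Properties using (∈-allFin)
  open import Data.Product using (_×_; _,_; proj₁; proj₂; ∃)
  open import Function.Base using (_∘_)
  open import Function.Bundles using (mk⇔)
  open import Relation.Nullary using (Dec; does)
  open import Relation.Nullary.Decidable using (does-⇔)
  open import Relation.Binary.PropositionalEquality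
  open ≡-Reasoning

  -- The simple transpositions of S_{m+1} are indexed by Fin m.
  s : ∀ {m} → Fin m → Permutation′ (suc m)
  s i = Perm.transpose (inject₁ i) (suc i)

  allPermutations : ∀ n → List (Permutation′ n)
  allPermutations zero    = Perm.id ∷ []
  allPermutations (suc n) =
    concatMap (λ k → map (Perm.insert zero k) (allPermutations n)) (allFin (suc n))

  allPermutations-complete : ∀ {n} (w : Permutation′ n) → Any (Perm._≈ w) (allPermutations n)
  allPermutations-complete {zero}  w = here λ ()
  allPermutations-complete {suc n} w =
    Any.concatMap⁺ _ (Any.map
      (λ { {k} refl → Any.map⁺ (Any.map (λ {v} v≈ → insert-≈ v v≈) (allPermutations-complete (Perm.remove zero w))) })
      (∈-allFin (w ⟨$⟩ʳ zero)))
    where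
    insert-≈ : ∀ v → v Perm.≈ Perm.remove zero w → Perm.insert zero (w ⟨$⟩ʳ zero) v Perm.≈ w
    insert-≈ v v≈ zero    = refl
    insert-≈ v v≈ (suc j) = trans (cong (punchIn (w ⟨$⟩ʳ zero)) (v≈ j)) (sym (Perm.punchIn-permute w zero j))

  allPermutations-length : ∀ n → length (allPermutations n) ≡ n !
  allPermutations-length zero    = refl
  allPermutations-length (suc n) = trans
    (blocks (allFin (suc n)) )
    (cong₂ ℕ._*_ (List.length-tabulate {n = suc n} (λ i → i)) (allPermutations-length n))
    where
    blocks : ∀ ks → length (concatMap (λ k → map (Perm.insert zero k) (allPermutations n)) ks)
                  ≡ length ks ℕ.* length (allPermutations n)
    blocks []       = refl
    blocks (k ∷ ks) = trans (List.length-++ (map (Perm.insert zero k) (allPermutations n)))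
      (cong₂ _+_ (List.length-map _ (allPermutations n)) (blocks ks))

  -- All pairs (i , j) with i < j.
  pairs : ∀ n → List (Fin n × Fin n)
  pairs zero    = []
  pairs (suc n) = map (λ j → zero , suc j) (allFin n) ++ map (λ (i , j) → suc i , suc j) (pairs n)

  ℓ : ∀ {n} → Permutation′ n → ℕ
  ℓ {n} w = length (filter (λ (i , j) → (w ⟨$⟩ʳ j) Fin.<? (w ⟨$⟩ʳ i)) (pairs n))

  w₀ : ∀ {n} → Permutation′ n
  w₀ = Perm.reverse

  -- The word i₁ ∷ … ∷ iₗ ∷ [] stands for s_{i₁} ⋯ s_{iₗ}; the composition π ∘ₚ ρ
  -- applies π first.
  product : ∀ {m} → List (Fin m) → Permutation′ (suc m)
  product = foldr (λ i w → w Perm.∘ₚ s i) Perm.id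

  record IsReducedWord {m} (w : Permutation′ (suc m)) (word : List (Fin m)) : Set where
    field
      product-≈ : product word Perm.≈ w
      length-≡  : length word ≡ ℓ w

  open IsReducedWord

  -- s_{k-1} ⋯ s_1 s_0, the cycle 0 ↦ k, j + 1 ↦ punchIn k j.
  cycleWord : ∀ {m} → Fin (suc m) → List (Fin m)
  cycleWord zero            = []
  cycleWord {suc m} (suc k) = map suc (cycleWord k) ++ zero ∷ []

  normalWord : ∀ {m} → Permutation′ (suc m) → List (Fin m)
  normalWord {zero}  w = []
  normalWord {suc m} w = cycleWord (w ⟨$⟩ʳ zero) ++ map suc (normalWord (Perm.remove zero w))

  product-++ : ∀ {m} (u v : List (Fin m)) j →
               product (u ++ v) ⟨$⟩ʳ j ≡ product u ⟨$⟩ʳ (product v ⟨$⟩ʳ j)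
  product-++ []      v j = refl
  product-++ (i ∷ u) v j = cong (s i ⟨$⟩ʳ_) (product-++ u v j)

  product-suc : ∀ {m} (u : List (Fin m)) → product (map suc u) Perm.≈ Perm.lift₀ (product u)
  product-suc []      zero    = refl
  product-suc []      (suc j) = refl
  product-suc (i ∷ u) j = trans (cong (s (suc i) ⟨$⟩ʳ_) (product-suc u j))
    (trans (Perm.lift₀-transpose (inject₁ i) (suc i) (Perm.lift₀ (product u) ⟨$⟩ʳ j))
           (Perm.lift₀-comp (product u) (s i) j))

  cycle-zero : ∀ {m} (k : Fin (suc m)) → product (cycleWord k) ⟨$⟩ʳ zero ≡ k
  cycle-zero zero            = refl
  cycle-zero {suc m} (suc k) = trans (product-++ (map suc (cycleWord k)) (zero ∷ []) zero)
    (trans (product-suc (cycleWord k) (suc zero)) (cong suc (cycle-zero k)))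

  cycle-suc : ∀ {m} (k : Fin (suc m)) (j : Fin m) → product (cycleWord k) ⟨$⟩ʳ suc j ≡ punchIn k j
  cycle-suc zero    j       = refl
  cycle-suc (suc k) zero    = trans (product-++ (map suc (cycleWord k)) (zero ∷ []) (suc zero))
    (product-suc (cycleWord k) zero)
  cycle-suc (suc k) (suc j) = trans (product-++ (map suc (cycleWord k)) (zero ∷ []) (suc (suc j)))
    (trans (product-suc (cycleWord k) (suc (suc j))) (cong suc (cycle-suc k j)))

  normalWord-product : ∀ {m} (w : Permutation′ (suc m)) → product (normalWord w) Perm.≈ w
  normalWord-product {zero} w zero with w ⟨$⟩ʳ zero
  ... | zero = refl
  normalWord-product {suc m} w j =
    trans (product-++ (cycleWord (w ⟨$⟩ʳ zero)) (map suc (normalWord (Perm.remove zero w))) j)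
    (trans (cong (product (cycleWord (w ⟨$⟩ʳ zero)) ⟨$⟩ʳ_)
             (trans (product-suc (normalWord (Perm.remove zero w)) j)
                    (Perm.lift₀-cong _ _ (normalWord-product (Perm.remove zero w)) j)))
           (split j))
    where
    split : ∀ j → product (cycleWord (w ⟨$⟩ʳ zero)) ⟨$⟩ʳ (Perm.lift₀ (Perm.remove zero w) ⟨$⟩ʳ j) ≡ w ⟨$⟩ʳ j
    split zero    = cycle-zero (w ⟨$⟩ʳ zero)
    split (suc j) = trans (cycle-suc (w ⟨$⟩ʳ zero) _) (sym (Perm.punchIn-permute w zero j))

  count : ∀ {A : Set} → (A → Bool) → List A → ℕ
  count p []       = 0
  count p (x ∷ xs) = (if p x then 1 else 0) + count p xs

  count-filter : ∀ {A : Set} {P : A → Set} (P? : ∀ x → Dec (P x)) xs →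
                 length (filter P? xs) ≡ count (does ∘ P?) xs
  count-filter P? []       = refl
  count-filter P? (x ∷ xs) with does (P? x)
  ... | true  = cong suc (count-filter P? xs)
  ... | false = count-filter P? xs

  count-++ : ∀ {A : Set} (p : A → Bool) xs ys → count p (xs ++ ys) ≡ count p xs + count p ys
  count-++ p []       ys = refl
  count-++ p (x ∷ xs) ys = trans (cong ((if p x then 1 else 0) +_) (count-++ p xs ys))
                                 (sym (ℕ.+-assoc (if p x then 1 else 0) _ _))

  count-map : ∀ {A B : Set} (p : B → Bool) (f : A → B) xs → count p (map f xs) ≡ count (p ∘ f) xs
  count-map p f []       = refl
  count-map p f (x ∷ xs) = cong ((if p (f x) then 1 else 0) +_) (count-map p f xs)

  count-cong : ∀ {A : Set} {p q : A → Bool} → (∀ x → p x ≡ q x) → ∀ xs → count p xs ≡ count q xs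
  count-cong eq []       = refl
  count-cong eq (x ∷ xs) = cong₂ _+_ (cong (if_then 1 else 0) (eq x)) (count-cong eq xs)

  open import Algebra.Properties.CommutativeMonoid.Sum ℕ.+-0-commutativeMonoid using (sum; sum-permute; sum-cong-≗)

  count-tabulate : ∀ {A : Set} (p : A → Bool) {n} (f : Fin n → A) →
                   count p (List.tabulate f) ≡ sum (λ i → if p (f i) then 1 else 0)
  count-tabulate p {zero}  f = refl
  count-tabulate p {suc n} f = cong ((if p (f zero) then 1 else 0) +_) (count-tabulate p (f ∘ suc))

  punchIn-< : ∀ {m} (k : Fin (suc m)) (j : Fin m) →
              does (punchIn k j Fin.<? k) ≡ does (toℕ j ℕ.<? toℕ k)
  punchIn-< zero    j       = refl
  punchIn-< (suc k) zero    = refl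
  punchIn-< (suc k) (suc j) = punchIn-< k j

  punchIn-mono : ∀ {m} (k : Fin (suc m)) (i j : Fin m) →
                 does (punchIn k i Fin.<? punchIn k j) ≡ does (i Fin.<? j)
  punchIn-mono zero    i       j       = refl
  punchIn-mono (suc k) zero    zero    = refl
  punchIn-mono (suc k) zero    (suc j) = refl
  punchIn-mono (suc k) (suc i) zero    = refl
  punchIn-mono (suc k) (suc i) (suc j) = punchIn-mono k i j

  sum-< : ∀ {m} (k : Fin (suc m)) → sum {m} (λ j → if does (toℕ j ℕ.<? toℕ k) then 1 else 0) ≡ toℕ k
  sum-< {zero}  zero    = refl
  sum-< {suc m} zero    = sum-< {m} zero
  sum-< {suc m} (suc k) = cong suc (sum-< k)

  inv : ∀ {n} → Permutation′ n → Fin n × Fin n → Bool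
  inv w (i , j) = does ((w ⟨$⟩ʳ j) Fin.<? (w ⟨$⟩ʳ i))

  ℓ-step : ∀ {n} (w : Permutation′ (suc n)) → ℓ w ≡ toℕ (w ⟨$⟩ʳ zero) + ℓ (Perm.remove zero w)
  ℓ-step {n} w = begin
    ℓ w
      ≡⟨ count-filter _ (pairs (suc n)) ⟩
    count (inv w) (pairs (suc n))
      ≡⟨ count-++ (inv w) (map (λ j → zero , suc j) (allFin n)) _ ⟩
    count (inv w) (map (λ j → zero , suc j) (allFin n)) + count (inv w) (map (λ (i , j) → suc i , suc j) (pairs n))
      ≡⟨ cong₂ _+_ first rest ⟩
    toℕ k + ℓ v ∎
    where
    k = w ⟨$⟩ʳ zero
    v = Perm.remove zero w
    first : count (inv w) (map (λ j → zero , suc j) (allFin n)) ≡ toℕ k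
    first = begin
      count (inv w) (map (λ j → zero , suc j) (allFin n))
        ≡⟨ count-map (inv w) _ (allFin n) ⟩
      count (λ j → inv w (zero , suc j)) (allFin n)
        ≡⟨ count-cong (λ j → trans (cong (λ i → does (i Fin.<? k)) (Perm.punchIn-permute w zero j))
                                   (punchIn-< k (v ⟨$⟩ʳ j))) (allFin n) ⟩
      count (λ j → does (toℕ (v ⟨$⟩ʳ j) ℕ.<? toℕ k)) (allFin n)
        ≡⟨ count-tabulate _ {n} (λ j → j) ⟩
      sum {n} (λ j → if does (toℕ (v ⟨$⟩ʳ j) ℕ.<? toℕ k) then 1 else 0)
        ≡⟨ sum-permute {n} {n} (λ j → if does (toℕ j ℕ.<? toℕ k) then 1 else 0) v ⟨
      sum {n} (λ j → if does (toℕ j ℕ.<? toℕ k) then 1 else 0)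
        ≡⟨ sum-< k ⟩
      toℕ k ∎
    rest : count (inv w) (map (λ (i , j) → suc i , suc j) (pairs n)) ≡ ℓ v
    rest = begin
      count (inv w) (map (λ (i , j) → suc i , suc j) (pairs n))
        ≡⟨ count-map (inv w) _ (pairs n) ⟩
      count (λ (i , j) → inv w (suc i , suc j)) (pairs n)
        ≡⟨ count-cong (λ (i , j) → trans
             (cong₂ (λ a b → does (a Fin.<? b)) (Perm.punchIn-permute w zero j) (Perm.punchIn-permute w zero i))
             (punchIn-mono k (v ⟨$⟩ʳ j) (v ⟨$⟩ʳ i))) (pairs n) ⟩
      count (inv v) (pairs n)
        ≡⟨ count-filter _ (pairs n) ⟨
      ℓ v ∎

  length-cycleWord : ∀ {m} (k : Fin (suc m)) → length (cycleWord k) ≡ toℕ k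
  length-cycleWord zero            = refl
  length-cycleWord {suc m} (suc k) = begin
    length (map suc (cycleWord k) ++ zero ∷ []) ≡⟨ List.length-++ (map suc (cycleWord k)) ⟩
    length (map suc (cycleWord k)) + 1          ≡⟨ ℕ.+-comm _ 1 ⟩
    suc (length (map suc (cycleWord k)))        ≡⟨ cong suc (List.length-map suc (cycleWord k)) ⟩
    suc (length (cycleWord k))                  ≡⟨ cong suc (length-cycleWord k) ⟩
    suc (toℕ k)                                 ∎

  normalWord-length : ∀ {m} (w : Permutation′ (suc m)) → length (normalWord w) ≡ ℓ w
  normalWord-length {zero}  w = refl
  normalWord-length {suc m} w = begin
    length (cycleWord (w ⟨$⟩ʳ zero) ++ map suc (normalWord v)) ≡⟨ List.length-++ (cycleWord (w ⟨$⟩ʳ zero)) ⟩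
    length (cycleWord (w ⟨$⟩ʳ zero)) + length (map suc (normalWord v))
      ≡⟨ cong₂ _+_ (length-cycleWord (w ⟨$⟩ʳ zero))
           (trans (List.length-map suc (normalWord v)) (normalWord-length v)) ⟩
    toℕ (w ⟨$⟩ʳ zero) + ℓ v ≡⟨ ℓ-step w ⟨
    ℓ w ∎
    where v = Perm.remove zero w

  reducedWord : ∀ {m} (w : Permutation′ (suc m)) → ∃ (IsReducedWord w)
  reducedWord w = normalWord w , record
    { product-≈ = normalWord-product w ; length-≡ = normalWord-length w }

module LaurentPolynomials where

  open import Level using (Level; _⊔_)
  open import Algebra.Bundles using (CommutativeRing)
  open import Data.Bool.Base using (Bool; true; false; if_then_else_)
  open import Data.Fin.Base using (Fin; zero; suc)
  open import Data.Fin.Permutation as Perm using (Permutation′; _⟨$⟩ʳ_; _⟨$⟩ˡ_)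
  open import Data.Integer.Base as ℤ using (ℤ; 0ℤ; 1ℤ; -1ℤ)
  import Data.Integer.Properties as ℤ
  open import Data.List.Base as List using (List; []; _∷_; _++_; map; concatMap; foldr)
  import Data.List.Properties as List
  open import Data.Nat.Base using (ℕ)
  open import Data.Product using (_×_; _,_; proj₁; proj₂)
  open import Data.Vec.Base as Vec using (Vec; lookup; tabulate; zipWith; replicate; _[_]≔_)
  import Data.Vec.Properties as Vec
  open import Function.Base using (_∘_)
  open import Function.Bundles using (mk⇔)
  open import Relation.Nullary using (Dec; does)
  open import Relation.Nullary.Decidable using (does-⇔)
  open import Relation.Binary.Bundles using (Setoid)
  import Relation.Binary.PropositionalEquality as ≡
  open ≡ using (_≡_)

  module Laurent {c r : Level} (𝕂 : CommutativeRing c r) (n : ℕ) where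

    open CommutativeRing 𝕂 renaming (Carrier to K)
    open import Algebra.Properties.Ring ring using (-‿+-comm; -0#≈0#)
    open import Algebra.Properties.CommutativeSemigroup +-commutativeSemigroup using (interchange; x∙yz≈y∙xz)
    open import Algebra.Properties.CommutativeSemigroup *-commutativeSemigroup
      using () renaming (x∙yz≈y∙xz to *-swap)

    Exponent : Set
    Exponent = Vec ℤ n

    infixl 6 _⊕_

    _⊕_ : Exponent → Exponent → Exponent
    _⊕_ = zipWith ℤ._+_

    ⊖_ : Exponent → Exponent
    ⊖_ = Vec.map (λ z → ℤ.- z)

    0ᴱ : Exponent
    0ᴱ = replicate n 0ℤ

    _≟ᴱ_ : (a b : Exponent) → Dec (a ≡ b)
    _≟ᴱ_ = Vec.≡-dec ℤ._≟_

    permuteᴱ : Permutation′ n → Exponent → Exponent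
    permuteᴱ w a = tabulate λ j → lookup a (w ⟨$⟩ˡ j)

    -- Finite formal sums of terms c·x^a.  The same exponent may occur several
    -- times, so equality compares total coefficients.
    Laurent : Set c
    Laurent = List (K × Exponent)

    coeff : Laurent → Exponent → K
    coeff []            e = 0#
    coeff ((k , a) ∷ f) e = (if does (a ≟ᴱ e) then k else 0#) + coeff f e

    infix 4 _≋_

    record _≋_ (f g : Laurent) : Set r where
      constructor mk≋
      field
        at : ∀ e → coeff f e ≈ coeff g e

    open _≋_ public

    infixl 6 _+ᴸ_ _-ᴸ_
    infixl 7 _*ᴸ_ _⊛_ _·_
    infix  8 -ᴸ_

    0ᴸ : Laurent
    0ᴸ = []

    const : K → Laurent
    const k = (k , 0ᴱ) ∷ []

    1ᴸ : Laurent
    1ᴸ = const 1#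

    infixr 8 _•_

    -- Opaque so that unification does not reduce these to list operations.
    opaque
      _+ᴸ_ : Laurent → Laurent → Laurent
      _+ᴸ_ = _++_

      -ᴸ_ : Laurent → Laurent
      -ᴸ_ = map λ (k , a) → - k , a

      _⊛_ : K × Exponent → Laurent → Laurent
      (k , a) ⊛ g = map (λ (l , b) → k * l , a ⊕ b) g

      _*ᴸ_ : Laurent → Laurent → Laurent
      f *ᴸ g = concatMap (_⊛ g) f

      -- The action of S_n on ℂ[X], determined by w xᵢ = x_{w(i)}.
      _•_ : Permutation′ n → Laurent → Laurent
      w • f = map (λ (k , a) → k , permuteᴱ w a) f

    _-ᴸ_ : Laurent → Laurent → Laurent
    f -ᴸ g = f +ᴸ (-ᴸ g)

    _·_ : K → Laurent → Laurent
    k · f = const k *ᴸ f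

    x x⁻¹ : Fin n → Laurent
    x   i = (1# , 0ᴱ [ i ]≔  1ℤ) ∷ []
    x⁻¹ i = (1# , 0ᴱ [ i ]≔ -1ℤ) ∷ []

    ext : ∀ {a b : Exponent} → (∀ j → lookup a j ≡ lookup b j) → a ≡ b
    ext {a} {b} eq = ≡.trans (≡.sym (Vec.tabulate∘lookup a))
                       (≡.trans (Vec.tabulate-cong eq) (Vec.tabulate∘lookup b))

    ⊕-assoc : ∀ a b d → (a ⊕ b) ⊕ d ≡ a ⊕ (b ⊕ d)
    ⊕-assoc = Vec.zipWith-assoc ℤ.+-assoc

    ⊕-comm : ∀ a b → a ⊕ b ≡ b ⊕ a
    ⊕-comm = Vec.zipWith-comm ℤ.+-comm

    ⊕-identityˡ : ∀ a → 0ᴱ ⊕ a ≡ a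
    ⊕-identityˡ = Vec.zipWith-identityˡ ℤ.+-identityˡ

    ⊕-inverseˡ : ∀ a → ⊖ a ⊕ a ≡ 0ᴱ
    ⊕-inverseˡ = Vec.zipWith-inverseˡ ℤ.+-inverseˡ

    ⊖⊕-cancel : ∀ a b → ⊖ a ⊕ (a ⊕ b) ≡ b
    ⊖⊕-cancel a b = ≡.trans (≡.sym (⊕-assoc (⊖ a) a b))
                      (≡.trans (≡.cong (_⊕ b) (⊕-inverseˡ a)) (⊕-identityˡ b))

    ⊕⊖-cancel : ∀ a b → a ⊕ (⊖ a ⊕ b) ≡ b
    ⊕⊖-cancel a b = ≡.trans (≡.sym (⊕-assoc a (⊖ a) b))
      (≡.trans (≡.cong (_⊕ b) (≡.trans (⊕-comm a (⊖ a)) (⊕-inverseˡ a))) (⊕-identityˡ b))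

    permuteᴱ-lookup : ∀ w a j → lookup (permuteᴱ w a) j ≡ lookup a (w ⟨$⟩ˡ j)
    permuteᴱ-lookup w a = Vec.lookup∘tabulate _

    permuteᴱ-⊕ : ∀ w a b → permuteᴱ w (a ⊕ b) ≡ permuteᴱ w a ⊕ permuteᴱ w b
    permuteᴱ-⊕ w a b = ext λ j →
      ≡.trans (permuteᴱ-lookup w (a ⊕ b) j)
      (≡.trans (Vec.lookup-zipWith ℤ._+_ (w ⟨$⟩ˡ j) a b)
      (≡.sym (≡.trans (Vec.lookup-zipWith ℤ._+_ j (permuteᴱ w a) (permuteᴱ w b))
        (≡.cong₂ ℤ._+_ (permuteᴱ-lookup w a j) (permuteᴱ-lookup w b j)))))

    permuteᴱ-flipˡ : ∀ w a → permuteᴱ (Perm.flip w) (permuteᴱ w a) ≡ a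
    permuteᴱ-flipˡ w a = ext λ j →
      ≡.trans (permuteᴱ-lookup (Perm.flip w) (permuteᴱ w a) j)
      (≡.trans (permuteᴱ-lookup w a (w ⟨$⟩ʳ j)) (≡.cong (lookup a) (Perm.inverseˡ w)))

    permuteᴱ-flipʳ : ∀ w a → permuteᴱ w (permuteᴱ (Perm.flip w) a) ≡ a
    permuteᴱ-flipʳ w a = permuteᴱ-flipˡ (Perm.flip w) a

    permuteᴱ-0 : ∀ w → permuteᴱ w 0ᴱ ≡ 0ᴱ
    permuteᴱ-0 w = ext λ j → ≡.trans (permuteᴱ-lookup w 0ᴱ j)
      (≡.trans (Vec.lookup-replicate (w ⟨$⟩ˡ j) 0ℤ) (≡.sym (Vec.lookup-replicate j 0ℤ)))

    private
      if-cong : ∀ (b : Bool) {p q} → p ≈ q → (if b then p else 0#) ≈ (if b then q else 0#)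
      if-cong true  p≈q = p≈q
      if-cong false _   = refl

      if-* : ∀ k (b : Bool) {p} → (if b then k * p else 0#) ≈ k * (if b then p else 0#)
      if-* k true  = refl
      if-* k false = sym (zeroʳ k)

      if-neg : ∀ (b : Bool) {p} → (if b then - p else 0#) ≈ - (if b then p else 0#)
      if-neg true  = refl
      if-neg false = sym -0#≈0#

    opaque
      unfolding _+ᴸ_

      coeff-+ : ∀ f g e → coeff (f +ᴸ g) e ≈ coeff f e + coeff g e
      coeff-+ []      g e = sym (+-identityˡ _)
      coeff-+ (u ∷ f) g e = trans (+-congˡ (coeff-+ f g e)) (sym (+-assoc _ _ _))

      coeff-neg : ∀ f e → coeff (-ᴸ f) e ≈ - coeff f e
      coeff-neg []            e = sym -0#≈0#
      coeff-neg ((k , a) ∷ f) e =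
        trans (+-cong (if-neg (does (a ≟ᴱ e))) (coeff-neg f e)) (-‿+-comm _ _)

      coeff-⊛ : ∀ k a g e → coeff ((k , a) ⊛ g) e ≈ k * coeff g (⊖ a ⊕ e)
      coeff-⊛ k a []            e = sym (zeroʳ k)
      coeff-⊛ k a ((l , b) ∷ g) e = trans
        (+-cong
          (trans
            (reflexive (≡.cong (λ d → if d then k * l else 0#)
              (does-⇔ (mk⇔ (λ { ≡.refl → ≡.sym (⊖⊕-cancel a b) })
                           (λ { ≡.refl → ⊕⊖-cancel a e }))
                      ((a ⊕ b) ≟ᴱ e) (b ≟ᴱ (⊖ a ⊕ e)))))
            (if-* k (does (b ≟ᴱ (⊖ a ⊕ e)))))
          (coeff-⊛ k a g e))
        (sym (distribˡ k _ _))

      coeff-• : ∀ w f e → coeff (w • f) e ≈ coeff f (permuteᴱ (Perm.flip w) e)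
      coeff-• w []            e = refl
      coeff-• w ((k , a) ∷ f) e = +-cong
        (reflexive (≡.cong (λ d → if d then k else 0#)
          (does-⇔ (mk⇔ (λ { ≡.refl → ≡.sym (permuteᴱ-flipˡ w a) })
                       (λ { ≡.refl → permuteᴱ-flipʳ w e }))
                  (permuteᴱ w a ≟ᴱ e) (a ≟ᴱ permuteᴱ (Perm.flip w) e))))
        (coeff-• w f e)

    ≋-refl : ∀ {f} → f ≋ f
    ≋-refl = mk≋ λ _ → refl

    ≋-sym : ∀ {f g} → f ≋ g → g ≋ f
    ≋-sym p = mk≋ λ e → sym (at p e)

    ≋-trans : ∀ {f g h} → f ≋ g → g ≋ h → f ≋ h
    ≋-trans p q = mk≋ λ e → trans (at p e) (at q e)

    ≋-reflexive : ∀ {f g} → f ≡ g → f ≋ g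
    ≋-reflexive ≡.refl = ≋-refl

    ≋-setoid : Setoid c r
    ≋-setoid = record
      { Carrier = Laurent ; _≈_ = _≋_
      ; isEquivalence = record { refl = ≋-refl ; sym = ≋-sym ; trans = ≋-trans } }

    open import Relation.Binary.Reasoning.Setoid ≋-setoid

    opaque
      unfolding _+ᴸ_

      ∷-cong : ∀ {k l a b f g} → k ≈ l → a ≡ b → f ≋ g → ((k , a) ∷ f) ≋ ((l , b) ∷ g)
      ∷-cong {a = a} p ≡.refl q = mk≋ λ e → +-cong (if-cong (does (a ≟ᴱ e)) p) (at q e)

      +ᴸ-cong : ∀ {f f′ g g′} → f ≋ f′ → g ≋ g′ → f +ᴸ g ≋ f′ +ᴸ g′
      +ᴸ-cong {f} {f′} {g} {g′} p q = mk≋ λ e →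
        trans (coeff-+ f g e) (trans (+-cong (at p e) (at q e)) (sym (coeff-+ f′ g′ e)))

      +ᴸ-comm : ∀ f g → f +ᴸ g ≋ g +ᴸ f
      +ᴸ-comm f g = mk≋ λ e →
        trans (coeff-+ f g e) (trans (+-comm _ _) (sym (coeff-+ g f e)))

      +ᴸ-assoc : ∀ f g h → (f +ᴸ g) +ᴸ h ≋ f +ᴸ (g +ᴸ h)
      +ᴸ-assoc f g h = ≋-reflexive (List.++-assoc f g h)

      +ᴸ-swap : ∀ f g h → f +ᴸ (g +ᴸ h) ≋ g +ᴸ (f +ᴸ h)
      +ᴸ-swap f g h = begin
        f +ᴸ (g +ᴸ h) ≈⟨ +ᴸ-assoc f g h ⟨
        (f +ᴸ g) +ᴸ h ≈⟨ +ᴸ-cong {g = h} (+ᴸ-comm f g) ≋-refl ⟩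
        (g +ᴸ f) +ᴸ h ≈⟨ +ᴸ-assoc g f h ⟩
        g +ᴸ (f +ᴸ h) ∎

      +ᴸ-identityˡ : ∀ f → 0ᴸ +ᴸ f ≋ f
      +ᴸ-identityˡ f = ≋-refl

      -ᴸ-cong : ∀ {f g} → f ≋ g → -ᴸ f ≋ -ᴸ g
      -ᴸ-cong {f} {g} p = mk≋ λ e →
        trans (coeff-neg f e) (trans (-‿cong (at p e)) (sym (coeff-neg g e)))

      -ᴸ-inverseˡ : ∀ f → -ᴸ f +ᴸ f ≋ 0ᴸ
      -ᴸ-inverseˡ f = mk≋ λ e →
        trans (coeff-+ (-ᴸ f) f e) (trans (+-congʳ (coeff-neg f e)) (-‿inverseˡ _))

      ⊛-cong : ∀ u {g g′} → g ≋ g′ → u ⊛ g ≋ u ⊛ g′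
      ⊛-cong (k , a) {g} {g′} p = mk≋ λ e →
        trans (coeff-⊛ k a g e) (trans (*-congˡ (at p _)) (sym (coeff-⊛ k a g′ e)))

      *ᴸ-congˡ : ∀ f {g g′} → g ≋ g′ → f *ᴸ g ≋ f *ᴸ g′
      *ᴸ-congˡ []      p = ≋-refl
      *ᴸ-congˡ (u ∷ f) p = +ᴸ-cong (⊛-cong u p) (*ᴸ-congˡ f p)

      *ᴸ-distribʳ : ∀ h f g → (f +ᴸ g) *ᴸ h ≋ f *ᴸ h +ᴸ g *ᴸ h
      *ᴸ-distribʳ h []      g = ≋-refl
      *ᴸ-distribʳ h (u ∷ f) g = begin
        u ⊛ h +ᴸ (f +ᴸ g) *ᴸ h         ≈⟨ +ᴸ-cong {u ⊛ h} ≋-refl (*ᴸ-distribʳ h f g) ⟩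
        u ⊛ h +ᴸ (f *ᴸ h +ᴸ g *ᴸ h)    ≈⟨ +ᴸ-assoc (u ⊛ h) (f *ᴸ h) (g *ᴸ h) ⟨
        u ⊛ h +ᴸ f *ᴸ h +ᴸ g *ᴸ h      ∎

      *ᴸ-cons : ∀ f u g → f *ᴸ (u ∷ g) ≋ u ⊛ f +ᴸ f *ᴸ g
      *ᴸ-cons []            u       g = ≋-refl
      *ᴸ-cons ((k , a) ∷ f) (l , b) g = ∷-cong (*-comm k l) (⊕-comm a b) (begin
        (k , a) ⊛ g +ᴸ f *ᴸ ((l , b) ∷ g)          ≈⟨ +ᴸ-cong {(k , a) ⊛ g} ≋-refl (*ᴸ-cons f (l , b) g) ⟩
        (k , a) ⊛ g +ᴸ ((l , b) ⊛ f +ᴸ f *ᴸ g)     ≈⟨ +ᴸ-swap ((k , a) ⊛ g) ((l , b) ⊛ f) (f *ᴸ g) ⟩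
        (l , b) ⊛ f +ᴸ ((k , a) ⊛ g +ᴸ f *ᴸ g)     ∎)

      *ᴸ-zeroʳ : ∀ f → f *ᴸ 0ᴸ ≋ 0ᴸ
      *ᴸ-zeroʳ []      = ≋-refl
      *ᴸ-zeroʳ (u ∷ f) = *ᴸ-zeroʳ f

      *ᴸ-comm : ∀ f g → f *ᴸ g ≋ g *ᴸ f
      *ᴸ-comm []      g = ≋-sym (*ᴸ-zeroʳ g)
      *ᴸ-comm (u ∷ f) g = begin
        u ⊛ g +ᴸ f *ᴸ g ≈⟨ +ᴸ-cong {u ⊛ g} ≋-refl (*ᴸ-comm f g) ⟩
        u ⊛ g +ᴸ g *ᴸ f ≈⟨ *ᴸ-cons g u f ⟨
        g *ᴸ (u ∷ f)    ∎

      *ᴸ-cong : ∀ {f f′ g g′} → f ≋ f′ → g ≋ g′ → f *ᴸ g ≋ f′ *ᴸ g′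
      *ᴸ-cong {f} {f′} {g} {g′} p q = begin
        f *ᴸ g   ≈⟨ *ᴸ-congˡ f q ⟩
        f *ᴸ g′  ≈⟨ *ᴸ-comm f g′ ⟩
        g′ *ᴸ f  ≈⟨ *ᴸ-congˡ g′ p ⟩
        g′ *ᴸ f′ ≈⟨ *ᴸ-comm g′ f′ ⟩
        f′ *ᴸ g′ ∎

      ⊛-⊛ : ∀ k a l b h → ((k * l , a ⊕ b) ⊛ h) ≋ (k , a) ⊛ ((l , b) ⊛ h)
      ⊛-⊛ k a l b []            = ≋-refl
      ⊛-⊛ k a l b ((m , d) ∷ h) = ∷-cong (*-assoc k l m) (⊕-assoc a b d) (⊛-⊛ k a l b h)

      ⊛-+ : ∀ u f g → u ⊛ (f +ᴸ g) ≋ u ⊛ f +ᴸ u ⊛ g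
      ⊛-+ u f g = ≋-reflexive (List.map-++ _ f g)

      ⊛-* : ∀ u g h → (u ⊛ g) *ᴸ h ≋ u ⊛ (g *ᴸ h)
      ⊛-* u       []            h = ≋-refl
      ⊛-* (k , a) ((l , b) ∷ g) h = begin
        (k * l , a ⊕ b) ⊛ h +ᴸ ((k , a) ⊛ g) *ᴸ h
          ≈⟨ +ᴸ-cong (⊛-⊛ k a l b h) (⊛-* (k , a) g h) ⟩
        (k , a) ⊛ ((l , b) ⊛ h) +ᴸ (k , a) ⊛ (g *ᴸ h)
          ≈⟨ ⊛-+ (k , a) ((l , b) ⊛ h) (g *ᴸ h) ⟨
        (k , a) ⊛ ((l , b) ⊛ h +ᴸ g *ᴸ h) ∎

      *ᴸ-assoc : ∀ f g h → (f *ᴸ g) *ᴸ h ≋ f *ᴸ (g *ᴸ h)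
      *ᴸ-assoc []      g h = ≋-refl
      *ᴸ-assoc (u ∷ f) g h = begin
        (u ⊛ g +ᴸ f *ᴸ g) *ᴸ h           ≈⟨ *ᴸ-distribʳ h (u ⊛ g) (f *ᴸ g) ⟩
        (u ⊛ g) *ᴸ h +ᴸ (f *ᴸ g) *ᴸ h    ≈⟨ +ᴸ-cong (⊛-* u g h) (*ᴸ-assoc f g h) ⟩
        u ⊛ (g *ᴸ h) +ᴸ f *ᴸ (g *ᴸ h)    ∎

      *ᴸ-identityˡ : ∀ f → 1ᴸ *ᴸ f ≋ f
      *ᴸ-identityˡ []            = ≋-refl
      *ᴸ-identityˡ ((k , a) ∷ f) = ∷-cong (*-identityˡ k) (⊕-identityˡ a) (*ᴸ-identityˡ f)

    Laurent-commutativeRing : CommutativeRing c r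
    Laurent-commutativeRing = record
      { Carrier = Laurent
      ; _≈_ = _≋_ ; _+_ = _+ᴸ_ ; _*_ = _*ᴸ_ ; -_ = -ᴸ_ ; 0# = 0ᴸ ; 1# = 1ᴸ
      ; isCommutativeRing = record
        { isRing = record
          { +-isAbelianGroup = record
            { isGroup = record
              { isMonoid = record
                { isSemigroup = record
                  { isMagma = record { isEquivalence = Setoid.isEquivalence ≋-setoid
                                     ; ∙-cong = λ {f} {f′} {g} {g′} → +ᴸ-cong {f} {f′} {g} {g′} }
                  ; assoc = +ᴸ-assoc }
                ; identity = comm∧idˡ⇒id {_+ᴸ_} +ᴸ-comm {0ᴸ} +ᴸ-identityˡ }
              ; inverse = comm∧invˡ⇒inv {_+ᴸ_} { -ᴸ_} {0ᴸ} +ᴸ-comm -ᴸ-inverseˡ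
              ; ⁻¹-cong = λ {f} {g} → -ᴸ-cong {f} {g} }
            ; comm = +ᴸ-comm }
          ; *-cong = λ {f} {f′} {g} {g′} → *ᴸ-cong {f} {f′} {g} {g′}
          ; *-assoc = *ᴸ-assoc
          ; *-identity = comm∧idˡ⇒id {_*ᴸ_} *ᴸ-comm {1ᴸ} *ᴸ-identityˡ
          ; distrib = comm∧distrʳ⇒distr (λ {f} {f′} {g} {g′} → +ᴸ-cong {f} {f′} {g} {g′})
                                        *ᴸ-comm *ᴸ-distribʳ
          }
        ; *-comm = *ᴸ-comm
        }
      }
      where open import Algebra.Consequences.Setoid ≋-setoid

    opaque
      unfolding _+ᴸ_

      •-cong : ∀ w {f g} → f ≋ g → w • f ≋ w • g
      •-cong w {f} {g} p = mk≋ λ e →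
        trans (coeff-• w f e) (trans (at p _) (sym (coeff-• w g e)))

      •-+ : ∀ w f g → w • (f +ᴸ g) ≋ w • f +ᴸ w • g
      •-+ w f g = ≋-reflexive (List.map-++ _ f g)

      •-neg : ∀ w f → w • (-ᴸ f) ≋ -ᴸ (w • f)
      •-neg w []      = ≋-refl
      •-neg w ((k , a) ∷ f) = ∷-cong refl ≡.refl (•-neg w f)

      •-⊛ : ∀ w k a g → w • ((k , a) ⊛ g) ≋ (k , permuteᴱ w a) ⊛ (w • g)
      •-⊛ w k a []            = ≋-refl
      •-⊛ w k a ((l , b) ∷ g) = ∷-cong refl (permuteᴱ-⊕ w a b) (•-⊛ w k a g)

      •-* : ∀ w f g → w • (f *ᴸ g) ≋ (w • f) *ᴸ (w • g)
      •-* w []            g = ≋-refl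
      •-* w ((k , a) ∷ f) g = begin
        w • ((k , a) ⊛ g +ᴸ f *ᴸ g)                           ≈⟨ •-+ w ((k , a) ⊛ g) (f *ᴸ g) ⟩
        w • ((k , a) ⊛ g) +ᴸ w • (f *ᴸ g)                     ≈⟨ +ᴸ-cong (•-⊛ w k a g) (•-* w f g) ⟩
        (k , permuteᴱ w a) ⊛ (w • g) +ᴸ (w • f) *ᴸ (w • g)    ∎

      •-flipˡ : ∀ w f → Perm.flip w • (w • f) ≋ f
      •-flipˡ w []            = ≋-refl
      •-flipˡ w ((k , a) ∷ f) = ∷-cong refl (permuteᴱ-flipˡ w a) (•-flipˡ w f)

      •-flipʳ : ∀ w f → w • (Perm.flip w • f) ≋ f
      •-flipʳ w []            = ≋-refl
      •-flipʳ w ((k , a) ∷ f) = ∷-cong refl (permuteᴱ-flipʳ w a) (•-flipʳ w f)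

      •-zero : ∀ w → w • 0ᴸ ≋ 0ᴸ
      •-zero w = ≋-refl

      •-const : ∀ w k → w • const k ≋ const k
      •-const w k = ∷-cong refl (permuteᴱ-0 w) ≋-refl

    Regular : Laurent → Set (c ⊔ r)
    Regular d = ∀ g → d *ᴸ g ≋ 0ᴸ → g ≋ 0ᴸ

    -- Together with _≋ꟳ_ this is the total ring of fractions, i.e. ℂ(x₁,…,xₙ) when
    -- the coefficients are complex numbers.
    record Fraction : Set (c ⊔ r) where
      constructor _/_by_
      field
        num     : Laurent
        den     : Laurent
        regular : Regular den

    open Fraction public

    infix 4 _≋ꟳ_
    infixl 6 _+ꟳ_
    infixl 7 _*ꟳ_

    _≋ꟳ_ : Fraction → Fraction → Set r
    p ≋ꟳ q = num p *ᴸ den q ≋ num q *ᴸ den p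

    regular-1 : Regular 1ᴸ
    regular-1 g p = ≋-trans (≋-sym (*ᴸ-identityˡ g)) p

    regular-* : ∀ {d e} → Regular d → Regular e → Regular (d *ᴸ e)
    regular-* {d} {e} rd re g p = re g (rd (e *ᴸ g) (≋-trans (≋-sym (*ᴸ-assoc d e g)) p))

    regular-• : ∀ w {d} → Regular d → Regular (w • d)
    regular-• w {d} rd g p = begin
      g                    ≈⟨ •-flipʳ w g ⟨
      w • (w⁻¹ • g)        ≈⟨ •-cong w (rd (w⁻¹ • g) (begin
        d *ᴸ (w⁻¹ • g)               ≈⟨ *ᴸ-cong (≋-sym (•-flipˡ w d)) (≋-refl {w⁻¹ • g}) ⟩
        (w⁻¹ • (w • d)) *ᴸ (w⁻¹ • g) ≈⟨ •-* w⁻¹ (w • d) g ⟨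
        w⁻¹ • ((w • d) *ᴸ g)         ≈⟨ •-cong w⁻¹ p ⟩
        w⁻¹ • 0ᴸ                     ≈⟨ •-zero w⁻¹ ⟩
        0ᴸ                           ∎)) ⟩
      w • 0ᴸ               ≈⟨ •-zero w ⟩
      0ᴸ                   ∎
      where w⁻¹ = Perm.flip w

    ι : Laurent → Fraction
    ι f = f / 1ᴸ by regular-1

    _+ꟳ_ _*ꟳ_ : Fraction → Fraction → Fraction
    (a / b by rb) +ꟳ (d / e by re) = (a *ᴸ e +ᴸ d *ᴸ b) / (b *ᴸ e) by regular-* {b} {e} rb re
    (a / b by rb) *ꟳ (d / e by re) = (a *ᴸ d) / (b *ᴸ e) by regular-* {b} {e} rb re

    infixr 8 _•ꟳ_

    _•ꟳ_ : Permutation′ n → Fraction → Fraction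
    w •ꟳ (a / b by rb) = (w • a) / (w • b) by regular-• w {b} rb

module HeckeOperators where

  open import Level using (Level; _⊔_)
  open import Algebra.Bundles using (CommutativeRing)
  open import Algebra.Module.Bundles using (Module)
  open import Algebra.Module.Structures.Biased using (IsModuleFromLeft)
  open import Data.Fin.Base as Fin using (Fin; zero; suc; inject₁; toℕ)
  import Data.Fin.Properties as Fin
  import Data.Fin.Permutation.Components as PC
  open import Data.Fin.Permutation as Perm using (Permutation′; _⟨$⟩ʳ_; _⟨$⟩ˡ_)
  open import Data.Integer.Base as ℤ using (ℤ; +_; -[1+_]; 0ℤ; 1ℤ; -1ℤ)
  import Data.Integer.Properties as ℤ
  import Data.Integer.Solver as ℤ-Solver
  open import Data.List.Base as List using (List; []; _∷_; map; foldr)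
  open import Data.Nat.Base as ℕ using (ℕ; zero; suc)
  import Data.Nat.Properties as ℕ
  open import Data.Product using (_×_; _,_; proj₁; proj₂; ∃)
  open import Data.Vec.Base as Vec using (lookup; _[_]≔_)
  import Data.Vec.Properties as Vec
  open import Relation.Nullary using (yes; no; contradiction)
  open import Relation.Unary using (Pred)
  import Relation.Binary.PropositionalEquality as ≡
  open ≡ using (_≡_; _≢_)

  open SymmetricGroup
  open LaurentPolynomials

  module Hecke {c r : Level} (𝕂 : CommutativeRing c r) (m : ℕ) where

    open Laurent 𝕂 (suc m) public
    open CommutativeRing 𝕂 using (1#) renaming (Carrier to K; _≈_ to _≈ᴷ_; _*_ to _*ᴷ_; -_ to -ᴷ_; _+_ to _+ᴷ_; 0# to 0ᴷ)
    module K = CommutativeRing 𝕂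
    private
      module 𝕃 = CommutativeRing Laurent-commutativeRing
    open import Algebra.Definitions _≈ᴷ_ using (Invertible)
    open import Algebra.Properties.Semiring.Exp K.semiring using (_^_)
    open import Algebra.Properties.Ring 𝕃.ring using (-0#≈0#; -1*x≈-x; -‿involutive; -‿distribˡ-*; -‿distribʳ-*; -‿+-comm; x∙y⁻¹≈ε⇒x≈y; x[y-z]≈xy-xz; x≈y⇒x∙y⁻¹≈ε; ⁻¹-anti-homo‿-)
    private
      module Solver where
        open import Algebra.Solver.Ring.NaturalCoefficients.Default 𝕃.commutativeSemiring public
          using (solve; _:=_; _:+_; _:*_; con)

    y : Fin m → Laurent
    y i = x⁻¹ (inject₁ i) *ᴸ x (suc i)

    private
      α : Fin m → Exponent
      α i = (0ᴱ [ inject₁ i ]≔ -1ℤ) ⊕ (0ᴱ [ suc i ]≔ 1ℤ)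

      i≢i+1 : ∀ (i : Fin m) → inject₁ i ≢ suc i
      i≢i+1 i eq = ℕ.1+n≢n (≡.sym (≡.trans (≡.sym (Fin.toℕ-inject₁ i)) (≡.cong toℕ eq)))

      α-i : ∀ i → lookup (α i) (inject₁ i) ≡ -1ℤ
      α-i i = ≡.trans (Vec.lookup-zipWith ℤ._+_ (inject₁ i) (0ᴱ [ inject₁ i ]≔ -1ℤ) (0ᴱ [ suc i ]≔ 1ℤ))
        (≡.cong₂ ℤ._+_ (Vec.lookup∘update (inject₁ i) 0ᴱ -1ℤ)
          (≡.trans (Vec.lookup∘update′ (i≢i+1 i) 0ᴱ 1ℤ) (Vec.lookup-replicate (inject₁ i) 0ℤ)))

      α-i+1 : ∀ i → lookup (α i) (suc i) ≡ 1ℤ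
      α-i+1 i = ≡.trans (Vec.lookup-zipWith ℤ._+_ (suc i) (0ᴱ [ inject₁ i ]≔ -1ℤ) (0ᴱ [ suc i ]≔ 1ℤ))
        (≡.cong₂ ℤ._+_
          (≡.trans (Vec.lookup∘update′ (λ e → i≢i+1 i (≡.sym e)) 0ᴱ -1ℤ) (Vec.lookup-replicate (suc i) 0ℤ))
          (Vec.lookup∘update (suc i) 0ᴱ 1ℤ))

      α-j : ∀ i j → j ≢ inject₁ i → j ≢ suc i → lookup (α i) j ≡ 0ℤ
      α-j i j p q = ≡.trans (Vec.lookup-zipWith ℤ._+_ j (0ᴱ [ inject₁ i ]≔ -1ℤ) (0ᴱ [ suc i ]≔ 1ℤ))
        (≡.cong₂ ℤ._+_
          (≡.trans (Vec.lookup∘update′ p 0ᴱ -1ℤ) (Vec.lookup-replicate j 0ℤ))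
          (≡.trans (Vec.lookup∘update′ q 0ᴱ 1ℤ) (Vec.lookup-replicate j 0ℤ)))

      sλ-i : ∀ i a → lookup (permuteᴱ (s i) a) (inject₁ i) ≡ lookup a (suc i)
      sλ-i i a = ≡.trans (permuteᴱ-lookup (s i) a (inject₁ i)) (≡.cong (lookup a) lem)
        where
        lem : PC.transpose (suc i) (inject₁ i) (inject₁ i) ≡ suc i
        lem with inject₁ i Fin.≟ suc i
        ... | yes e = contradiction e (i≢i+1 i)
        ... | no _ with inject₁ i Fin.≟ inject₁ i
        ... | yes _ = ≡.refl
        ... | no ¬r = contradiction ≡.refl ¬r

      sλ-i+1 : ∀ i a → lookup (permuteᴱ (s i) a) (suc i) ≡ lookup a (inject₁ i)
      sλ-i+1 i a = ≡.trans (permuteᴱ-lookup (s i) a (suc i)) (≡.cong (lookup a) lem)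
        where
        lem : PC.transpose (suc i) (inject₁ i) (suc i) ≡ inject₁ i
        lem with i Fin.≟ i
        ... | yes _ = ≡.refl
        ... | no ¬r = contradiction ≡.refl ¬r

      sλ-j : ∀ i a j → j ≢ inject₁ i → j ≢ suc i → lookup (permuteᴱ (s i) a) j ≡ lookup a j
      sλ-j i a j p q = ≡.trans (permuteᴱ-lookup (s i) a j) (≡.cong (lookup a) lem)
        where
        lem : PC.transpose (suc i) (inject₁ i) j ≡ j
        lem with j Fin.≟ suc i
        ... | yes e = contradiction e q
        ... | no _ with j Fin.≟ inject₁ i
        ... | yes e = contradiction e p
        ... | no _  = ≡.refl

      ss-id : ∀ i a → permuteᴱ (s i) (permuteᴱ (s i) a) ≡ a
      ss-id i a = ext go
        where
        sa = permuteᴱ (s i) a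
        go : ∀ j → lookup (permuteᴱ (s i) sa) j ≡ lookup a j
        go j with j Fin.≟ inject₁ i
        ... | yes ≡.refl = ≡.trans (sλ-i i sa) (sλ-i+1 i a)
        ... | no j≢i with j Fin.≟ suc i
        ... | yes ≡.refl = ≡.trans (sλ-i+1 i sa) (sλ-i i a)
        ... | no j≢i+1   = ≡.trans (sλ-j i sa j j≢i j≢i+1) (sλ-j i a j j≢i j≢i+1)

      cancel₁ : ∀ p q → ℤ.- (p ℤ.- q) ℤ.+ p ≡ q
      cancel₁ = solve 2 (λ p q → :- (p :- q) :+ p := q) ≡.refl
        where open ℤ-Solver.+-*-Solver

      cancel₂ : ∀ p q → (p ℤ.- q) ℤ.+ q ≡ p
      cancel₂ = solve 2 (λ p q → (p :- q) :+ q := p) ≡.refl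
        where open ℤ-Solver.+-*-Solver

      cancel₃ : ∀ p q → p ℤ.- (p ℤ.- q) ≡ q
      cancel₃ = solve 2 (λ p q → p :- (p :- q) := q) ≡.refl
        where open ℤ-Solver.+-*-Solver

      shift : Fin m → ℕ → Exponent → Exponent
      shift i zero    a = a
      shift i (suc k) a = shift i k (α i ⊕ a)

      lookup-shift : ∀ i k a j → lookup (shift i k a) j ≡ + k ℤ.* lookup (α i) j ℤ.+ lookup a j
      lookup-shift i zero    a j = ≡.sym (≡.trans (≡.cong (ℤ._+ lookup a j) (ℤ.*-zeroˡ (lookup (α i) j)))
                                                  (ℤ.+-identityˡ _))
      lookup-shift i (suc k) a j = ≡.trans (lookup-shift i k (α i ⊕ a) j)
        (≡.trans (≡.cong (λ z → + k ℤ.* l ℤ.+ z) (Vec.lookup-zipWith ℤ._+_ j (α i) a))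
        (≡.trans (≡.sym (ℤ.+-assoc (+ k ℤ.* l) l (lookup a j)))
          (≡.cong (ℤ._+ lookup a j) (≡.trans (ℤ.+-comm (+ k ℤ.* l) l) (≡.sym (ℤ.suc-* (+ k) l))))))
        where l = lookup (α i) j

      shift-s : ∀ i a k → lookup a (inject₁ i) ℤ.- lookup a (suc i) ≡ + k → shift i k a ≡ permuteᴱ (s i) a
      shift-s i a k eq = ext go
        where
        open ≡.≡-Reasoning 
        p = lookup a (inject₁ i)
        q = lookup a (suc i)
        go : ∀ j → lookup (shift i k a) j ≡ lookup (permuteᴱ (s i) a) j
        go j with j Fin.≟ inject₁ i
        ... | yes ≡.refl = begin
          lookup (shift i k a) (inject₁ i) ≡⟨ lookup-shift i k a (inject₁ i) ⟩
          + k ℤ.* lookup (α i) (inject₁ i) ℤ.+ p ≡⟨ ≡.cong (λ z → + k ℤ.* z ℤ.+ p) (α-i i) ⟩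
          + k ℤ.* -1ℤ ℤ.+ p ≡⟨ ≡.cong (ℤ._+ p) (≡.trans (ℤ.*-comm (+ k) -1ℤ) (ℤ.-1*i≡-i (+ k))) ⟩
          ℤ.- + k ℤ.+ p ≡⟨ ≡.cong (λ z → ℤ.- z ℤ.+ p) eq ⟨
          ℤ.- (p ℤ.- q) ℤ.+ p ≡⟨ cancel₁ p q ⟩
          q ≡⟨ sλ-i i a ⟨
          lookup (permuteᴱ (s i) a) (inject₁ i) ∎
        ... | no j≢i with j Fin.≟ suc i
        ... | yes ≡.refl = begin
          lookup (shift i k a) (suc i) ≡⟨ lookup-shift i k a (suc i) ⟩
          + k ℤ.* lookup (α i) (suc i) ℤ.+ q ≡⟨ ≡.cong (λ z → + k ℤ.* z ℤ.+ q) (α-i+1 i) ⟩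
          + k ℤ.* 1ℤ ℤ.+ q ≡⟨ ≡.cong (ℤ._+ q) (ℤ.*-identityʳ (+ k)) ⟩
          + k ℤ.+ q ≡⟨ ≡.cong (ℤ._+ q) eq ⟨
          (p ℤ.- q) ℤ.+ q ≡⟨ cancel₂ p q ⟩
          p ≡⟨ sλ-i+1 i a ⟨
          lookup (permuteᴱ (s i) a) (suc i) ∎
        ... | no j≢i+1 = begin
          lookup (shift i k a) j ≡⟨ lookup-shift i k a j ⟩
          + k ℤ.* lookup (α i) j ℤ.+ lookup a j ≡⟨ ≡.cong (λ z → + k ℤ.* z ℤ.+ lookup a j) (α-j i j j≢i j≢i+1) ⟩
          + k ℤ.* 0ℤ ℤ.+ lookup a j ≡⟨ ≡.cong (ℤ._+ lookup a j) (ℤ.*-zeroʳ (+ k)) ⟩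
          0ℤ ℤ.+ lookup a j ≡⟨ ℤ.+-identityˡ _ ⟩
          lookup a j ≡⟨ sλ-j i a j j≢i j≢i+1 ⟨
          lookup (permuteᴱ (s i) a) j ∎

    open import Relation.Binary.Reasoning.Setoid ≋-setoid

    opaque
      unfolding _+ᴸ_

      s-involutive : ∀ i f → s i • (s i • f) ≋ f
      s-involutive i []            = ≋-refl
      s-involutive i ((k , a) ∷ f) = ∷-cong K.refl (ss-id i a) (s-involutive i f)

    1-y : Fin m → Laurent
    1-y i = 1ᴸ -ᴸ y i

    private
      1-y-* : ∀ i f → 1-y i *ᴸ f ≋ f -ᴸ y i *ᴸ f
      1-y-* i f = begin
        1-y i *ᴸ f                     ≈⟨ 𝕃.distribʳ f 1ᴸ (-ᴸ y i) ⟩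
        1ᴸ *ᴸ f +ᴸ (-ᴸ y i) *ᴸ f       ≈⟨ 𝕃.+-cong (𝕃.*-identityˡ f) (≋-sym (-‿distribˡ-* (y i) f)) ⟩
        f -ᴸ y i *ᴸ f                  ∎

      opaque
        unfolding _+ᴸ_

        y-monomial : ∀ i → y i ≋ (1# , α i) ∷ []
        y-monomial i = ∷-cong (K.*-identityˡ 1#) ≡.refl ≋-refl

        monomial-* : ∀ k a b → ((1# , a) ∷ []) *ᴸ ((k , b) ∷ []) ≋ (k , a ⊕ b) ∷ []
        monomial-* k a b = ∷-cong (K.*-identityˡ k) ≡.refl ≋-refl

        coeff-monomial-* : ∀ a f e → coeff (((1# , a) ∷ []) *ᴸ f) e ≈ᴷ coeff f (⊖ a ⊕ e)
        coeff-monomial-* a f e = K.trans (coeff-+ ((1# , a) ⊛ f) [] e) (K.trans (K.+-identityʳ _)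
          (K.trans (coeff-⊛ 1# a f e) (K.*-identityˡ _)))

      coeff-y : ∀ i f e → coeff (y i *ᴸ f) e ≈ᴷ coeff f (⊖ α i ⊕ e)
      coeff-y i f e = K.trans (at (𝕃.*-congʳ (y-monomial i)) e) (coeff-monomial-* (α i) f e)

      unshift : Fin m → ℕ → Exponent → Exponent
      unshift i zero    e = e
      unshift i (suc k) e = unshift i k (⊖ α i ⊕ e)

      lookup-unshift : ∀ i k e → lookup (unshift i k e) (suc i) ≡ lookup e (suc i) ℤ.- + k
      lookup-unshift i zero    e = ≡.sym (ℤ.+-identityʳ _)
      lookup-unshift i (suc k) e = ≡.trans (lookup-unshift i k (⊖ α i ⊕ e))
        (≡.trans (≡.cong (ℤ._- + k)
          (≡.trans (Vec.lookup-zipWith ℤ._+_ (suc i) (⊖ α i) e)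
            (≡.cong (ℤ._+ l) (≡.trans (Vec.lookup-map (suc i) (λ z → ℤ.- z) (α i)) (≡.cong (λ z → ℤ.- z) (α-i+1 i))))))
        (≡.trans (≡.cong (ℤ._- + k) (ℤ.+-comm -1ℤ l))
        (≡.trans (ℤ.+-assoc l -1ℤ (ℤ.- + k))
          (≡.cong (λ z → l ℤ.+ z) (≡.sym (ℤ.neg-distrib-+ 1ℤ (+ k)))))))
        where l = lookup e (suc i)

      vanish : ∀ i f e → ∃ λ N → ∀ k → N ℕ.≤ k → coeff f (unshift i k e) ≈ᴷ 0ᴷ
      vanish i []            e = 0 , λ _ _ → K.refl
      vanish i ((l , a) ∷ f) e = suc ℤ.∣ d ∣ ℕ.⊔ N , go
        where
        d = lookup e (suc i) ℤ.- lookup a (suc i)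
        N = proj₁ (vanish i f e)
        go : ∀ k → suc ℤ.∣ d ∣ ℕ.⊔ N ℕ.≤ k → coeff ((l , a) ∷ f) (unshift i k e) ≈ᴷ 0ᴷ
        go k N≤k with a ≟ᴱ unshift i k e
        ... | no _  = K.trans (K.+-identityˡ _) (proj₂ (vanish i f e) k (ℕ.m⊔n≤o⇒n≤o _ N N≤k))
        ... | yes p = contradiction (ℕ.m⊔n≤o⇒m≤o _ N N≤k) (ℕ.<⇒≱ (ℕ.s≤s (ℕ.≤-reflexive k≡∣d∣)))
          where
          k≡d : d ≡ + k
          k≡d = ≡.trans (≡.cong (λ z → lookup e (suc i) ℤ.- z)
                  (≡.trans (≡.cong (λ b → lookup b (suc i)) p) (lookup-unshift i k e)))
            (cancel₃ (lookup e (suc i)) (+ k))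
          k≡∣d∣ : k ≡ ℤ.∣ d ∣
          k≡∣d∣ = ≡.sym (≡.cong ℤ.∣_∣ k≡d)

    1-y-regular : ∀ i → Regular (1-y i)
    1-y-regular i g p = mk≋ λ e → K.trans (walk e (proj₁ (vanish i g e)))
                                          (proj₂ (vanish i g e) _ ℕ.≤-refl)
      where
      step : ∀ e → coeff g e ≈ᴷ coeff g (⊖ α i ⊕ e)
      step e = K.trans (at (x∙y⁻¹≈ε⇒x≈y g (y i *ᴸ g) (≋-trans (≋-sym (1-y-* i g)) p)) e) (coeff-y i g e)
      walk : ∀ e k → coeff g e ≈ᴷ coeff g (unshift i k e)
      walk e zero    = K.refl
      walk e (suc k) = K.trans (step e) (walk (⊖ α i ⊕ e) k)

    regular-cancel : ∀ {d} → Regular d → ∀ {f g} → d *ᴸ f ≋ d *ᴸ g → f ≋ g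
    regular-cancel {d} rd {f} {g} p = x∙y⁻¹≈ε⇒x≈y f g (rd (f -ᴸ g) (begin
      d *ᴸ (f -ᴸ g)         ≈⟨ x[y-z]≈xy-xz d f g ⟩
      d *ᴸ f -ᴸ d *ᴸ g      ≈⟨ x≈y⇒x∙y⁻¹≈ε p ⟩
      0ᴸ                    ∎))

    private
      [_] : K × Exponent → Laurent
      [ u ] = u ∷ []

      -- x^a (1 + y + ⋯ + y^{d-1})
      geometric : Fin m → K → Exponent → ℕ → Laurent
      geometric i k a zero    = []
      geometric i k a (suc d) = [ k , a ] +ᴸ geometric i k (α i ⊕ a) d

      ∂-term : Fin m → K → Exponent → ℤ → Laurent
      ∂-term i k a (+ d)    = geometric i k a d
      ∂-term i k a -[1+ d ] = -ᴸ geometric i k (permuteᴱ (s i) a) (suc d)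

      ∂ : Fin m → Laurent → Laurent
      ∂ i []            = []
      ∂ i ((k , a) ∷ f) = ∂-term i k a (lookup a (inject₁ i) ℤ.- lookup a (suc i)) +ᴸ ∂ i f

      y-[] : ∀ i k a → y i *ᴸ [ k , a ] ≋ [ k , α i ⊕ a ]
      y-[] i k a = ≋-trans (𝕃.*-congʳ (y-monomial i)) (monomial-* k (α i) a)

      telescope : ∀ A B C → (A -ᴸ B) +ᴸ (B -ᴸ C) ≋ A -ᴸ C
      telescope A B C = begin
        (A -ᴸ B) +ᴸ (B -ᴸ C)
          ≈⟨ solve 4 (λ a b nb nc → (a :+ nb) :+ (b :+ nc) := (a :+ nc) :+ (nb :+ b)) ≋-refl A B (-ᴸ B) (-ᴸ C) ⟩
        (A -ᴸ C) +ᴸ (-ᴸ B +ᴸ B)  ≈⟨ 𝕃.+-congˡ (𝕃.-‿inverseˡ B) ⟩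
        (A -ᴸ C) +ᴸ 0ᴸ           ≈⟨ 𝕃.+-identityʳ _ ⟩
        A -ᴸ C                   ∎
        where open Solver

      geometric-spec : ∀ i k a d → 1-y i *ᴸ geometric i k a d ≋ [ k , a ] -ᴸ [ k , shift i d a ]
      geometric-spec i k a zero    = ≋-trans (𝕃.zeroʳ (1-y i)) (≋-sym (𝕃.-‿inverseʳ [ k , a ]))
      geometric-spec i k a (suc d) = begin
        1-y i *ᴸ ([ k , a ] +ᴸ geometric i k (α i ⊕ a) d)
          ≈⟨ 𝕃.distribˡ (1-y i) [ k , a ] (geometric i k (α i ⊕ a) d) ⟩
        1-y i *ᴸ [ k , a ] +ᴸ 1-y i *ᴸ geometric i k (α i ⊕ a) d
          ≈⟨ 𝕃.+-cong (≋-trans (1-y-* i [ k , a ]) (𝕃.+-congˡ (𝕃.-‿cong (y-[] i k a))))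
                      (geometric-spec i k (α i ⊕ a) d) ⟩
        ([ k , a ] -ᴸ [ k , α i ⊕ a ]) +ᴸ ([ k , α i ⊕ a ] -ᴸ [ k , shift i d (α i ⊕ a) ])
          ≈⟨ telescope [ k , a ] [ k , α i ⊕ a ] [ k , shift i d (α i ⊕ a) ] ⟩
        [ k , a ] -ᴸ [ k , shift i d (α i ⊕ a) ] ∎

      ∂-term-spec : ∀ i k a z → lookup a (inject₁ i) ℤ.- lookup a (suc i) ≡ z →
                    1-y i *ᴸ ∂-term i k a z ≋ [ k , a ] -ᴸ [ k , permuteᴱ (s i) a ]
      ∂-term-spec i k a (+ d)    eq = ≋-trans (geometric-spec i k a d)
        (≋-reflexive (≡.cong (λ b → [ k , a ] -ᴸ [ k , b ]) (shift-s i a d eq)))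
      ∂-term-spec i k a -[1+ d ] eq = begin
        1-y i *ᴸ (-ᴸ geometric i k sa (suc d))     ≈⟨ -‿distribʳ-* (1-y i) (geometric i k sa (suc d)) ⟨
        -ᴸ (1-y i *ᴸ geometric i k sa (suc d))     ≈⟨ 𝕃.-‿cong (geometric-spec i k sa (suc d)) ⟩
        -ᴸ ([ k , sa ] -ᴸ [ k , shift i (suc d) sa ])
          ≈⟨ ≋-reflexive (≡.cong (λ b → -ᴸ ([ k , sa ] -ᴸ [ k , b ])) (≡.trans (shift-s i sa (suc d) eq′) (ss-id i a))) ⟩
        -ᴸ ([ k , sa ] -ᴸ [ k , a ])               ≈⟨ ⁻¹-anti-homo‿- [ k , sa ] [ k , a ] ⟩
        [ k , a ] -ᴸ [ k , sa ]                    ∎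
        where
        sa = permuteᴱ (s i) a
        swap-sub : ∀ p q → q ℤ.- p ≡ ℤ.- (p ℤ.- q)
        swap-sub = solve 2 (λ p q → q :- p := :- (p :- q)) ≡.refl
          where open ℤ-Solver.+-*-Solver
        eq′ : lookup sa (inject₁ i) ℤ.- lookup sa (suc i) ≡ + suc d
        eq′ = ≡.trans (≡.cong₂ ℤ._-_ (sλ-i i a) (sλ-i+1 i a))
                (≡.trans (swap-sub (lookup a (inject₁ i)) (lookup a (suc i))) (≡.cong (λ z → ℤ.- z) eq))

      opaque
        unfolding _+ᴸ_

        cons : ∀ u f → (u ∷ f) ≋ [ u ] +ᴸ f
        cons u f = ≋-refl

        s-cons : ∀ i k a f → s i • ((k , a) ∷ f) ≋ [ k , permuteᴱ (s i) a ] +ᴸ s i • f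
        s-cons i k a f = ≋-refl

      ∂-spec : ∀ i f → 1-y i *ᴸ ∂ i f ≋ f -ᴸ s i • f
      ∂-spec i []            = begin
        1-y i *ᴸ 0ᴸ       ≈⟨ 𝕃.zeroʳ (1-y i) ⟩
        0ᴸ                ≈⟨ 𝕃.-‿inverseʳ 0ᴸ ⟨
        0ᴸ -ᴸ 0ᴸ          ≈⟨ 𝕃.+-congˡ (𝕃.-‿cong (•-zero (s i))) ⟨
        0ᴸ -ᴸ s i • 0ᴸ    ∎
      ∂-spec i ((k , a) ∷ f) = begin
        1-y i *ᴸ (t +ᴸ ∂ i f)             ≈⟨ 𝕃.distribˡ (1-y i) t (∂ i f) ⟩
        1-y i *ᴸ t +ᴸ 1-y i *ᴸ ∂ i f      ≈⟨ 𝕃.+-cong (∂-term-spec i k a _ ≡.refl) (∂-spec i f) ⟩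
        ([ k , a ] -ᴸ [ k , sa ]) +ᴸ (f -ᴸ s i • f)
          ≈⟨ solve 4 (λ a nb c nd → (a :+ nb) :+ (c :+ nd) := (a :+ c) :+ (nb :+ nd)) ≋-refl
               [ k , a ] (-ᴸ [ k , sa ]) f (-ᴸ (s i • f)) ⟩
        ([ k , a ] +ᴸ f) +ᴸ (-ᴸ [ k , sa ] +ᴸ -ᴸ (s i • f))
          ≈⟨ 𝕃.+-congˡ (-‿+-comm [ k , sa ] (s i • f)) ⟩
        ([ k , a ] +ᴸ f) -ᴸ ([ k , sa ] +ᴸ s i • f)
          ≈⟨ 𝕃.+-cong (cons (k , a) f) (𝕃.-‿cong (s-cons i k a f)) ⟨
        ((k , a) ∷ f) -ᴸ s i • ((k , a) ∷ f) ∎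
        where
        open Solver
        sa = permuteᴱ (s i) a
        t  = ∂-term i k a (lookup a (inject₁ i) ℤ.- lookup a (suc i))

    private
      1-y-s : ∀ i → s i • 1-y i ≋ 1ᴸ -ᴸ s i • y i
      1-y-s i = ≋-trans (•-+ (s i) 1ᴸ (-ᴸ y i)) (𝕃.+-cong (•-const (s i) 1#) (•-neg (s i) (y i)))

      opaque
        unfolding _+ᴸ_

        y-s-monomial : ∀ i → s i • y i ≋ (1# , permuteᴱ (s i) (α i)) ∷ []
        y-s-monomial i = •-cong (s i) (y-monomial i)

      α+sα : ∀ i → α i ⊕ permuteᴱ (s i) (α i) ≡ 0ᴱ
      α+sα i = ext λ j → ≡.trans (Vec.lookup-zipWith ℤ._+_ j (α i) (permuteᴱ (s i) (α i)))
                           (≡.trans (go j) (≡.sym (Vec.lookup-replicate j 0ℤ)))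
        where
        go : ∀ j → lookup (α i) j ℤ.+ lookup (permuteᴱ (s i) (α i)) j ≡ 0ℤ
        go j with j Fin.≟ inject₁ i
        ... | yes ≡.refl = ≡.cong₂ ℤ._+_ (α-i i) (≡.trans (sλ-i i (α i)) (α-i+1 i))
        ... | no j≢i with j Fin.≟ suc i
        ... | yes ≡.refl = ≡.cong₂ ℤ._+_ (α-i+1 i) (≡.trans (sλ-i+1 i (α i)) (α-i i))
        ... | no j≢i+1   = ≡.cong₂ ℤ._+_ (α-j i j j≢i j≢i+1)
                             (≡.trans (sλ-j i (α i) j j≢i j≢i+1) (α-j i j j≢i j≢i+1))

      y-y⁻¹ : ∀ i → y i *ᴸ s i • y i ≋ 1ᴸ
      y-y⁻¹ i = begin
        y i *ᴸ s i • y i    ≈⟨ 𝕃.*-cong (y-monomial i) (y-s-monomial i) ⟩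
        [ 1# , α i ] *ᴸ [ 1# , permuteᴱ (s i) (α i) ] ≈⟨ monomial-* 1# (α i) _ ⟩
        [ 1# , α i ⊕ permuteᴱ (s i) (α i) ] ≈⟨ ≋-reflexive (≡.cong (λ e → [ 1# , e ]) (α+sα i)) ⟩
        1ᴸ ∎

      ∂-unique : ∀ i f g → 1-y i *ᴸ g ≋ f -ᴸ s i • f → ∂ i f ≋ g
      ∂-unique i f g p = regular-cancel (1-y-regular i) (≋-trans (∂-spec i f) (≋-sym p))

      neg-neg-* : ∀ f g → (-ᴸ f) *ᴸ (-ᴸ g) ≋ f *ᴸ g
      neg-neg-* f g = begin
        (-ᴸ f) *ᴸ (-ᴸ g)     ≈⟨ -‿distribˡ-* f (-ᴸ g) ⟨
        -ᴸ (f *ᴸ (-ᴸ g))     ≈⟨ 𝕃.-‿cong (-‿distribʳ-* f g) ⟨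
        -ᴸ (-ᴸ (f *ᴸ g))     ≈⟨ -‿involutive (f *ᴸ g) ⟩
        f *ᴸ g               ∎

      drop : ∀ f g → f +ᴸ (-ᴸ g +ᴸ g) ≋ f
      drop f g = ≋-trans (𝕃.+-congˡ (𝕃.-‿inverseˡ g)) (𝕃.+-identityʳ f)

    Symmetric Antisymmetric : Laurent → Set r
    Symmetric     f = ∀ i → s i • f ≋ f
    Antisymmetric f = ∀ i → s i • f ≋ -ᴸ f

    private
      sym-+ : ∀ {f g} → Symmetric f → Symmetric g → Symmetric (f +ᴸ g)
      sym-+ {f} {g} p q i = ≋-trans (•-+ (s i) f g) (𝕃.+-cong (p i) (q i))

      sym-* : ∀ {f g} → Symmetric f → Symmetric g → Symmetric (f *ᴸ g)
      sym-* {f} {g} p q i = ≋-trans (•-* (s i) f g) (𝕃.*-cong (p i) (q i))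

      sym-neg : ∀ {f} → Symmetric f → Symmetric (-ᴸ f)
      sym-neg {f} p i = ≋-trans (•-neg (s i) f) (𝕃.-‿cong (p i))

      sym-0 : Symmetric 0ᴸ
      sym-0 i = •-zero (s i)

      sym-1 : Symmetric 1ᴸ
      sym-1 i = •-const (s i) 1#

    -- ℂ[X]^{S_n}
    Symmetric-commutativeRing : CommutativeRing (c ⊔ r) r
    Symmetric-commutativeRing = record
      { Carrier = ∃ Symmetric
      ; _≈_ = λ f g → proj₁ f ≋ proj₁ g
      ; _+_ = λ (f , p) (g , q) → f +ᴸ g , sym-+ p q
      ; _*_ = λ (f , p) (g , q) → f *ᴸ g , sym-* p q
      ; -_ = λ (f , p) → -ᴸ f , sym-neg p
      ; 0# = 0ᴸ , sym-0
      ; 1# = 1ᴸ , sym-1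
      ; isCommutativeRing = record
        { isRing = record
          { +-isAbelianGroup = record
            { isGroup = record
              { isMonoid = record
                { isSemigroup = record
                  { isMagma = record
                    { isEquivalence = record { refl = ≋-refl ; sym = ≋-sym ; trans = ≋-trans }
                    ; ∙-cong = 𝕃.+-cong }
                  ; assoc = λ f g h → 𝕃.+-assoc (proj₁ f) (proj₁ g) (proj₁ h) }
                ; identity = (λ f → 𝕃.+-identityˡ (proj₁ f)) , (λ f → 𝕃.+-identityʳ (proj₁ f)) }
              ; inverse = (λ f → 𝕃.-‿inverseˡ (proj₁ f)) , (λ f → 𝕃.-‿inverseʳ (proj₁ f))
              ; ⁻¹-cong = 𝕃.-‿cong }
            ; comm = λ f g → 𝕃.+-comm (proj₁ f) (proj₁ g) }
          ; *-cong = 𝕃.*-cong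
          ; *-assoc = λ f g h → 𝕃.*-assoc (proj₁ f) (proj₁ g) (proj₁ h)
          ; *-identity = (λ f → 𝕃.*-identityˡ (proj₁ f)) , (λ f → 𝕃.*-identityʳ (proj₁ f))
          ; distrib = (λ f g h → 𝕃.distribˡ (proj₁ f) (proj₁ g) (proj₁ h))
                    , (λ f g h → 𝕃.distribʳ (proj₁ f) (proj₁ g) (proj₁ h))
          }
        ; *-comm = λ f g → 𝕃.*-comm (proj₁ f) (proj₁ g)
        }
      }

    record IsSubmodule (P : Laurent → Set r) : Set (c ⊔ r) where
      field
        0-closed : P 0ᴸ
        +-closed : ∀ {f g} → P f → P g → P (f +ᴸ g)
        neg-closed : ∀ {f} → P f → P (-ᴸ f)
        *-closed : ∀ {h f} → Symmetric h → P f → P (h *ᴸ f)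

    -- A subspace of ℂ[X] stable under ℂ[X]^{S_n}, as a ℂ[X]^{S_n}-module.
    submodule : ∀ {P} → IsSubmodule P → Module Symmetric-commutativeRing (c ⊔ r) r
    submodule {P} P-sub = record
      { Carrierᴹ = ∃ P
      ; _≈ᴹ_ = λ f g → proj₁ f ≋ proj₁ g
      ; _+ᴹ_ = λ (f , p) (g , q) → f +ᴸ g , +-closed p q
      ; _*ₗ_ = λ (h , p) (f , q) → h *ᴸ f , *-closed p q
      ; _*ᵣ_ = λ (f , q) (h , p) → h *ᴸ f , *-closed p q
      ; 0ᴹ = 0ᴸ , 0-closed
      ; -ᴹ_ = λ (f , p) → -ᴸ f , neg-closed p
      ; isModule = IsModuleFromLeft.isModule {commutativeRing = Symmetric-commutativeRing} record
        { isLeftModule = record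
          { isLeftSemimodule = record
            { +ᴹ-isCommutativeMonoid = record
              { isMonoid = record
                { isSemigroup = record
                  { isMagma = record
                    { isEquivalence = record { refl = ≋-refl ; sym = ≋-sym ; trans = ≋-trans }
                    ; ∙-cong = 𝕃.+-cong }
                  ; assoc = λ f g h → 𝕃.+-assoc (proj₁ f) (proj₁ g) (proj₁ h) }
                ; identity = (λ f → 𝕃.+-identityˡ (proj₁ f)) , (λ f → 𝕃.+-identityʳ (proj₁ f)) }
              ; comm = λ f g → 𝕃.+-comm (proj₁ f) (proj₁ g) }
            ; isPreleftSemimodule = record
              { *ₗ-cong = 𝕃.*-cong
              ; *ₗ-zeroˡ = λ f → 𝕃.zeroˡ (proj₁ f)
              ; *ₗ-distribʳ = λ f g h → 𝕃.distribʳ (proj₁ f) (proj₁ g) (proj₁ h)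
              ; *ₗ-identityˡ = λ f → 𝕃.*-identityˡ (proj₁ f)
              ; *ₗ-assoc = λ f g h → 𝕃.*-assoc (proj₁ f) (proj₁ g) (proj₁ h)
              ; *ₗ-zeroʳ = λ f → 𝕃.zeroʳ (proj₁ f)
              ; *ₗ-distribˡ = λ f g h → 𝕃.distribˡ (proj₁ f) (proj₁ g) (proj₁ h)
              }
            }
          ; -ᴹ‿cong = 𝕃.-‿cong
          ; -ᴹ‿inverse = (λ f → 𝕃.-‿inverseˡ (proj₁ f)) , (λ f → 𝕃.-‿inverseʳ (proj₁ f))
          }
        }
      }
      where open IsSubmodule P-sub

    symmetric-isSubmodule : IsSubmodule Symmetric
    symmetric-isSubmodule = record
      { 0-closed = sym-0 ; +-closed = sym-+ ; neg-closed = sym-neg ; *-closed = sym-* }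

    antisymmetric-isSubmodule : IsSubmodule Antisymmetric
    antisymmetric-isSubmodule = record
      { 0-closed = λ i → begin
          s i • 0ᴸ    ≈⟨ •-zero (s i) ⟩
          0ᴸ          ≈⟨ -0#≈0# ⟨
          -ᴸ 0ᴸ       ∎
      ; +-closed = λ {f} {g} p q i → begin
          s i • (f +ᴸ g)        ≈⟨ •-+ (s i) f g ⟩
          s i • f +ᴸ s i • g    ≈⟨ 𝕃.+-cong (p i) (q i) ⟩
          -ᴸ f +ᴸ -ᴸ g          ≈⟨ -‿+-comm f g ⟩
          -ᴸ (f +ᴸ g)           ∎
      ; neg-closed = λ {f} p i → ≋-trans (•-neg (s i) f) (𝕃.-‿cong (p i))
      ; *-closed = λ {h} {f} p q i → begin
          s i • (h *ᴸ f)        ≈⟨ •-* (s i) h f ⟩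
          s i • h *ᴸ s i • f    ≈⟨ 𝕃.*-cong (p i) (q i) ⟩
          h *ᴸ (-ᴸ f)           ≈⟨ -‿distribʳ-* h f ⟨
          -ᴸ (h *ᴸ f)           ∎
      }

    Symmetric-module Antisymmetric-module : Module Symmetric-commutativeRing (c ⊔ r) r
    Symmetric-module     = submodule symmetric-isSubmodule
    Antisymmetric-module = submodule antisymmetric-isSubmodule

    Image : (Laurent → Laurent) → Laurent → Set (c ⊔ r)
    Image φ g = ∃ λ f → φ f ≋ g

    MultipleBySymmetric : Laurent → Laurent → Set (c ⊔ r)
    MultipleBySymmetric h g = ∃ λ f → Symmetric f × h *ᴸ f ≋ g

    sumᴸ productᴸ : List Laurent → Laurent
    sumᴸ     = foldr _+ᴸ_ 0ᴸ
    productᴸ = foldr _*ᴸ_ 1ᴸ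

    aρ : Laurent
    aρ = productᴸ (map (λ (i , j) → x j -ᴸ x i) (pairs (suc m)))

    -- 1 + t + ⋯ + t^{k-1}; the scalar by which 𝟏₀ acts on bosonic f is, up to
    -- a power of t½, the product of these for k ≤ n.  They cannot be allowed to
    -- vanish: for n = 2 and t = -1 the image of 𝟏₀ is (x₁ + x₂)·ℂ[X]^{S₂}, which
    -- does not contain 1, whereas 1 is bosonic.
    quantum : K → ℕ → K
    quantum t zero    = 0ᴷ
    quantum t (suc k) = quantum t k +ᴷ t ^ k

    zpower : ∀ u → Invertible 1# _*ᴷ_ u → ℤ → K
    zpower u _         (+ k)    = u ^ k
    zpower u (u⁻¹ , _) -[1+ k ] = u⁻¹ ^ suc k

    module _ (t½ : K) (t½-invertible : Invertible 1# _*ᴷ_ t½) where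

      private
        t⁻½ : K
        t⁻½ = proj₁ t½-invertible

      -- T_i f as an element of the fraction ring, by its defining formula.
      T-fraction : Fin m → Laurent → Fraction
      T-fraction i f = ι (-ᴸ (t⁻½ · f)) +ꟳ (cf +ꟳ s i •ꟳ cf)
        where
        cf : Fraction
        cf = ((const t⁻½ -ᴸ t½ · y i) / 1-y i by 1-y-regular i) *ꟳ ι f

      T-fraction-unique : ∀ i f {g h} → ι g ≋ꟳ T-fraction i f → ι h ≋ꟳ T-fraction i f → g ≋ h
      T-fraction-unique i f {g} {h} p q = regular-cancel (regular (T-fraction i f)) (begin
        d *ᴸ g    ≈⟨ 𝕃.*-comm d g ⟩
        g *ᴸ d    ≈⟨ p ⟩
        num (T-fraction i f) *ᴸ 1ᴸ ≈⟨ q ⟨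
        h *ᴸ d    ≈⟨ 𝕃.*-comm h d ⟩
        d *ᴸ h    ∎)
        where d = den (T-fraction i f)

      private
        A B : Laurent
        A = const t½
        B = const t⁻½

        τ : Fin m → Laurent → Laurent
        τ i f = (A -ᴸ B) *ᴸ f +ᴸ B *ᴸ s i • f +ᴸ (B -ᴸ A) *ᴸ ∂ i f

        τ-core : ∀ i f → 1-y i *ᴸ (τ i f +ᴸ B *ᴸ f)
                         ≋ (B +ᴸ (-ᴸ y i) *ᴸ A) *ᴸ f +ᴸ (A +ᴸ (-ᴸ y i) *ᴸ B) *ᴸ s i • f
        τ-core i f = begin
          P *ᴸ (τ i f +ᴸ B *ᴸ f)
            ≈⟨ 𝕃.*-congˡ (solve 7 (λ a b na nb f s d →
                 (a :+ nb) :* f :+ b :* s :+ (b :+ na) :* d :+ b :* f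
                 := (a :* f :+ b :* s :+ (b :+ na) :* d) :+ (nb :+ b) :* f) ≋-refl A B (-ᴸ A) (-ᴸ B) f S D) ⟩
          P *ᴸ ((A *ᴸ f +ᴸ B *ᴸ S +ᴸ (B -ᴸ A) *ᴸ D) +ᴸ (-ᴸ B +ᴸ B) *ᴸ f)
            ≈⟨ 𝕃.*-congˡ (𝕃.+-congˡ (≋-trans (𝕃.*-congʳ (𝕃.-‿inverseˡ B)) (𝕃.zeroˡ f))) ⟩
          P *ᴸ ((A *ᴸ f +ᴸ B *ᴸ S +ᴸ (B -ᴸ A) *ᴸ D) +ᴸ 0ᴸ)
            ≈⟨ 𝕃.*-congˡ (𝕃.+-identityʳ _) ⟩
          P *ᴸ (A *ᴸ f +ᴸ B *ᴸ S +ᴸ (B -ᴸ A) *ᴸ D)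
            ≈⟨ solve 7 (λ p a b na f s d → p :* (a :* f :+ b :* s :+ (b :+ na) :* d)
                 := p :* (a :* f :+ b :* s) :+ (b :+ na) :* (p :* d)) ≋-refl P A B (-ᴸ A) f S D ⟩
          P *ᴸ (A *ᴸ f +ᴸ B *ᴸ S) +ᴸ (B -ᴸ A) *ᴸ (P *ᴸ D)
            ≈⟨ 𝕃.+-congˡ (𝕃.*-congˡ (∂-spec i f)) ⟩
          P *ᴸ (A *ᴸ f +ᴸ B *ᴸ S) +ᴸ (B -ᴸ A) *ᴸ (f -ᴸ S)
            ≈⟨ solve 7 (λ ny a b na f s ns →
                 (con 1 :+ ny) :* (a :* f :+ b :* s) :+ (b :+ na) :* (f :+ ns)
                 := ((b :+ ny :* a) :* f :+ (na :* ns :+ ny :* b :* s))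
                    :+ ((na :+ a) :* f :+ b :* (ns :+ s))) ≋-refl (-ᴸ y i) A B (-ᴸ A) f S (-ᴸ S) ⟩
          ((B +ᴸ (-ᴸ y i) *ᴸ A) *ᴸ f +ᴸ ((-ᴸ A) *ᴸ (-ᴸ S) +ᴸ (-ᴸ y i) *ᴸ B *ᴸ S))
            +ᴸ ((-ᴸ A +ᴸ A) *ᴸ f +ᴸ B *ᴸ (-ᴸ S +ᴸ S))
            ≈⟨ 𝕃.+-cong (𝕃.+-congˡ (𝕃.+-congʳ (neg-neg-* A S)))
                 (𝕃.+-cong (≋-trans (𝕃.*-congʳ (𝕃.-‿inverseˡ A)) (𝕃.zeroˡ f))
                           (≋-trans (𝕃.*-congˡ (𝕃.-‿inverseˡ S)) (𝕃.zeroʳ B))) ⟩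
          ((B +ᴸ (-ᴸ y i) *ᴸ A) *ᴸ f +ᴸ (A *ᴸ S +ᴸ (-ᴸ y i) *ᴸ B *ᴸ S)) +ᴸ (0ᴸ +ᴸ 0ᴸ)
            ≈⟨ ≋-trans (𝕃.+-congˡ (𝕃.+-identityˡ 0ᴸ)) (𝕃.+-identityʳ _) ⟩
          (B +ᴸ (-ᴸ y i) *ᴸ A) *ᴸ f +ᴸ (A *ᴸ S +ᴸ (-ᴸ y i) *ᴸ B *ᴸ S)
            ≈⟨ 𝕃.+-congˡ (𝕃.distribʳ S A ((-ᴸ y i) *ᴸ B)) ⟨
          (B +ᴸ (-ᴸ y i) *ᴸ A) *ᴸ f +ᴸ (A +ᴸ (-ᴸ y i) *ᴸ B) *ᴸ S ∎
          where
          open Solver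
          P = 1-y i
          S = s i • f
          D = ∂ i f

        τ-spec : ∀ i f → ι (τ i f) ≋ꟳ T-fraction i f
        τ-spec i f = begin
          g *ᴸ (1ᴸ *ᴸ ((P *ᴸ 1ᴸ) *ᴸ s i • (P *ᴸ 1ᴸ)))
            ≈⟨ 𝕃.*-congˡ (≋-trans (𝕃.*-identityˡ _) (𝕃.*-cong (𝕃.*-identityʳ P) U≈)) ⟩
          g *ᴸ (P *ᴸ P′)
            ≈⟨ drop (g *ᴸ (P *ᴸ P′)) (Bf *ᴸ (P *ᴸ P′)) ⟨
          g *ᴸ (P *ᴸ P′) +ᴸ (-ᴸ (Bf *ᴸ (P *ᴸ P′)) +ᴸ Bf *ᴸ (P *ᴸ P′))
            ≈⟨ 𝕃.+-congˡ (𝕃.+-congʳ (-‿distribˡ-* Bf (P *ᴸ P′))) ⟩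
          g *ᴸ (P *ᴸ P′) +ᴸ ((-ᴸ Bf) *ᴸ (P *ᴸ P′) +ᴸ Bf *ᴸ (P *ᴸ P′))
            ≈⟨ solve 5 (λ g nb b p p′ → g :* (p :* p′) :+ (nb :* (p :* p′) :+ b :* (p :* p′))
                         := nb :* (p :* p′) :+ (p :* (g :+ b)) :* p′) ≋-refl g (-ᴸ Bf) Bf P P′ ⟩
          (-ᴸ Bf) *ᴸ (P *ᴸ P′) +ᴸ (P *ᴸ (g +ᴸ Bf)) *ᴸ P′
            ≈⟨ 𝕃.+-congˡ (𝕃.*-congʳ (τ-core i f)) ⟩
          (-ᴸ Bf) *ᴸ (P *ᴸ P′) +ᴸ (N *ᴸ f +ᴸ N′ *ᴸ S) *ᴸ P′
            ≈⟨ 𝕃.+-congˡ (solve 5 (λ n f n′ s p → (n :* f :+ n′ :* s) :* p := (n :* f) :* p :+ (n′ :* p) :* s)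
                 ≋-refl N f N′ S P′) ⟩
          (-ᴸ Bf) *ᴸ (P *ᴸ P′) +ᴸ ((N *ᴸ f) *ᴸ P′ +ᴸ (N′ *ᴸ P′) *ᴸ S)
            ≈⟨ 𝕃.+-congˡ (𝕃.+-congˡ (𝕃.*-congʳ cross)) ⟩
          (-ᴸ Bf) *ᴸ (P *ᴸ P′) +ᴸ ((N *ᴸ f) *ᴸ P′ +ᴸ (N̄ *ᴸ P) *ᴸ S)
            ≈⟨ 𝕃.+-congˡ (𝕃.+-congˡ (solve 3 (λ n p s → (n :* p) :* s := (n :* s) :* p) ≋-refl N̄ P S)) ⟩
          (-ᴸ Bf) *ᴸ (P *ᴸ P′) +ᴸ ((N *ᴸ f) *ᴸ P′ +ᴸ (N̄ *ᴸ S) *ᴸ P)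
            ≈⟨ 𝕃.+-cong (𝕃.*-congˡ (𝕃.*-cong (𝕃.*-identityʳ P) U≈))
                 (𝕃.+-cong (𝕃.*-cong (𝕃.*-congʳ N≈) U≈) (𝕃.*-cong V≈ (𝕃.*-identityʳ P))) ⟨
          (-ᴸ Bf) *ᴸ ((P *ᴸ 1ᴸ) *ᴸ s i • (P *ᴸ 1ᴸ))
            +ᴸ ((M *ᴸ f) *ᴸ s i • (P *ᴸ 1ᴸ) +ᴸ s i • (M *ᴸ f) *ᴸ (P *ᴸ 1ᴸ))
            ≈⟨ ≋-trans (𝕃.*-identityʳ _) (𝕃.+-congˡ (𝕃.*-identityʳ _)) ⟨
          ((-ᴸ Bf) *ᴸ ((P *ᴸ 1ᴸ) *ᴸ s i • (P *ᴸ 1ᴸ))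
            +ᴸ ((M *ᴸ f) *ᴸ s i • (P *ᴸ 1ᴸ) +ᴸ s i • (M *ᴸ f) *ᴸ (P *ᴸ 1ᴸ)) *ᴸ 1ᴸ) *ᴸ 1ᴸ ∎
          where
          open Solver
          g  = τ i f
          Bf = B *ᴸ f
          S  = s i • f
          ȳ  = s i • y i
          P  = 1-y i
          P′ = 1ᴸ -ᴸ ȳ
          M  = B -ᴸ A *ᴸ y i
          N  = B +ᴸ (-ᴸ y i) *ᴸ A
          N′ = A +ᴸ (-ᴸ y i) *ᴸ B
          N̄  = B +ᴸ (-ᴸ ȳ) *ᴸ A

          neg-comm : ∀ u v → -ᴸ (u *ᴸ v) ≋ (-ᴸ v) *ᴸ u
          neg-comm u v = ≋-trans (𝕃.-‿cong (𝕃.*-comm u v)) (-‿distribˡ-* v u)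

          N≈ : M ≋ N
          N≈ = 𝕃.+-congˡ (neg-comm A (y i))

          U≈ : s i • (P *ᴸ 1ᴸ) ≋ P′
          U≈ = ≋-trans (•-cong (s i) (𝕃.*-identityʳ P)) (1-y-s i)

          V≈ : s i • (M *ᴸ f) ≋ N̄ *ᴸ S
          V≈ = begin
            s i • (M *ᴸ f)                               ≈⟨ •-* (s i) M f ⟩
            s i • M *ᴸ S                                 ≈⟨ 𝕃.*-congʳ (•-+ (s i) B _) ⟩
            (s i • B +ᴸ s i • (-ᴸ (A *ᴸ y i))) *ᴸ S
              ≈⟨ 𝕃.*-congʳ (𝕃.+-cong (•-const (s i) t⁻½) (≋-trans (•-neg (s i) (A *ᴸ y i))
                   (𝕃.-‿cong (≋-trans (•-* (s i) A (y i)) (𝕃.*-congʳ (•-const (s i) t½)))))) ⟩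
            (B +ᴸ -ᴸ (A *ᴸ ȳ)) *ᴸ S                      ≈⟨ 𝕃.*-congʳ (𝕃.+-congˡ (neg-comm A ȳ)) ⟩
            N̄ *ᴸ S                                       ∎

          cross : N′ *ᴸ P′ ≋ N̄ *ᴸ P
          cross = begin
            N′ *ᴸ P′
              ≈⟨ solve 4 (λ a b u v → (a :+ u :* b) :* (con 1 :+ v)
                   := (a :+ a :* v :+ u :* b) :+ (u :* v) :* b) ≋-refl A B (-ᴸ y i) (-ᴸ ȳ) ⟩
            (A +ᴸ A *ᴸ (-ᴸ ȳ) +ᴸ (-ᴸ y i) *ᴸ B) +ᴸ ((-ᴸ y i) *ᴸ (-ᴸ ȳ)) *ᴸ B
              ≈⟨ 𝕃.+-cong (𝕃.+-congʳ (𝕃.+-congʳ (≋-trans (≋-sym (𝕃.*-identityˡ A)) (𝕃.*-congʳ (≋-sym uv≈1)))))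
                   (≋-trans (𝕃.*-congʳ uv≈1) (𝕃.*-identityˡ B)) ⟩
            (((-ᴸ y i) *ᴸ (-ᴸ ȳ)) *ᴸ A +ᴸ A *ᴸ (-ᴸ ȳ) +ᴸ (-ᴸ y i) *ᴸ B) +ᴸ B
              ≈⟨ solve 4 (λ a b u v → ((u :* v) :* a :+ a :* v :+ u :* b) :+ b
                   := (b :+ v :* a) :* (con 1 :+ u)) ≋-refl A B (-ᴸ y i) (-ᴸ ȳ) ⟩
            N̄ *ᴸ P ∎
            where
            uv≈1 : (-ᴸ y i) *ᴸ (-ᴸ ȳ) ≋ 1ᴸ
            uv≈1 = ≋-trans (neg-neg-* (y i) ȳ) (y-y⁻¹ i)

      T-exists : ∀ i f → ∃ λ g → ι g ≋ꟳ T-fraction i f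
      T-exists i f = τ i f , τ-spec i f

      T : Fin m → Laurent → Laurent
      T i f = proj₁ (T-exists i f)

      Bosonic Fermionic : Laurent → Set r
      Bosonic   f = ∀ i → T i f ≋ t½ · f
      Fermionic f = ∀ i → T i f ≋ -ᴸ (t⁻½ · f)

      T-+ : ∀ i f g → T i (f +ᴸ g) ≋ T i f +ᴸ T i g
      T-+ i f g = begin
        a *ᴸ (f +ᴸ g) +ᴸ B *ᴸ s i • (f +ᴸ g) +ᴸ b *ᴸ ∂ i (f +ᴸ g)
          ≈⟨ 𝕃.+-cong (𝕃.+-congˡ (𝕃.*-congˡ (•-+ (s i) f g))) (𝕃.*-congˡ (∂-unique i (f +ᴸ g) (∂ i f +ᴸ ∂ i g) ∂-+)) ⟩
        a *ᴸ (f +ᴸ g) +ᴸ B *ᴸ (s i • f +ᴸ s i • g) +ᴸ b *ᴸ (∂ i f +ᴸ ∂ i g)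
          ≈⟨ solve 9 (λ a b c f g sf sg df dg →
               a :* (f :+ g) :+ c :* (sf :+ sg) :+ b :* (df :+ dg)
               := (a :* f :+ c :* sf :+ b :* df) :+ (a :* g :+ c :* sg :+ b :* dg)) ≋-refl
               a b B f g (s i • f) (s i • g) (∂ i f) (∂ i g) ⟩
        T i f +ᴸ T i g ∎
        where
        open Solver
        a = A -ᴸ B
        b = B -ᴸ A
        ∂-+ : 1-y i *ᴸ (∂ i f +ᴸ ∂ i g) ≋ (f +ᴸ g) -ᴸ s i • (f +ᴸ g)
        ∂-+ = begin
          1-y i *ᴸ (∂ i f +ᴸ ∂ i g)               ≈⟨ 𝕃.distribˡ (1-y i) (∂ i f) (∂ i g) ⟩
          1-y i *ᴸ ∂ i f +ᴸ 1-y i *ᴸ ∂ i g        ≈⟨ 𝕃.+-cong (∂-spec i f) (∂-spec i g) ⟩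
          (f -ᴸ s i • f) +ᴸ (g -ᴸ s i • g)
            ≈⟨ solve 4 (λ a nb c nd → (a :+ nb) :+ (c :+ nd) := (a :+ c) :+ (nb :+ nd)) ≋-refl
                 f (-ᴸ (s i • f)) g (-ᴸ (s i • g)) ⟩
          (f +ᴸ g) +ᴸ (-ᴸ (s i • f) +ᴸ -ᴸ (s i • g))  ≈⟨ 𝕃.+-congˡ (-‿+-comm (s i • f) (s i • g)) ⟩
          (f +ᴸ g) -ᴸ (s i • f +ᴸ s i • g)        ≈⟨ 𝕃.+-congˡ (𝕃.-‿cong (•-+ (s i) f g)) ⟨
          (f +ᴸ g) -ᴸ s i • (f +ᴸ g)              ∎

      T-* : ∀ i {h} → s i • h ≋ h → ∀ f → T i (h *ᴸ f) ≋ h *ᴸ T i f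
      T-* i {h} p f = begin
        a *ᴸ (h *ᴸ f) +ᴸ B *ᴸ s i • (h *ᴸ f) +ᴸ b *ᴸ ∂ i (h *ᴸ f)
          ≈⟨ 𝕃.+-cong (𝕃.+-congˡ (𝕃.*-congˡ s-*)) (𝕃.*-congˡ (∂-unique i (h *ᴸ f) (h *ᴸ ∂ i f) ∂-*)) ⟩
        a *ᴸ (h *ᴸ f) +ᴸ B *ᴸ (h *ᴸ s i • f) +ᴸ b *ᴸ (h *ᴸ ∂ i f)
          ≈⟨ solve 7 (λ a b c h f sf df → a :* (h :* f) :+ c :* (h :* sf) :+ b :* (h :* df)
               := h :* (a :* f :+ c :* sf :+ b :* df)) ≋-refl a b B h f (s i • f) (∂ i f) ⟩
        h *ᴸ T i f ∎
        where
        open Solver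
        a = A -ᴸ B
        b = B -ᴸ A
        s-* : s i • (h *ᴸ f) ≋ h *ᴸ s i • f
        s-* = ≋-trans (•-* (s i) h f) (𝕃.*-congʳ p)
        ∂-* : 1-y i *ᴸ (h *ᴸ ∂ i f) ≋ h *ᴸ f -ᴸ s i • (h *ᴸ f)
        ∂-* = begin
          1-y i *ᴸ (h *ᴸ ∂ i f)       ≈⟨ solve 3 (λ a b c → a :* (b :* c) := b :* (a :* c)) ≋-refl (1-y i) h (∂ i f) ⟩
          h *ᴸ (1-y i *ᴸ ∂ i f)       ≈⟨ 𝕃.*-congˡ (∂-spec i f) ⟩
          h *ᴸ (f -ᴸ s i • f)         ≈⟨ x[y-z]≈xy-xz h f (s i • f) ⟩
          h *ᴸ f -ᴸ h *ᴸ s i • f      ≈⟨ 𝕃.+-congˡ (𝕃.-‿cong s-*) ⟨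
          h *ᴸ f -ᴸ s i • (h *ᴸ f)    ∎

      T-cong : ∀ i {f g} → f ≋ g → T i f ≋ T i g
      T-cong i {f} {g} p = 𝕃.+-cong (𝕃.+-cong (𝕃.*-congˡ p) (𝕃.*-congˡ (•-cong (s i) p)))
        (𝕃.*-congˡ (∂-unique i f (∂ i g) (≋-trans (∂-spec i g)
          (𝕃.+-cong (≋-sym p) (𝕃.-‿cong (•-cong (s i) (≋-sym p)))))))

      private
        neg1 : ∀ f → (-ᴸ 1ᴸ) *ᴸ f ≋ -ᴸ f
        neg1 = -1*x≈-x

        eigenspace : ∀ k → IsSubmodule (λ f → ∀ i → T i f ≋ k *ᴸ f)
        eigenspace k = record
          { 0-closed = λ i → begin
              T i 0ᴸ              ≈⟨ T-cong i (𝕃.zeroˡ 0ᴸ) ⟨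
              T i (0ᴸ *ᴸ 0ᴸ)      ≈⟨ T-* i (•-zero (s i)) 0ᴸ ⟩
              0ᴸ *ᴸ T i 0ᴸ        ≈⟨ 𝕃.zeroˡ (T i 0ᴸ) ⟩
              0ᴸ                  ≈⟨ 𝕃.zeroʳ k ⟨
              k *ᴸ 0ᴸ             ∎
          ; +-closed = λ {f} {g} p q i → begin
              T i (f +ᴸ g)        ≈⟨ T-+ i f g ⟩
              T i f +ᴸ T i g      ≈⟨ 𝕃.+-cong (p i) (q i) ⟩
              k *ᴸ f +ᴸ k *ᴸ g    ≈⟨ 𝕃.distribˡ k f g ⟨
              k *ᴸ (f +ᴸ g)       ∎
          ; neg-closed = λ {f} p i → begin
              T i (-ᴸ f)          ≈⟨ T-cong i (neg1 f) ⟨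
              T i ((-ᴸ 1ᴸ) *ᴸ f)  ≈⟨ T-* i (sym-neg sym-1 i) f ⟩
              (-ᴸ 1ᴸ) *ᴸ T i f    ≈⟨ neg1 (T i f) ⟩
              -ᴸ T i f            ≈⟨ 𝕃.-‿cong (p i) ⟩
              -ᴸ (k *ᴸ f)         ≈⟨ -‿distribʳ-* k f ⟩
              k *ᴸ (-ᴸ f)         ∎
          ; *-closed = λ {h} {f} σ p i → begin
              T i (h *ᴸ f)        ≈⟨ T-* i (σ i) f ⟩
              h *ᴸ T i f          ≈⟨ 𝕃.*-congˡ (p i) ⟩
              h *ᴸ (k *ᴸ f)       ≈⟨ solve 3 (λ a b c → a :* (b :* c) := b :* (a :* c)) ≋-refl h k f ⟩
              k *ᴸ (h *ᴸ f)       ∎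
          }
          where open Solver

      bosonic-isSubmodule : IsSubmodule Bosonic
      bosonic-isSubmodule = eigenspace A

      fermionic-isSubmodule : IsSubmodule Fermionic
      fermionic-isSubmodule = record
        { 0-closed   = λ i → out i (0-closed i)
        ; +-closed   = λ p q i → out i (+-closed (into p) (into q) i)
        ; neg-closed = λ p i → out i (neg-closed (into p) i)
        ; *-closed   = λ σ p i → out i (*-closed σ (into p) i)
        }
        where
        open IsSubmodule (eigenspace (-ᴸ B))
        into : ∀ {f} → Fermionic f → ∀ i → T i f ≋ (-ᴸ B) *ᴸ f
        into {f} p i = ≋-trans (p i) (-‿distribˡ-* B f)
        out : ∀ {f} i → T i f ≋ (-ᴸ B) *ᴸ f → T i f ≋ -ᴸ (t⁻½ · f)
        out {f} i p = ≋-trans p (≋-sym (-‿distribˡ-* B f))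

      Bosonic-module Fermionic-module : Module Symmetric-commutativeRing (c ⊔ r) r
      Bosonic-module   = submodule bosonic-isSubmodule
      Fermionic-module = submodule fermionic-isSubmodule

      T-word : List (Fin m) → Laurent → Laurent
      T-word word f = foldr T f word

      T-perm : Permutation′ (suc m) → Laurent → Laurent
      T-perm w = T-word (proj₁ (reducedWord w))

      -t⁻½-invertible : Invertible 1# _*ᴷ_ (-ᴷ t⁻½)
      -t⁻½-invertible = -ᴷ t½
        , K.trans (neg-neg t½ t⁻½) (proj₂ (proj₂ t½-invertible))
        , K.trans (neg-neg t⁻½ t½) (proj₁ (proj₂ t½-invertible))
        where
        open import Algebra.Properties.Ring K.ring using () renaming
          (-‿distribˡ-* to distˡ; -‿distribʳ-* to distʳ; -‿involutive to invol)
        neg-neg : ∀ a b → (-ᴷ a) *ᴷ (-ᴷ b) ≈ᴷ a *ᴷ b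
        neg-neg a b = K.trans (K.sym (distˡ a (-ᴷ b)))
          (K.trans (K.-‿cong (K.sym (distʳ a b))) (invol (a *ᴷ b)))

      𝟏₀ ε₀ : Laurent → Laurent
      𝟏₀ f = sumᴸ (map (λ w → zpower t½ t½-invertible (+ ℓ w ℤ.- + ℓ (w₀ {suc m})) · T-perm w f)
                       (allPermutations (suc m)))
      ε₀ f = sumᴸ (map (λ w → zpower (-ᴷ t⁻½) -t⁻½-invertible (+ ℓ w ℤ.- + ℓ (w₀ {suc m})) · T-perm w f)
                       (allPermutations (suc m)))

      Aρ : Laurent
      Aρ = productᴸ (map (λ (i , j) → x j -ᴸ (t½ *ᴷ t½) · x i) (pairs (suc m)))

open ComplexNumbers public using (ℂ; _≈ᶜ_; _*ᶜ_; ℂˣ; ℂ-commutativeRing)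
open HeckeOperators public using (module Hecke)

{-# OPTIONS --safe #-}
module Submission where

-- Multiplying the definition of T_i by x_i - x_{i+1} clears its denominators:
--   (x_i - x_{i+1}) T_i f = (t^{-½} - t^½) x_{i+1} f + (t^½ x_i - t^{-½} x_{i+1}) s_i f.
-- Since x_i - x_{i+1} is not a zero divisor, the quadratic, braid and commutation relations become
-- polynomial identities.  With u one of the two eigenvalues t^½, -t^{-½}, the reduced words used for T_w
-- factor ∑ u^{ℓ(w)} T_w through cosets of S_m in S_{m+1}; the relations alone show that its image consists
-- of common u-eigenvectors of the T_i, and it multiplies such a vector by the product of the [k]_{u²}, a unit.
--
-- T_i f = t^½ f says (t^{-½} x_{i+1} - t^½ x_i)(f - s_i f) = 0, that is, s_i f = f.  T_i f = -t^{-½} f says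
-- (x_i - t x_{i+1}) f = (x_{i+1} - t x_i) s_i f, and, as (t^½ + t^{-½}) f = t^½ f - T_i f is a multiple of
-- x_{i+1} - t x_i, such an f is divisible by x_{i+1} - t x_i.  The twisted symmetry carries this over to
-- x_j - t x_i for all i < j.  Reducing modulo x_j - t x_i (replacing x_j by t x_i) shows that these factors
-- are pairwise coprime, so A_ρ divides f, and the quotient is symmetric.  The case t = 1 is that of a_ρ.

open import Defs
open import Algebra.Bundles using (CommutativeMonoid; CommutativeRing; RawRing)
open import Algebra.Definitions using (Invertible)
open import Algebra.Module.Bundles using (module Module)
open import Algebra.Module.Morphism.Structures using (IsModuleIsomorphism)
open import Data.Fin.Base as Fin using (Fin; zero; suc; toℕ; inject₁; punchIn)
open import Data.Fin.Permutation as Perm using (Permutation′; _⟨$⟩ʳ_; _⟨$⟩ˡ_; _∘ₚ_)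
import Data.Fin.Properties as Fin
open import Data.Integer.Base as ℤ using (ℤ; +_; -[1+_]; 0ℤ; 1ℤ; -1ℤ)
import Data.Integer.Properties as ℤ
import Data.Integer.Solver as ℤ-Solver
open import Data.List.Base as List using (List; []; _∷_; _++_; map; concatMap; foldr; length; allFin)
open import Data.List.Membership.Propositional.Properties using (∈-map⁻)
import Data.List.Properties as List
open import Data.List.Relation.Unary.All as All using (All; []; _∷_)
import Data.List.Relation.Unary.All.Properties as All
open import Data.List.Relation.Unary.AllPairs using ([]; _∷_)
open import Data.List.Relation.Unary.Unique.Propositional using (Unique)
import Data.List.Relation.Unary.Unique.Propositional.Properties as Unique
open import Data.Maybe.Base using (Maybe; just; nothing)
open import Data.Nat.Base using (ℕ; suc; _≤_)
open import Data.Nat.Base as ℕ using (zero; z≤n; s≤s)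
import Data.Nat.Properties as ℕ
open import Data.Product using (Σ; _×_; _,_)
open import Data.Product using (∃; proj₁; proj₂)
open import Data.Rational.Base using (0ℚ; ½)
open import Data.Sum.Base using (inj₁; inj₂)
open import Data.Vec.Base as Vec using (lookup; zipWith; _[_]≔_)
import Data.Vec.Properties as Vec
open import Function.Base using (_∘_; id)
open import Level using (Level; _⊔_)
open import Relation.Binary.PropositionalEquality as ≡ using (_≡_; _≢_)
open import Relation.Nullary using (yes; no; contradiction)
open import Relation.Nullary.Decidable using (toSum)
open import Relation.Unary using (_≐_)

open ComplexNumbers using (fromℚ; mk≈ʳ; _,_)
open LaurentPolynomials using (module Laurent)
open SymmetricGroup using (s; cycleWord)

-- Equality of complex numbers is undecidable, so a Laurent polynomial has no computable leading
-- term, and arguments by degree or by unique factorization are out of reach. The lemmas are stated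
-- over an arbitrary commutative ring instead, and cancellation goes through regular elements: a
-- binomial with an invertible coefficient is regular because coefficients that propagate by a fixed
-- scalar along a line must vanish once the line leaves a finite support. Coprimality of P and Q
-- appears only as "P divides Q f implies P divides f", which is the form that splits off roots one
-- after another. The assumption at k = 2 makes 1 + t invertible, which turns divisibility of (1 +
-- t) f by a root into divisibility of f.

-- A ring solver with integer coefficients

module IntegerCoefficients {c r : Level} (R : CommutativeRing c r) where
  open CommutativeRing R
  open import Algebra.Properties.Semiring.Mult semiring using (×-homo-+; ×1-homo-*) renaming (_×_ to _⊠_)
  open import Algebra.Properties.Ring ring using (-‿+-comm; x[y-z]≈xy-xz; -‿distribˡ-*; -‿distribʳ-*; -0#≈0#; ⁻¹-anti-homo‿-)
  open import Algebra.Properties.CommutativeSemigroup +-commutativeSemigroup using (interchange)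
  open import Algebra.Solver.Ring.AlmostCommutativeRing using (fromCommutativeRing; _-Raw-AlmostCommutative⟶_)
  open import Relation.Binary.Reasoning.Setoid setoid

  private
    -- (a , b) stands for the integer a - b.  The solver compares normal forms syntactically, hence canonical.
    canonical : ℕ × ℕ → ℕ × ℕ
    canonical (a , b) = a ℕ.∸ b , b ℕ.∸ a

  -- Coefficients are integers rather than elements of `R`: the solver has to decide their equality,
  -- and the signed identities below rely on cancellation.
  ℤ-rawRing : RawRing _ _
  ℤ-rawRing = record
    { Carrier = ℕ × ℕ
    ; _≈_ = _≡_
    ; _+_ = λ (a , b) (d , e) → canonical (a ℕ.+ d , b ℕ.+ e)
    ; _*_ = λ (a , b) (d , e) → canonical (a ℕ.* d ℕ.+ b ℕ.* e , a ℕ.* e ℕ.+ b ℕ.* d)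
    ; -_ = λ (a , b) → b , a
    ; 0# = 0 , 0
    ; 1# = 1 , 0
    }

  private
    ⟪_⟫ : ℕ → Carrier
    ⟪ a ⟫ = a ⊠ 1#

    ⟪⟫-+* : ∀ a b d e → ⟪ a ℕ.* b ℕ.+ d ℕ.* e ⟫ ≈ ⟪ a ⟫ * ⟪ b ⟫ + ⟪ d ⟫ * ⟪ e ⟫
    ⟪⟫-+* a b d e = trans (×-homo-+ 1# (a ℕ.* b) (d ℕ.* e)) (+-cong (×1-homo-* a b) (×1-homo-* d e))

    sub-+ : ∀ a b d e → (a + d) - (b + e) ≈ (a - b) + (d - e)
    sub-+ a b d e = trans (+-congˡ (sym (-‿+-comm b e))) (interchange a d (- b) (- e))

    sub-* : ∀ a b d e → (a * d + b * e) - (a * e + b * d) ≈ (a - b) * (d - e)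
    sub-* a b d e = begin
      (a * d + b * e) - (a * e + b * d)     ≈⟨ sub-+ (a * d) (a * e) (b * e) (b * d) ⟩
      (a * d - a * e) + (b * e - b * d)     ≈⟨ +-cong (x[y-z]≈xy-xz a d e) (x[y-z]≈xy-xz b e d) ⟨
      a * (d - e) + b * (e - d)             ≈⟨ +-congˡ (*-congˡ (⁻¹-anti-homo‿- d e)) ⟨
      a * (d - e) + b * - (d - e)           ≈⟨ +-congˡ (trans (sym (-‿distribʳ-* b (d - e))) (-‿distribˡ-* b (d - e))) ⟩
      a * (d - e) + - b * (d - e)           ≈⟨ distribʳ (d - e) a (- b) ⟨
      (a - b) * (d - e)                     ∎

    ⟦_⟧ : ℕ × ℕ → Carrier
    ⟦ a , b ⟧ = ⟪ a ⟫ - ⟪ b ⟫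

    ⟦⟧-cong : ∀ p q → (let a , b = p ; d , e = q in a ℕ.+ e ≡ d ℕ.+ b) → ⟦ p ⟧ ≈ ⟦ q ⟧
    ⟦⟧-cong (a , b) (d , e) eq = begin
      ⟪ a ⟫ - ⟪ b ⟫                        ≈⟨ +-identityʳ _ ⟨
      (⟪ a ⟫ - ⟪ b ⟫) + 0#                 ≈⟨ +-congˡ (-‿inverseʳ ⟪ e ⟫) ⟨
      (⟪ a ⟫ - ⟪ b ⟫) + (⟪ e ⟫ - ⟪ e ⟫)    ≈⟨ sub-+ ⟪ a ⟫ ⟪ b ⟫ ⟪ e ⟫ ⟪ e ⟫ ⟨
      (⟪ a ⟫ + ⟪ e ⟫) - (⟪ b ⟫ + ⟪ e ⟫)    ≈⟨ +-cong lem (-‿cong (+-comm ⟪ b ⟫ ⟪ e ⟫)) ⟩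
      (⟪ d ⟫ + ⟪ b ⟫) - (⟪ e ⟫ + ⟪ b ⟫)    ≈⟨ sub-+ ⟪ d ⟫ ⟪ e ⟫ ⟪ b ⟫ ⟪ b ⟫ ⟩
      (⟪ d ⟫ - ⟪ e ⟫) + (⟪ b ⟫ - ⟪ b ⟫)    ≈⟨ +-congˡ (-‿inverseʳ ⟪ b ⟫) ⟩
      (⟪ d ⟫ - ⟪ e ⟫) + 0#                 ≈⟨ +-identityʳ _ ⟩
      ⟪ d ⟫ - ⟪ e ⟫                        ∎
      where
      lem : ⟪ a ⟫ + ⟪ e ⟫ ≈ ⟪ d ⟫ + ⟪ b ⟫
      lem = begin
        ⟪ a ⟫ + ⟪ e ⟫   ≈⟨ ×-homo-+ 1# a e ⟨
        ⟪ a ℕ.+ e ⟫     ≈⟨ reflexive (≡.cong ⟪_⟫ eq) ⟩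
        ⟪ d ℕ.+ b ⟫     ≈⟨ ×-homo-+ 1# d b ⟩
        ⟪ d ⟫ + ⟪ b ⟫   ∎

    ∸-exchange : ∀ a b → (a ℕ.∸ b) ℕ.+ b ≡ a ℕ.+ (b ℕ.∸ a)
    ∸-exchange zero    b       = ≡.cong (ℕ._+ b) (ℕ.0∸n≡0 b)
    ∸-exchange (suc a) zero    = ≡.refl
    ∸-exchange (suc a) (suc b) = ≡.trans (ℕ.+-suc (a ℕ.∸ b) b) (≡.cong suc (∸-exchange a b))

    canonical-≈ : ∀ p → ⟦ canonical p ⟧ ≈ ⟦ p ⟧
    canonical-≈ p@(a , b) = ⟦⟧-cong (canonical p) p (∸-exchange a b)

    morphism : ℤ-rawRing -Raw-AlmostCommutative⟶ fromCommutativeRing R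
    morphism = record
      { ⟦_⟧ = ⟦_⟧
      ; +-homo = λ (a , b) (d , e) →
          trans (canonical-≈ (a ℕ.+ d , b ℕ.+ e)) (trans (+-cong (×-homo-+ 1# a d) (-‿cong (×-homo-+ 1# b e))) (sub-+ ⟪ a ⟫ ⟪ b ⟫ ⟪ d ⟫ ⟪ e ⟫))
      ; *-homo = λ (a , b) (d , e) →
          trans (canonical-≈ (a ℕ.* d ℕ.+ b ℕ.* e , a ℕ.* e ℕ.+ b ℕ.* d)) (trans (+-cong (⟪⟫-+* a d b e) (-‿cong (⟪⟫-+* a e b d))) (sub-* ⟪ a ⟫ ⟪ b ⟫ ⟪ d ⟫ ⟪ e ⟫))
      ; -‿homo = λ (a , b) → sym (⁻¹-anti-homo‿- ⟪ a ⟫ ⟪ b ⟫)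
      ; 0-homo = -‿inverseʳ 0#
      ; 1-homo = trans (+-cong (+-identityʳ 1#) -0#≈0#) (+-identityʳ 1#)
      }

    coefficient-≟ : ∀ p q → Maybe (⟦ p ⟧ ≈ ⟦ q ⟧)
    coefficient-≟ p@(a , b) q@(d , e) with a ℕ.+ e ℕ.≟ d ℕ.+ b
    ... | yes eq = just (⟦⟧-cong p q eq)
    ... | no  _  = nothing

  open import Algebra.Solver.Ring ℤ-rawRing (fromCommutativeRing R) morphism coefficient-≟ public
    using (solve; _:=_; _:+_; _:*_; _:-_; :-_)

-- Polynomial identities behind the braid relation

module BraidAlgebra {c r : Level} (R : CommutativeRing c r) where
  open CommutativeRing R
  open IntegerCoefficients R
  open import Relation.Binary.Reasoning.Setoid setoid

  -- V = T_i T_j T_i f, Z = T_j T_i f, W = T_i f and F = f; subscripts 1 and 2 stand for applications of s_i and s_j.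
  expand : ∀ {d₁ d₂ d₃ a₁ a₂ a₃ p₁ p₂ p₃ e r V Z Z₁ W W₁ W₂ W₁₂ F F₁ F₂ F₁₂ F₂₁ F₁₂₁} →
    d₁ * V ≈ a₁ * Z + p₁ * Z₁ →
    d₂ * Z ≈ a₂ * W + p₂ * W₂ →
    d₃ * Z₁ ≈ a₃ * W₁ + p₃ * W₁₂ →
    d₁ * W ≈ a₁ * F + p₁ * F₁ →
    d₃ * W₂ ≈ a₃ * F₂ + p₃ * F₂₁ →
    d₁ * W₁ ≈ e * F₁ + r * F →
    d₂ * W₁₂ ≈ a₂ * F₁₂ + p₂ * F₁₂₁ →
    d₁ * d₁ * d₂ * d₃ * V ≈
      d₃ * a₁ * a₂ * (a₁ * F + p₁ * F₁) + d₁ * a₁ * p₂ * (a₃ * F₂ + p₃ * F₂₁)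
      + (d₂ * p₁ * a₃ * (e * F₁ + r * F) + d₁ * p₁ * p₃ * (a₂ * F₁₂ + p₂ * F₁₂₁))
  expand {d₁} {d₂} {d₃} {a₁} {a₂} {a₃} {p₁} {p₂} {p₃} {e} {r} {V} {Z} {Z₁} {W} {W₁} {W₂} {W₁₂} V≈ Z≈ Z₁≈ W≈ W₂≈ W₁≈ W₁₂≈ = begin
    d₁ * d₁ * d₂ * d₃ * V
      ≈⟨ solve 4 (λ d₁ d₂ d₃ V → d₁ :* d₁ :* d₂ :* d₃ :* V := d₁ :* d₂ :* d₃ :* (d₁ :* V)) refl d₁ d₂ d₃ V ⟩
    d₁ * d₂ * d₃ * (d₁ * V)
      ≈⟨ *-congˡ V≈ ⟩
    d₁ * d₂ * d₃ * (a₁ * Z + p₁ * Z₁)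
      ≈⟨ solve 7 (λ d₁ d₂ d₃ a₁ p₁ Z Z₁ → d₁ :* d₂ :* d₃ :* (a₁ :* Z :+ p₁ :* Z₁)
           := d₁ :* d₃ :* a₁ :* (d₂ :* Z) :+ d₁ :* d₂ :* p₁ :* (d₃ :* Z₁)) refl d₁ d₂ d₃ a₁ p₁ Z Z₁ ⟩
    d₁ * d₃ * a₁ * (d₂ * Z) + d₁ * d₂ * p₁ * (d₃ * Z₁)
      ≈⟨ +-cong (*-congˡ Z≈) (*-congˡ Z₁≈) ⟩
    d₁ * d₃ * a₁ * (a₂ * W + p₂ * W₂) + d₁ * d₂ * p₁ * (a₃ * W₁ + p₃ * W₁₂)
      ≈⟨ +-cong
           (solve 7 (λ d₁ d₃ a₁ a₂ p₂ W W₂ → d₁ :* d₃ :* a₁ :* (a₂ :* W :+ p₂ :* W₂)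
             := d₃ :* a₁ :* a₂ :* (d₁ :* W) :+ d₁ :* a₁ :* p₂ :* (d₃ :* W₂)) refl d₁ d₃ a₁ a₂ p₂ W W₂)
           (solve 7 (λ d₁ d₂ p₁ a₃ p₃ W₁ W₁₂ → d₁ :* d₂ :* p₁ :* (a₃ :* W₁ :+ p₃ :* W₁₂)
             := d₂ :* p₁ :* a₃ :* (d₁ :* W₁) :+ d₁ :* p₁ :* p₃ :* (d₂ :* W₁₂)) refl d₁ d₂ p₁ a₃ p₃ W₁ W₁₂) ⟩
    d₃ * a₁ * a₂ * (d₁ * W) + d₁ * a₁ * p₂ * (d₃ * W₂) + (d₂ * p₁ * a₃ * (d₁ * W₁) + d₁ * p₁ * p₃ * (d₂ * W₁₂))
      ≈⟨ +-cong (+-cong (*-congˡ W≈) (*-congˡ W₂≈)) (+-cong (*-congˡ W₁≈) (*-congˡ W₁₂≈)) ⟩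
    _ ∎

  -- The results of `expand` for T_i T_j T_i f and T_j T_i T_j f over the common denominator (x -
  -- y)² (y - z)² (x - z): the first lacks a factor y - z, the second a factor x - y. The translates
  -- of f are independent variables here, s_i s_j s_i f and s_j s_i s_j f sharing the name `F₁₂₁`.
  compare : ∀ x y z A B F F₁ F₂ F₁₂ F₂₁ F₁₂₁ →
    (y - z) * ((x - z) * ((B - A) * y) * ((B - A) * z) * ((B - A) * y * F + (A * x - B * y) * F₁)
      + (x - y) * ((B - A) * y) * (A * y - B * z) * ((B - A) * z * F₂ + (A * x - B * z) * F₂₁)
      + ((y - z) * (A * x - B * y) * ((B - A) * z) * (- ((B - A) * x) * F₁ + - (A * y - B * x) * F)
      + (x - y) * (A * x - B * y) * (A * x - B * z) * ((B - A) * z * F₁₂ + (A * y - B * z) * F₁₂₁)))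
    ≈ (x - y) * ((x - z) * ((B - A) * z) * ((B - A) * y) * ((B - A) * z * F + (A * y - B * z) * F₂)
      + (y - z) * ((B - A) * z) * (A * x - B * y) * ((B - A) * z * F₁ + (A * x - B * z) * F₁₂)
      + ((x - y) * (A * y - B * z) * ((B - A) * z) * (- ((B - A) * y) * F₂ + - (A * z - B * y) * F)
      + (y - z) * (A * y - B * z) * (A * x - B * z) * ((B - A) * y * F₂₁ + (A * x - B * y) * F₁₂₁)))
  compare = solve 11 (λ x y z A B F F₁ F₂ F₁₂ F₂₁ F₁₂₁ →
    (y :- z) :* ((x :- z) :* ((B :- A) :* y) :* ((B :- A) :* z) :* ((B :- A) :* y :* F :+ (A :* x :- B :* y) :* F₁)
      :+ (x :- y) :* ((B :- A) :* y) :* (A :* y :- B :* z) :* ((B :- A) :* z :* F₂ :+ (A :* x :- B :* z) :* F₂₁)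
      :+ ((y :- z) :* (A :* x :- B :* y) :* ((B :- A) :* z) :* (:- ((B :- A) :* x) :* F₁ :+ :- (A :* y :- B :* x) :* F)
      :+ (x :- y) :* (A :* x :- B :* y) :* (A :* x :- B :* z) :* ((B :- A) :* z :* F₁₂ :+ (A :* y :- B :* z) :* F₁₂₁)))
    := (x :- y) :* ((x :- z) :* ((B :- A) :* z) :* ((B :- A) :* y) :* ((B :- A) :* z :* F :+ (A :* y :- B :* z) :* F₂)
      :+ (y :- z) :* ((B :- A) :* z) :* (A :* x :- B :* y) :* ((B :- A) :* z :* F₁ :+ (A :* x :- B :* z) :* F₁₂)
      :+ ((x :- y) :* (A :* y :- B :* z) :* ((B :- A) :* z) :* (:- ((B :- A) :* y) :* F₂ :+ :- (A :* z :- B :* y) :* F)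
      :+ (y :- z) :* (A :* y :- B :* z) :* (A :* x :- B :* z) :* ((B :- A) :* y :* F₂₁ :+ (A :* x :- B :* y) :* F₁₂₁)))) refl

-- Reduced words of all permutations

module NormalWords where
  open SymmetricGroup using (normalWord; allPermutations)
  open ≡.≡-Reasoning

  normalWords : ∀ m → List (List (Fin m))
  normalWords zero    = [] ∷ []
  normalWords (suc m) = concatMap (λ k → map (λ v → cycleWord k ++ map suc v) (normalWords m)) (allFin (suc (suc m)))

  -- Needed because removing an inserted point returns the original permutation only pointwise.
  normalWord-cong : ∀ {m} {v w : Permutation′ (suc m)} → v Perm.≈ w → normalWord v ≡ normalWord w
  normalWord-cong {zero}          p = ≡.refl
  normalWord-cong {suc m} {v} {w} p = ≡.cong₂ (λ k u → cycleWord k ++ map suc u) (p zero)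
    (normalWord-cong λ j → Fin.punchIn-injective (w ⟨$⟩ʳ zero) _ _ (begin
      punchIn (w ⟨$⟩ʳ zero) (Perm.remove zero v ⟨$⟩ʳ j)   ≡⟨ ≡.cong (λ k → punchIn k (Perm.remove zero v ⟨$⟩ʳ j)) (p zero) ⟨
      punchIn (v ⟨$⟩ʳ zero) (Perm.remove zero v ⟨$⟩ʳ j)   ≡⟨ Perm.punchIn-permute v zero j ⟨
      v ⟨$⟩ʳ suc j                                            ≡⟨ p (suc j) ⟩
      w ⟨$⟩ʳ suc j                                            ≡⟨ Perm.punchIn-permute w zero j ⟩
      punchIn (w ⟨$⟩ʳ zero) (Perm.remove zero w ⟨$⟩ʳ j)   ∎))

  normalWord-allPermutations : ∀ m → map normalWord (allPermutations (suc m)) ≡ normalWords m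
  normalWord-allPermutations zero    = ≡.refl
  normalWord-allPermutations (suc m) = begin
    map normalWord (concatMap (λ k → map (Perm.insert zero k) (allPermutations (suc m))) ks)
      ≡⟨ List.map-concatMap normalWord (λ k → map (Perm.insert zero k) (allPermutations (suc m))) ks ⟩
    concatMap (λ k → map normalWord (map (Perm.insert zero k) (allPermutations (suc m)))) ks
      ≡⟨ List.concatMap-cong (λ k → begin
           map normalWord (map (Perm.insert zero k) (allPermutations (suc m)))
             ≡⟨ List.map-∘ (allPermutations (suc m)) ⟨
           map (λ v → normalWord (Perm.insert zero k v)) (allPermutations (suc m))
             ≡⟨ List.map-cong (λ v → ≡.cong (λ u → cycleWord k ++ map suc u)
                  (normalWord-cong (Perm.remove-insert zero k v))) (allPermutations (suc m)) ⟩
           map (λ v → cycleWord k ++ map suc (normalWord v)) (allPermutations (suc m))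
             ≡⟨ List.map-∘ (allPermutations (suc m)) ⟩
           map (λ v → cycleWord k ++ map suc v) (map normalWord (allPermutations (suc m)))
             ≡⟨ ≡.cong (map (λ v → cycleWord k ++ map suc v)) (normalWord-allPermutations m) ⟩
           map (λ v → cycleWord k ++ map suc v) (normalWords m) ∎) ks ⟩
    concatMap (λ k → map (λ v → cycleWord k ++ map suc v) (normalWords m)) ks ∎
    where ks = allFin (suc (suc m))

open NormalWords

module ListFold {c r : Level} (M : CommutativeMonoid c r) where
  open CommutativeMonoid M

  fold : ∀ {A : Set} → List A → (A → Carrier) → Carrier
  fold xs φ = foldr _∙_ ε (map φ xs)

  fold-cong : ∀ {A : Set} (xs : List A) {φ ψ : A → Carrier} → (∀ x → φ x ≈ ψ x) → fold xs φ ≈ fold xs ψ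
  fold-cong []       p = refl
  fold-cong (x ∷ xs) p = ∙-cong (p x) (fold-cong xs p)

  fold-++ : ∀ {A : Set} (xs ys : List A) φ → fold (xs ++ ys) φ ≈ fold xs φ ∙ fold ys φ
  fold-++ []       ys φ = sym (identityˡ _)
  fold-++ (x ∷ xs) ys φ = trans (∙-congˡ (fold-++ xs ys φ)) (sym (assoc _ _ _))

  fold-map : ∀ {A B : Set} (h : A → B) xs φ → fold (map h xs) φ ≡ fold xs (φ ∘ h)
  fold-map h xs φ = ≡.cong (foldr _∙_ ε) (≡.sym (List.map-∘ xs))

  fold-concatMap : ∀ {A B : Set} (h : A → List B) xs φ → fold (concatMap h xs) φ ≈ fold xs (λ x → fold (h x) φ)
  fold-concatMap h []       φ = refl
  fold-concatMap h (x ∷ xs) φ = trans (fold-++ (h x) (concatMap h xs) φ) (∙-congˡ (fold-concatMap h xs φ))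

-- Units and quantum integers

module Quantum {c r : Level} (𝕂 : CommutativeRing c r) (m : ℕ) where
  open CommutativeRing 𝕂 hiding (zero)
  open Hecke 𝕂 m using (quantum)
  open IntegerCoefficients 𝕂
  open import Algebra.Properties.Semiring.Exp semiring using (_^_; ^-congˡ)
  open import Relation.Binary.Reasoning.Setoid setoid

  Unit : Carrier → Set (c ⊔ r)
  Unit = Invertible _≈_ 1# _*_

  unit-* : ∀ {a b} → Unit a → Unit b → Unit (a * b)
  unit-* {a} {b} (a⁻¹ , aˡ , aʳ) (b⁻¹ , bˡ , bʳ) = a⁻¹ * b⁻¹
    , trans (interchange a⁻¹ b⁻¹ a b) (trans (*-cong aˡ bˡ) (*-identityˡ 1#))
    , trans (interchange a b a⁻¹ b⁻¹) (trans (*-cong aʳ bʳ) (*-identityˡ 1#))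
    where open import Algebra.Properties.CommutativeSemigroup *-commutativeSemigroup using (interchange)

  unit-1 : Unit 1#
  unit-1 = 1# , *-identityˡ 1# , *-identityˡ 1#

  unit-^ : ∀ {a} → Unit a → ∀ k → Unit (a ^ k)
  unit-^ p zero    = unit-1
  unit-^ p (suc k) = unit-* p (unit-^ p k)

  unit-≈ : ∀ {a b} → a ≈ b → Unit a → Unit b
  unit-≈ p (a⁻¹ , l , r) = a⁻¹ , trans (*-congˡ (sym p)) l , trans (*-congʳ (sym p)) r

  unit-inverse : ∀ {a} (p : Unit a) → Unit (proj₁ p)
  unit-inverse {a} (a⁻¹ , l , r) = a , r , l

  quantum-cong : ∀ {q q′} → q ≈ q′ → ∀ k → quantum q k ≈ quantum q′ k
  quantum-cong p zero    = refl
  quantum-cong p (suc k) = +-cong (quantum-cong p k) (^-congˡ k p)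

  -- `quantum` adds the highest power last, whereas the coset recursion splits off the summand 1
  -- first.
  quantum-step : ∀ q k → quantum q (suc k) ≈ 1# + q * quantum q k
  quantum-step q zero    = trans (+-identityˡ 1#) (sym (trans (+-congˡ (zeroʳ q)) (+-identityʳ 1#)))
  quantum-step q (suc k) = begin
    quantum q (suc k) + q * q ^ k          ≈⟨ +-congʳ (quantum-step q k) ⟩
    1# + q * quantum q k + q * q ^ k       ≈⟨ +-assoc 1# _ _ ⟩
    1# + (q * quantum q k + q * q ^ k)     ≈⟨ +-congˡ (distribˡ q (quantum q k) (q ^ k)) ⟨
    1# + q * (quantum q k + q ^ k)         ∎

  -- The q-factorial, which is the Poincaré polynomial ∑ q^{ℓ(w)} of the symmetric group.
  quantum! : Carrier → ℕ → Carrier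
  quantum! q zero    = 1#
  quantum! q (suc k) = quantum q (suc k) * quantum! q k

  quantum-inverse : ∀ {q q′} → q * q′ ≈ 1# → ∀ k → q′ ^ k * quantum q (suc k) ≈ quantum q′ (suc k)
  quantum-inverse {q} {q′} inv zero    = *-identityˡ _
  quantum-inverse {q} {q′} inv (suc k) = begin
    q′ * q′ ^ k * quantum q (suc (suc k))
      ≈⟨ *-congˡ (quantum-step q (suc k)) ⟩
    q′ * q′ ^ k * (1# + q * quantum q (suc k))
      ≈⟨ solve 5 (λ q q′ p o z → q′ :* p :* (o :+ q :* z) := (q :* q′) :* (p :* z) :+ q′ :* p :* o) refl q q′ (q′ ^ k) 1# (quantum q (suc k)) ⟩
    (q * q′) * (q′ ^ k * quantum q (suc k)) + q′ * q′ ^ k * 1#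
      ≈⟨ +-cong (trans (*-cong inv (quantum-inverse inv k)) (*-identityˡ _)) (*-identityʳ _) ⟩
    quantum q′ (suc k) + q′ * q′ ^ k ∎

-- Symmetrizers of an abstract Hecke family

module HeckeSymmetrizer {c r : Level} (R : CommutativeRing c r)
  (u u⁻¹ : CommutativeRing.Carrier R)
  (u*u⁻¹ : CommutativeRing._≈_ R (CommutativeRing._*_ R u u⁻¹) (CommutativeRing.1# R)) where

  open CommutativeRing R hiding (zero)
  open IntegerCoefficients R
  open import Relation.Binary.Reasoning.Setoid setoid
  open import Algebra.Properties.Semiring.Exp semiring using (_^_; ^-homo-*)
  open import Algebra.Properties.Ring ring using (x+x≈x⇒x≈0)

  open Hecke R 0 using (quantum)
  open Quantum R 0 using (quantum-step; quantum!)

  -- `R` is both the space acted on and the source of scalars, and T_i does not commute with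
  -- multiplication by every element. Only u is required to pass through; the scalars that occur
  -- later are polynomials in u.
  record IsLinear (X : Carrier → Carrier) : Set (c ⊔ r) where
    field
      cong   : ∀ {f g} → f ≈ g → X f ≈ X g
      +-homo : ∀ f g → X (f + g) ≈ X f + X g
      u-homo : ∀ f → X (u * f) ≈ u * X f

    0-homo : X 0# ≈ 0#
    0-homo = x+x≈x⇒x≈0 (X 0#) (trans (sym (+-homo 0# 0#)) (cong (+-identityʳ 0#)))

    Scalar : Carrier → Set (c ⊔ r)
    Scalar a = ∀ f → X (a * f) ≈ a * X f

    scalar-0 : Scalar 0#
    scalar-0 f = trans (cong (zeroˡ f)) (trans 0-homo (sym (zeroˡ (X f))))

    scalar-1 : Scalar 1#
    scalar-1 f = trans (cong (*-identityˡ f)) (sym (*-identityˡ (X f)))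

    scalar-+ : ∀ {a b} → Scalar a → Scalar b → Scalar (a + b)
    scalar-+ {a} {b} p q f = begin
      X ((a + b) * f)          ≈⟨ cong (distribʳ f a b) ⟩
      X (a * f + b * f)        ≈⟨ trans (+-homo _ _) (+-cong (p f) (q f)) ⟩
      a * X f + b * X f        ≈⟨ distribʳ (X f) a b ⟨
      (a + b) * X f            ∎

    scalar-* : ∀ {a b} → Scalar a → Scalar b → Scalar (a * b)
    scalar-* {a} {b} p q f = begin
      X (a * b * f)            ≈⟨ cong (*-assoc a b f) ⟩
      X (a * (b * f))          ≈⟨ trans (p (b * f)) (*-congˡ (q f)) ⟩
      a * (b * X f)            ≈⟨ *-assoc a b (X f) ⟨
      a * b * X f              ∎

    scalar-^ : ∀ {a} → Scalar a → ∀ k → Scalar (a ^ k)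
    scalar-^ p zero    = scalar-1
    scalar-^ p (suc k) = scalar-* p (scalar-^ p k)

    scalar-quantum : ∀ k → Scalar (quantum (u * u) k)
    scalar-quantum zero    = scalar-0
    scalar-quantum (suc k) = scalar-+ (scalar-quantum k) (scalar-^ (scalar-* u-homo u-homo) k)

    scalar-quantum! : ∀ k → Scalar (quantum! (u * u) k)
    scalar-quantum! zero    = scalar-1
    scalar-quantum! (suc k) = scalar-* (scalar-quantum (suc k)) (scalar-quantum! k)

  -- `quadratic` is (T_i - u)(T_i + u⁻¹) = 0. Since `commute` and `braid` are symmetric relations,
  -- they are listed for i before j only.
  record IsHeckeFamily {m : ℕ} (T : Fin m → Carrier → Carrier) : Set (c ⊔ r) where
    field
      linear    : ∀ i → IsLinear (T i)
      quadratic : ∀ i f → T i (T i f) ≈ (u - u⁻¹) * T i f + f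
      commute   : ∀ i j → suc (toℕ i) ℕ.< toℕ j → ∀ f → T i (T j f) ≈ T j (T i f)
      braid     : ∀ i j → toℕ j ≡ suc (toℕ i) → ∀ f → T i (T j (T i f)) ≈ T j (T i (T j f))

  open IsLinear
  open IsHeckeFamily

  tail : ∀ {m} {T : Fin (suc m) → Carrier → Carrier} → IsHeckeFamily T → IsHeckeFamily (T ∘ suc)
  tail H = record
    { linear    = linear H ∘ suc
    ; quadratic = quadratic H ∘ suc
    ; commute   = λ i j p → commute H (suc i) (suc j) (s≤s p)
    ; braid     = λ i j p → braid H (suc i) (suc j) (≡.cong suc p)
    }

  -- ∑ₖ uᵏ T_{k-1} ⋯ T₀, summing over the minimal representatives of S_{m+1} / S_m.
  cosetSum : ∀ {m} → (Fin m → Carrier → Carrier) → Carrier → Carrier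
  cosetSum {zero}  T g = g
  cosetSum {suc m} T g = g + u * cosetSum (T ∘ suc) (T zero g)

  -- Each permutation is uniquely a coset representative times an element of the subgroup fixing 0,
  -- whose operators are `T ∘ suc`. This is how `normalWord` is built, so the sum over the group
  -- becomes an iterated coset sum.
  symmetrizer : ∀ {m} → (Fin m → Carrier → Carrier) → Carrier → Carrier
  symmetrizer {zero}  T f = f
  symmetrizer {suc m} T f = cosetSum T (symmetrizer (T ∘ suc) f)

  cosetSum-cong : ∀ {m} {T : Fin m → Carrier → Carrier} → (∀ i → IsLinear (T i)) →
                  ∀ {f g} → f ≈ g → cosetSum T f ≈ cosetSum T g
  cosetSum-cong {zero}  L p = p
  cosetSum-cong {suc m} L p = +-cong p (*-congˡ (cosetSum-cong (L ∘ suc) (cong (L zero) p)))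

  cosetSum-commute : ∀ {m} {T : Fin m → Carrier → Carrier} → (∀ i → IsLinear (T i)) →
                     ∀ {X} → IsLinear X → (∀ i f → X (T i f) ≈ T i (X f)) →
                     ∀ g → X (cosetSum T g) ≈ cosetSum T (X g)
  cosetSum-commute {zero}      L LX XT g = refl
  cosetSum-commute {suc m} {T} L {X} LX XT g = begin
    X (g + u * cosetSum (T ∘ suc) (T zero g))
      ≈⟨ trans (+-homo LX g _) (+-congˡ (u-homo LX _)) ⟩
    X g + u * X (cosetSum (T ∘ suc) (T zero g))
      ≈⟨ +-congˡ (*-congˡ (trans (cosetSum-commute (L ∘ suc) LX (XT ∘ suc) (T zero g))
           (cosetSum-cong (L ∘ suc) (XT zero g)))) ⟩
    X g + u * cosetSum (T ∘ suc) (T zero (X g)) ∎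

  cosetSum-u : ∀ {m} {T : Fin m → Carrier → Carrier} → (∀ i → IsLinear (T i)) →
               ∀ g → cosetSum T (u * g) ≈ u * cosetSum T g
  cosetSum-u L g = sym (cosetSum-commute L
    (record { cong = *-congˡ ; +-homo = distribˡ u ; u-homo = λ _ → refl }) (λ i f → sym (u-homo (L i) f)) g)

  -- T₀ commutes with T₂, T₃, ..., so `T zero g` is again an eigenvector for the later operators of
  -- the tail and induction handles every T_i except T₀. For T₀ the first two summands form an
  -- eigenvector by the quadratic relation, and on the remaining ones T₀ T₁ T₀ g = T₁ T₀ T₁ g = u T₁
  -- T₀ g.
  cosetSum-eigen : ∀ {m} {T : Fin m → Carrier → Carrier} → IsHeckeFamily T →
                   ∀ {g} → (∀ i → 1 ℕ.≤ toℕ i → T i g ≈ u * g) →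
                   ∀ i → T i (cosetSum T g) ≈ u * cosetSum T g
  cosetSum-eigen {suc m} {T} H {g} e (suc i) = begin
    T (suc i) (g + u * C′ (T zero g))
      ≈⟨ trans (+-homo (linear H (suc i)) g _) (+-congˡ (u-homo (linear H (suc i)) _)) ⟩
    T (suc i) g + u * T (suc i) (C′ (T zero g))
      ≈⟨ +-cong (e (suc i) (s≤s z≤n)) (*-congˡ (cosetSum-eigen (tail H) e′ i)) ⟩
    u * g + u * (u * C′ (T zero g))
      ≈⟨ distribˡ u g _ ⟨
    u * (g + u * C′ (T zero g)) ∎
    where
    C′ = cosetSum (T ∘ suc)
    e′ : ∀ j → 1 ℕ.≤ toℕ j → T (suc j) (T zero g) ≈ u * T zero g
    e′ j 1≤j = begin
      T (suc j) (T zero g)   ≈⟨ commute H zero (suc j) (s≤s 1≤j) g ⟨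
      T zero (T (suc j) g)   ≈⟨ cong (linear H zero) (e (suc j) (s≤s z≤n)) ⟩
      T zero (u * g)         ≈⟨ u-homo (linear H zero) g ⟩
      u * T zero g           ∎
  cosetSum-eigen {suc m} {T} H {g} e zero = at-zero m T H e
    where
    T₀-head : ∀ {m} {T : Fin (suc m) → Carrier → Carrier} → IsHeckeFamily T → ∀ g →
              T zero (g + u * T zero g) ≈ u * (g + u * T zero g)
    T₀-head {T = T} H g = begin
      T zero (g + u * h)
        ≈⟨ trans (+-homo (linear H zero) g _) (+-congˡ (u-homo (linear H zero) h)) ⟩
      h + u * T zero h
        -- Writing h as u u⁻¹ h lets it cancel the term -u u⁻¹ h produced by the quadratic relation.
        ≈⟨ +-cong (trans (sym (*-identityˡ h)) (*-congʳ (sym u*u⁻¹))) (*-congˡ (quadratic H zero g)) ⟩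
      u * u⁻¹ * h + u * ((u - u⁻¹) * h + g)
        ≈⟨ solve 4 (λ u v h g → u :* v :* h :+ u :* ((u :- v) :* h :+ g) := u :* (g :+ u :* h)) refl u u⁻¹ h g ⟩
      u * (g + u * h) ∎
      where h = T zero g

    at-zero : ∀ m (T : Fin (suc m) → Carrier → Carrier) → IsHeckeFamily T → ∀ {g} →
              (∀ i → 1 ℕ.≤ toℕ i → T i g ≈ u * g) → T zero (cosetSum T g) ≈ u * cosetSum T g
    at-zero zero    T H {g} e = T₀-head H g
    at-zero (suc m) T H {g} e = begin
      T₀ (g + u * (h + u * C″ (T₁ h)))
        ≈⟨ cong (linear H zero) (regroup (C″ (T₁ h))) ⟩
      T₀ ((g + u * h) + u * (u * C″ (T₁ h)))
        ≈⟨ trans (+-homo (linear H zero) _ _) (+-congˡ (trans (u-homo (linear H zero) _) (*-congˡ (u-homo (linear H zero) _)))) ⟩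
      T₀ (g + u * h) + u * (u * T₀ (C″ (T₁ h)))
        ≈⟨ +-cong (T₀-head H g) (*-congˡ (*-congˡ T₀C″)) ⟩
      u * (g + u * h) + u * (u * (u * C″ (T₁ h)))
        ≈⟨ solve 4 (λ u g h k → u :* (g :+ u :* h) :+ u :* (u :* (u :* k)) := u :* (g :+ u :* (h :+ u :* k))) refl
             u g h (C″ (T₁ h)) ⟩
      u * (g + u * (h + u * C″ (T₁ h))) ∎
      where
      T₀ = T zero
      T₁ = T (suc zero)
      h  = T₀ g
      L″ = λ i → linear H (suc (suc i))
      C″ = cosetSum (λ i → T (suc (suc i)))
      regroup : ∀ k → g + u * (h + u * k) ≈ (g + u * h) + u * (u * k)
      regroup k = solve 4 (λ u g h k → g :+ u :* (h :+ u :* k) := (g :+ u :* h) :+ u :* (u :* k)) refl u g h k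
      T₀C″ : T₀ (C″ (T₁ h)) ≈ u * C″ (T₁ h)
      T₀C″ = begin
        T₀ (C″ (T₁ h))        ≈⟨ cosetSum-commute L″ (linear H zero)
                                   (λ i → commute H zero (suc (suc i)) (s≤s (s≤s z≤n))) (T₁ h) ⟩
        C″ (T₀ (T₁ (T₀ g)))   ≈⟨ cosetSum-cong L″ (braid H zero (suc zero) ≡.refl g) ⟩
        C″ (T₁ (T₀ (T₁ g)))   ≈⟨ cosetSum-cong L″ (cong (linear H (suc zero))
                                   (trans (cong (linear H zero) (e (suc zero) (s≤s z≤n))) (u-homo (linear H zero) g))) ⟩
        C″ (T₁ (u * h))       ≈⟨ cosetSum-cong L″ (u-homo (linear H (suc zero)) h) ⟩
        C″ (u * T₁ h)         ≈⟨ cosetSum-u L″ (T₁ h) ⟩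
        u * C″ (T₁ h)         ∎

  symmetrizer-eigen : ∀ {m} {T : Fin m → Carrier → Carrier} → IsHeckeFamily T →
                      ∀ f i → T i (symmetrizer T f) ≈ u * symmetrizer T f
  symmetrizer-eigen {suc m} {T} H f = cosetSum-eigen H λ where
    (suc i) _ → symmetrizer-eigen (tail H) f i

  -- The k-th representative has length k and contributes u^k twice, as its coefficient and as its
  -- eigenvalue; hence a quantum integer in u².
  cosetSum-scalar : ∀ {m} {T : Fin m → Carrier → Carrier} → (∀ i → IsLinear (T i)) →
                    ∀ {f} → (∀ i → T i f ≈ u * f) → cosetSum T f ≈ quantum (u * u) (suc m) * f
  cosetSum-scalar {zero}      L {f} e = sym (trans (*-congʳ (+-identityˡ 1#)) (*-identityˡ f))
  cosetSum-scalar {suc m} {T} L {f} e = begin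
    f + u * cosetSum (T ∘ suc) (T zero f)
      ≈⟨ +-congˡ (*-congˡ (trans (cosetSum-cong (L ∘ suc) (e zero)) (cosetSum-u (L ∘ suc) f))) ⟩
    f + u * (u * cosetSum (T ∘ suc) f)
      ≈⟨ +-cong (sym (*-identityˡ f)) (*-congˡ (*-congˡ (cosetSum-scalar (L ∘ suc) (e ∘ suc)))) ⟩
    1# * f + u * (u * (Q * f))
      ≈⟨ solve 4 (λ i u q f → i :* f :+ u :* (u :* (q :* f)) := (i :+ (u :* u) :* q) :* f) refl 1# u Q f ⟩
    (1# + u * u * Q) * f
      ≈⟨ *-congʳ (quantum-step (u * u) (suc m)) ⟨
    quantum (u * u) (suc (suc m)) * f ∎
    where Q = quantum (u * u) (suc m)

  symmetrizer-scalar : ∀ {m} {T : Fin m → Carrier → Carrier} → (∀ i → IsLinear (T i)) →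
                       ∀ {f} → (∀ i → T i f ≈ u * f) → symmetrizer T f ≈ quantum! (u * u) (suc m) * f
  symmetrizer-scalar {zero}      L {f} e =
    sym (trans (*-congʳ (trans (*-identityʳ _) (+-identityˡ 1#))) (*-identityˡ f))
  symmetrizer-scalar {suc m} {T} L {f} e = begin
    cosetSum T (symmetrizer (T ∘ suc) f)       ≈⟨ cosetSum-cong L (symmetrizer-scalar (L ∘ suc) (e ∘ suc)) ⟩
    cosetSum T (Q! * f)                        ≈⟨ cosetSum-scalar L e′ ⟩
    Q * (Q! * f)                               ≈⟨ *-assoc Q Q! f ⟨
    Q * Q! * f                                 ∎
    where
    Q  = quantum (u * u) (suc (suc m))
    Q! = quantum! (u * u) (suc m)
    -- `Q!` is a polynomial in u, so the T_i commute with it and the multiple of f remains an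
    -- eigenvector.
    e′ : ∀ i → T i (Q! * f) ≈ u * (Q! * f)
    e′ i = begin
      T i (Q! * f)       ≈⟨ scalar-quantum! (L i) (suc m) f ⟩
      Q! * T i f         ≈⟨ *-congˡ (e i) ⟩
      Q! * (u * f)       ≈⟨ solve 3 (λ q u f → q :* (u :* f) := u :* (q :* f)) refl Q! u f ⟩
      u * (Q! * f)       ∎

  open ListFold +-commutativeMonoid
    renaming (fold to ∑; fold-cong to ∑-cong; fold-map to ∑-map; fold-concatMap to ∑-concatMap) public

  ∑-*ˡ : ∀ {A : Set} (xs : List A) a φ → ∑ xs (λ x → a * φ x) ≈ a * ∑ xs φ
  ∑-*ˡ []       a φ = sym (zeroʳ a)
  ∑-*ˡ (x ∷ xs) a φ = trans (+-congˡ (∑-*ˡ xs a φ)) (sym (distribˡ a (φ x) _))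

  ∑-linear : ∀ {X} → IsLinear X → ∀ {A : Set} (xs : List A) φ → X (∑ xs φ) ≈ ∑ xs (X ∘ φ)
  ∑-linear L []       φ = 0-homo L
  ∑-linear L (x ∷ xs) φ = trans (+-homo L (φ x) _) (+-congˡ (∑-linear L xs φ))

  word-linear : ∀ {m} {T : Fin m → Carrier → Carrier} → (∀ i → IsLinear (T i)) →
                ∀ w → IsLinear (λ f → foldr T f w)
  word-linear L []      = record { cong = id ; +-homo = λ _ _ → refl ; u-homo = λ _ → refl }
  word-linear L (i ∷ w) = record
    { cong   = λ p → cong (L i) (cong Lw p)
    ; +-homo = λ f g → trans (cong (L i) (+-homo Lw f g)) (+-homo (L i) _ _)
    ; u-homo = λ f → trans (cong (L i) (u-homo Lw f)) (u-homo (L i) _)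
    }
    where Lw = word-linear L w

  cosetSum-words : ∀ {m} {T : Fin m → Carrier → Carrier} → (∀ i → IsLinear (T i)) → ∀ g →
    ∑ (allFin (suc m)) (λ k → u ^ length (cycleWord k) * foldr T g (cycleWord k)) ≈ cosetSum T g
  cosetSum-words {zero}      L g = trans (+-identityʳ _) (*-identityˡ g)
  cosetSum-words {suc m} {T} L g = +-cong (*-identityˡ g) (begin
    ∑ (List.tabulate suc) φ
      ≡⟨ ≡.cong (λ ks → ∑ ks φ) (List.map-tabulate {n = suc m} id suc) ⟨
    ∑ (map suc (allFin (suc m))) φ
      ≡⟨ ∑-map suc (allFin (suc m)) φ ⟩
    ∑ (allFin (suc m)) (φ ∘ suc)
      ≈⟨ ∑-cong (allFin (suc m)) step ⟩
    ∑ (allFin (suc m)) (λ k → u * (u ^ length (cycleWord k) * foldr (T ∘ suc) (T zero g) (cycleWord k)))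
      ≈⟨ ∑-*ˡ (allFin (suc m)) u _ ⟩
    u * ∑ (allFin (suc m)) (λ k → u ^ length (cycleWord k) * foldr (T ∘ suc) (T zero g) (cycleWord k))
      ≈⟨ *-congˡ (cosetSum-words (L ∘ suc) (T zero g)) ⟩
    u * cosetSum (T ∘ suc) (T zero g) ∎)
    where
    φ : Fin (suc (suc m)) → Carrier
    φ k = u ^ length (cycleWord k) * foldr T g (cycleWord k)
    step : ∀ k → φ (suc k) ≈ u * (u ^ length (cycleWord k) * foldr (T ∘ suc) (T zero g) (cycleWord k))
    step k = trans (*-cong
        (reflexive (≡.cong (u ^_) (≡.trans (List.length-++ (map suc w))
          (≡.trans (ℕ.+-comm _ 1) (≡.cong suc (List.length-map suc w))))))
        (reflexive (≡.trans (List.foldr-++ T g (map suc w) (zero ∷ [])) (List.foldr-map T suc (T zero g) w))))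
      (*-assoc u _ _)
      where w = cycleWord k

  -- Lengths add under concatenation, so the weight of a word is the product of the weights of its
  -- coset part and its tail. By linearity the inner sum over tails is formed before the coset word
  -- acts.
  symmetrizer-words : ∀ {m} {T : Fin m → Carrier → Carrier} → (∀ i → IsLinear (T i)) → ∀ f →
    ∑ (normalWords m) (λ w → u ^ length w * foldr T f w) ≈ symmetrizer T f
  symmetrizer-words {zero}      L f = trans (+-identityʳ _) (*-identityˡ f)
  symmetrizer-words {suc m} {T} L f = begin
    ∑ (normalWords (suc m)) φ
      ≈⟨ ∑-concatMap (λ k → map (λ v → cycleWord k ++ map suc v) (normalWords m)) (allFin (suc (suc m))) φ ⟩
    ∑ (allFin (suc (suc m))) (λ k → ∑ (map (λ v → cycleWord k ++ map suc v) (normalWords m)) φ)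
      ≈⟨ ∑-cong (allFin (suc (suc m))) (λ k → begin
           ∑ (map (λ v → cycleWord k ++ map suc v) (normalWords m)) φ
             ≡⟨ ∑-map (λ v → cycleWord k ++ map suc v) (normalWords m) φ ⟩
           ∑ (normalWords m) (λ v → φ (cycleWord k ++ map suc v))
             ≈⟨ ∑-cong (normalWords m) (split (cycleWord k)) ⟩
           ∑ (normalWords m) (λ v → u ^ length (cycleWord k) * foldr T (ψ v) (cycleWord k))
             ≈⟨ ∑-*ˡ (normalWords m) (u ^ length (cycleWord k)) _ ⟩
           u ^ length (cycleWord k) * ∑ (normalWords m) (λ v → foldr T (ψ v) (cycleWord k))
             ≈⟨ *-congˡ (∑-linear (word-linear L (cycleWord k)) (normalWords m) ψ) ⟨
           u ^ length (cycleWord k) * foldr T (∑ (normalWords m) ψ) (cycleWord k)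
             ≈⟨ *-congˡ (cong (word-linear L (cycleWord k)) (symmetrizer-words (L ∘ suc) f)) ⟩
           u ^ length (cycleWord k) * foldr T (symmetrizer (T ∘ suc) f) (cycleWord k) ∎) ⟩
    ∑ (allFin (suc (suc m))) (λ k → u ^ length (cycleWord k) * foldr T (symmetrizer (T ∘ suc) f) (cycleWord k))
      ≈⟨ cosetSum-words L (symmetrizer (T ∘ suc) f) ⟩
    cosetSum T (symmetrizer (T ∘ suc) f) ∎
    where
    φ : List (Fin (suc m)) → Carrier
    φ w = u ^ length w * foldr T f w
    ψ : List (Fin m) → Carrier
    ψ v = u ^ length v * foldr (T ∘ suc) f v
    split : ∀ w v → φ (w ++ map suc v) ≈ u ^ length w * foldr T (ψ v) w
    split w v = begin
      u ^ length (w ++ map suc v) * foldr T f (w ++ map suc v)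
        ≈⟨ *-cong
             (trans (reflexive (≡.cong (u ^_) (≡.trans (List.length-++ w) (≡.cong (length w ℕ.+_) (List.length-map suc v)))))
               (^-homo-* u (length w) (length v)))
             (reflexive (≡.trans (List.foldr-++ T f w (map suc v)) (≡.cong (λ g → foldr T g w) (List.foldr-map T suc f v)))) ⟩
      u ^ length w * u ^ length v * foldr T g w
        ≈⟨ *-assoc (u ^ length w) (u ^ length v) _ ⟩
      u ^ length w * (u ^ length v * foldr T g w)
        -- The weight of the tail moves inside the operators of the coset word, where it belongs to
        -- the inner sum.
        ≈⟨ *-congˡ (scalar-^ Lw (u-homo Lw) (length v) g) ⟨
      u ^ length w * foldr T (ψ v) w ∎
      where
      g  = foldr (T ∘ suc) f v
      Lw = word-linear L w

-- Relations between simple transpositions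

module SimpleTranspositions {m : ℕ} where

  private
    transpose-l : ∀ {n} (a b : Fin n) → Perm.transpose a b ⟨$⟩ʳ a ≡ b
    transpose-l a b with a Fin.≟ a
    ... | yes _ = ≡.refl
    ... | no ¬p = contradiction ≡.refl ¬p

    transpose-r : ∀ {n} (a b : Fin n) → Perm.transpose a b ⟨$⟩ʳ b ≡ a
    transpose-r a b with b Fin.≟ a
    ... | yes p = p
    ... | no _ with b Fin.≟ b
    ...   | yes _ = ≡.refl
    ...   | no ¬p = contradiction ≡.refl ¬p

    transpose-≢ : ∀ {n} {a b k : Fin n} → k ≢ a → k ≢ b → Perm.transpose a b ⟨$⟩ʳ k ≡ k
    transpose-≢ {a = a} {b} {k} p q with k Fin.≟ a
    ... | yes e = contradiction e p
    ... | no _ with k Fin.≟ b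
    ...   | yes e = contradiction e q
    ...   | no _  = ≡.refl

  inject₁≢suc : ∀ (i : Fin m) → inject₁ i ≢ suc i
  inject₁≢suc i eq = ℕ.1+n≢n (≡.sym (≡.trans (≡.sym (Fin.toℕ-inject₁ i)) (≡.cong toℕ eq)))

  s-inject₁ : ∀ i → s {m} i ⟨$⟩ʳ inject₁ i ≡ suc i
  s-inject₁ i = transpose-l (inject₁ i) (suc i)

  s-suc : ∀ i → s {m} i ⟨$⟩ʳ suc i ≡ inject₁ i
  s-suc i = transpose-r (inject₁ i) (suc i)

  s-≢ : ∀ i {k} → k ≢ inject₁ i → k ≢ suc i → s {m} i ⟨$⟩ʳ k ≡ k
  s-≢ i = transpose-≢

  adjacent : ∀ (i j : Fin m) → toℕ j ≡ suc (toℕ i) → inject₁ j ≡ suc i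
  adjacent i j p = Fin.toℕ-injective (≡.trans (Fin.toℕ-inject₁ j) p)

  s-inject₁⁺ : ∀ {i j : Fin m} → inject₁ j ≡ suc i → s {m} j ⟨$⟩ʳ suc i ≡ suc j
  s-inject₁⁺ {j = j} e = ≡.trans (≡.cong (s j ⟨$⟩ʳ_) (≡.sym e)) (s-inject₁ j)

  s-suc⁺ : ∀ {i j : Fin m} → inject₁ j ≡ suc i → s {m} j ⟨$⟩ʳ suc j ≡ suc i
  s-suc⁺ {j = j} e = ≡.trans (s-suc j) e

  inject₁-< : ∀ {i j : Fin m} → toℕ i ℕ.< toℕ j → inject₁ i ≢ suc j
  inject₁-< {i} {j} i<j eq = ℕ.<-irrefl (≡.trans (≡.sym (Fin.toℕ-inject₁ i)) (≡.cong toℕ eq)) (ℕ.m<n⇒m<1+n i<j)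

  s-fix-left : ∀ {i j : Fin m} → toℕ i ℕ.< toℕ j → s {m} j ⟨$⟩ʳ inject₁ i ≡ inject₁ i
  s-fix-left {i} {j} i<j = s-≢ j
    (λ e → ℕ.<-irrefl (≡.cong toℕ (Fin.inject₁-injective e)) i<j) (inject₁-< i<j)

  s-fix-right : ∀ {i j : Fin m} → toℕ i ℕ.< toℕ j → s {m} i ⟨$⟩ʳ suc j ≡ suc j
  s-fix-right {i} {j} i<j = s-≢ i
    (λ e → inject₁-< i<j (≡.sym e)) (λ e → ℕ.<-irrefl (≡.cong toℕ (≡.sym (Fin.suc-injective e))) i<j)

  -- Both sides are the transposition of `inject₁ i` and `suc j`; the cases are these two points,
  -- the point `suc i` between them, and all others.
  s-braid : ∀ (i j : Fin m) → toℕ j ≡ suc (toℕ i) → (s i ∘ₚ s j ∘ₚ s i) Perm.≈ (s j ∘ₚ s i ∘ₚ s j)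
  s-braid i j p k with toSum (k Fin.≟ inject₁ i)
  ... | inj₁ ≡.refl = ≡.trans (≡.cong (λ l → s i ⟨$⟩ʳ (s j ⟨$⟩ʳ l)) (s-inject₁ i))
        (≡.trans (≡.cong (s i ⟨$⟩ʳ_) (s-inject₁⁺ (adjacent i j p)))
        (≡.trans (s-fix-right i<j)
        (≡.sym (≡.trans (≡.cong (λ l → s j ⟨$⟩ʳ (s i ⟨$⟩ʳ l)) (s-fix-left i<j))
        (≡.trans (≡.cong (s j ⟨$⟩ʳ_) (s-inject₁ i)) (s-inject₁⁺ (adjacent i j p)))))))
    where
    i<j : toℕ i ℕ.< toℕ j
    i<j = ℕ.≤-reflexive (≡.sym p)
  ... | inj₂ k≢a with toSum (k Fin.≟ suc i)
  ...   | inj₁ ≡.refl = ≡.trans (≡.cong (λ l → s i ⟨$⟩ʳ (s j ⟨$⟩ʳ l)) (s-suc i))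
        (≡.trans (≡.cong (s i ⟨$⟩ʳ_) (s-fix-left i<j))
        (≡.trans (s-inject₁ i)
        (≡.sym (≡.trans (≡.cong (λ l → s j ⟨$⟩ʳ (s i ⟨$⟩ʳ l)) (s-inject₁⁺ (adjacent i j p)))
        (≡.trans (≡.cong (s j ⟨$⟩ʳ_) (s-fix-right i<j)) (s-suc⁺ (adjacent i j p)))))))
    where
    i<j : toℕ i ℕ.< toℕ j
    i<j = ℕ.≤-reflexive (≡.sym p)
  ...   | inj₂ k≢b with toSum (k Fin.≟ suc j)
  ...     | inj₁ ≡.refl = ≡.trans (≡.cong (λ l → s i ⟨$⟩ʳ (s j ⟨$⟩ʳ l)) (s-fix-right i<j))
        (≡.trans (≡.cong (s i ⟨$⟩ʳ_) (s-suc⁺ (adjacent i j p)))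
        (≡.trans (s-suc i)
        (≡.sym (≡.trans (≡.cong (λ l → s j ⟨$⟩ʳ (s i ⟨$⟩ʳ l)) (s-suc⁺ (adjacent i j p)))
        (≡.trans (≡.cong (s j ⟨$⟩ʳ_) (s-suc i)) (s-fix-left i<j))))))
    where
    i<j : toℕ i ℕ.< toℕ j
    i<j = ℕ.≤-reflexive (≡.sym p)
  ...     | inj₂ k≢d = ≡.trans (≡.cong (λ l → s i ⟨$⟩ʳ (s j ⟨$⟩ʳ l)) i-fix)
        (≡.trans (≡.cong (s i ⟨$⟩ʳ_) j-fix) (≡.trans i-fix
        (≡.sym (≡.trans (≡.cong (λ l → s j ⟨$⟩ʳ (s i ⟨$⟩ʳ l)) j-fix)
        (≡.trans (≡.cong (s j ⟨$⟩ʳ_) i-fix) j-fix)))))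
    where
    i-fix : s i ⟨$⟩ʳ k ≡ k
    i-fix = s-≢ i k≢a k≢b
    j-fix : s j ⟨$⟩ʳ k ≡ k
    j-fix = s-≢ j (λ e → k≢b (≡.trans e (adjacent i j p))) k≢d

  s-far-left : ∀ {i j : Fin m} → suc (toℕ i) ℕ.< toℕ j → s {m} j ⟨$⟩ʳ suc i ≡ suc i
  s-far-left {i} {j} p = s-≢ j
    (λ e → ℕ.<-irrefl (≡.trans (≡.cong toℕ e) (Fin.toℕ-inject₁ j)) p)
    (λ e → ℕ.<-irrefl (≡.cong toℕ (Fin.suc-injective e)) (ℕ.<⇒≤ p))

  s-far-right : ∀ {i j : Fin m} → suc (toℕ i) ℕ.< toℕ j → s {m} i ⟨$⟩ʳ inject₁ j ≡ inject₁ j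
  s-far-right {i} {j} p = s-≢ i
    (λ e → ℕ.<-irrefl (≡.sym (≡.cong toℕ (Fin.inject₁-injective e))) (ℕ.<⇒≤ p))
    (λ e → ℕ.<-irrefl (≡.sym (≡.trans (≡.sym (Fin.toℕ-inject₁ j)) (≡.cong toℕ e))) p)

  s-commute : ∀ (i j : Fin m) → suc (toℕ i) ℕ.< toℕ j → (s j ∘ₚ s i) Perm.≈ (s i ∘ₚ s j)
  s-commute i j p k with toSum (k Fin.≟ inject₁ i)
  ... | inj₁ ≡.refl = ≡.trans (≡.cong (s i ⟨$⟩ʳ_) (s-fix-left (ℕ.<⇒≤ p)))
        (≡.trans (s-inject₁ i) (≡.sym (≡.trans (≡.cong (s j ⟨$⟩ʳ_) (s-inject₁ i)) (s-far-left p))))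
  ... | inj₂ k≢a with toSum (k Fin.≟ suc i)
  ...   | inj₁ ≡.refl = ≡.trans (≡.cong (s i ⟨$⟩ʳ_) (s-far-left p))
        (≡.trans (s-suc i) (≡.sym (≡.trans (≡.cong (s j ⟨$⟩ʳ_) (s-suc i)) (s-fix-left (ℕ.<⇒≤ p)))))
  ...   | inj₂ k≢b with toSum (k Fin.≟ inject₁ j)
  ...     | inj₁ ≡.refl = ≡.trans (≡.cong (s i ⟨$⟩ʳ_) (s-inject₁ j))
        (≡.trans (s-fix-right (ℕ.<⇒≤ p)) (≡.sym (≡.trans (≡.cong (s j ⟨$⟩ʳ_) (s-far-right p)) (s-inject₁ j))))
  ...     | inj₂ k≢d with toSum (k Fin.≟ suc j)
  ...       | inj₁ ≡.refl = ≡.trans (≡.cong (s i ⟨$⟩ʳ_) (s-suc j))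
        (≡.trans (s-far-right p) (≡.sym (≡.trans (≡.cong (s j ⟨$⟩ʳ_) (s-fix-right (ℕ.<⇒≤ p))) (s-suc j))))
  ...       | inj₂ k≢e = ≡.trans (≡.cong (s i ⟨$⟩ʳ_) (s-≢ j k≢d k≢e))
        (≡.trans (s-≢ i k≢a k≢b) (≡.sym (≡.trans (≡.cong (s j ⟨$⟩ʳ_) (s-≢ i k≢a k≢b)) (s-≢ j k≢d k≢e))))

open SimpleTranspositions

-- Integer arithmetic for exponents

module IntegerLemmas where
  open ℤ-Solver.+-*-Solver

  i<1+∣i∣ : ∀ i → i ℤ.< + suc ℤ.∣ i ∣
  i<1+∣i∣ (+ n)    = ℤ.+<+ (ℕ.n<1+n n)
  i<1+∣i∣ -[1+ n ] = ℤ.-<+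

  i<1+i : ∀ i → i ℤ.< 1ℤ ℤ.+ i
  i<1+i i = ≡.subst (ℤ._< 1ℤ ℤ.+ i) (ℤ.+-identityˡ i) (ℤ.+-monoˡ-< i (ℤ.+<+ (s≤s z≤n)))

  -1+i<i : ∀ i → -1ℤ ℤ.+ i ℤ.< i
  -1+i<i i = ≡.subst (-1ℤ ℤ.+ i ℤ.<_) (ℤ.+-identityˡ i) (ℤ.+-monoˡ-< i ℤ.-<+)

  archimedean : ∀ i j → ∃ λ k → i ℤ.< j ℤ.+ + k
  archimedean i j = suc ℤ.∣ i ℤ.- j ∣ , ≡.subst (ℤ._< j ℤ.+ + suc ℤ.∣ i ℤ.- j ∣)
    (solve 2 (λ i j → j :+ (i :- j) := i) ≡.refl i j) (ℤ.+-monoʳ-< j (i<1+∣i∣ (i ℤ.- j)))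

  +-suc-shift : ∀ i k → i ℤ.+ + suc k ≡ (1ℤ ℤ.+ i) ℤ.+ + k
  +-suc-shift i k = solve 3 (λ o i k → i :+ (o :+ k) := (o :+ i) :+ k) ≡.refl 1ℤ i (+ k)

  combine : ∀ k v a → v ℤ.+ (k ℤ.* v ℤ.+ a) ≡ ℤ.suc k ℤ.* v ℤ.+ a
  combine = solve 3 (λ k v a → v :+ (k :* v :+ a) := (con 1ℤ :+ k) :* v :+ a) ≡.refl

  cancel-combine : ∀ k v a → k ℤ.* v ℤ.+ (ℤ.- k ℤ.* v ℤ.+ a) ≡ a
  cancel-combine = solve 3 (λ k v a → k :* v :+ (:- k :* v :+ a) := a) ≡.refl

  minus-self : ∀ k → k ℤ.* -1ℤ ℤ.+ k ≡ 0ℤ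
  minus-self = solve 1 (λ k → k :* con -1ℤ :+ k := con 0ℤ) ≡.refl

  at-source : ∀ p q → (q ℤ.- p) ℤ.* 1ℤ ℤ.+ p ≡ q
  at-source = solve 2 (λ p q → (q :- p) :* con 1ℤ :+ p := q) ≡.refl

  at-target : ∀ p q → (q ℤ.- p) ℤ.* -1ℤ ℤ.+ q ≡ p
  at-target = solve 2 (λ p q → (q :- p) :* con -1ℤ :+ q := p) ≡.refl

open IntegerLemmas

-- Monomials, binomials and regularity

module LaurentProperties {c r : Level} (𝕂 : CommutativeRing c r) (n : ℕ) where
  open Laurent 𝕂 n
  module K = CommutativeRing 𝕂
  open K using () renaming (Carrier to K; _≈_ to _≈ᴷ_; _*_ to _*ᴷ_; -_ to -ᴷ_; _+_ to _+ᴷ_; 0# to 0ᴷ; 1# to 1ᴷ)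
  module 𝕃 = CommutativeRing Laurent-commutativeRing
  open IntegerCoefficients Laurent-commutativeRing
  open import Algebra.Properties.Ring 𝕃.ring using (x∙y⁻¹≈ε⇒x≈y; x≈y⇒x∙y⁻¹≈ε; x[y-z]≈xy-xz)
  open import Relation.Binary.Reasoning.Setoid ≋-setoid

  opaque
    unfolding _+ᴸ_

    monomial-* : ∀ k l a b → ((k , a) ∷ []) *ᴸ ((l , b) ∷ []) ≋ (k *ᴷ l , a ⊕ b) ∷ []
    monomial-* k l a b = ≋-refl

    monomial-+ : ∀ k l a → ((k , a) ∷ []) +ᴸ ((l , a) ∷ []) ≋ (k +ᴷ l , a) ∷ []
    monomial-+ k l a = mk≋ λ e → go e
      where
      go : ∀ e → coeff (((k , a) ∷ []) +ᴸ ((l , a) ∷ [])) e ≈ᴷ coeff ((k +ᴷ l , a) ∷ []) e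
      go e with a ≟ᴱ e
      ... | yes _ = K.sym (K.+-assoc k l 0ᴷ)
      ... | no _  = K.+-identityˡ _

    monomial-neg : ∀ k a → -ᴸ ((k , a) ∷ []) ≋ (-ᴷ k , a) ∷ []
    monomial-neg k a = ≋-refl

    monomial-cons : ∀ u f → (u ∷ f) ≋ (u ∷ []) +ᴸ f
    monomial-cons u f = ≋-refl

    coeff-monomial-* : ∀ k a f e → coeff (((k , a) ∷ []) *ᴸ f) e ≈ᴷ k *ᴷ coeff f (⊖ a ⊕ e)
    coeff-monomial-* k a f e = K.trans (coeff-+ ((k , a) ⊛ f) [] e) (K.trans (K.+-identityʳ _) (coeff-⊛ k a f e))

    •-monomial : ∀ w k a → w • ((k , a) ∷ []) ≋ (k , permuteᴱ w a) ∷ []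
    •-monomial w k a = ≋-refl

    •-∘ : ∀ v w f → w • (v • f) ≋ (v ∘ₚ w) • f
    •-∘ v w []            = ≋-refl
    •-∘ v w ((k , a) ∷ f) = ∷-cong K.refl
      (ext λ j → ≡.trans (permuteᴱ-lookup w (permuteᴱ v a) j)
        (≡.trans (permuteᴱ-lookup v a (w ⟨$⟩ˡ j)) (≡.sym (permuteᴱ-lookup (v ∘ₚ w) a j))))
      (•-∘ v w f)

    •-≈ : ∀ {v w} → v Perm.≈ w → ∀ f → v • f ≋ w • f
    •-≈ p []            = ≋-refl
    •-≈ {v} {w} p ((k , a) ∷ f) = ∷-cong K.refl
      (ext λ j → ≡.trans (permuteᴱ-lookup v a j) (≡.trans (≡.cong (lookup a) (inverse-≈ j))
        (≡.sym (permuteᴱ-lookup w a j))))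
      (•-≈ {v} {w} p f)
      where
      inverse-≈ : ∀ j → v ⟨$⟩ˡ j ≡ w ⟨$⟩ˡ j
      inverse-≈ j = ≡.trans (≡.cong (v ⟨$⟩ˡ_) (≡.sym (≡.trans (p (w ⟨$⟩ˡ j)) (Perm.inverseʳ w)))) (Perm.inverseˡ v)

  monomial-cong : ∀ {k l a b} → k ≈ᴷ l → a ≡ b → ((k , a) ∷ []) ≋ ((l , b) ∷ [])
  monomial-cong p q = ∷-cong p q ≋-refl

  const-cong : ∀ {k l} → k ≈ᴷ l → const k ≋ const l
  const-cong p = monomial-cong p ≡.refl

  const-* : ∀ k l → const (k *ᴷ l) ≋ const k *ᴸ const l
  const-* k l = ≋-sym (≋-trans (monomial-* k l 0ᴱ 0ᴱ) (monomial-cong K.refl (⊕-identityˡ 0ᴱ)))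

  const-+ : ∀ k l → const (k +ᴷ l) ≋ const k +ᴸ const l
  const-+ k l = ≋-sym (monomial-+ k l 0ᴱ)

  const-neg : ∀ k → const (-ᴷ k) ≋ -ᴸ const k
  const-neg k = ≋-sym (monomial-neg k 0ᴱ)

  const-0 : const 0ᴷ ≋ 0ᴸ
  const-0 = mk≋ λ e → go e
    where
    go : ∀ e → coeff (const 0ᴷ) e ≈ᴷ 0ᴷ
    go e with 0ᴱ ≟ᴱ e
    ... | yes _ = K.+-identityˡ 0ᴷ
    ... | no _  = K.+-identityˡ 0ᴷ

  εᴱ : Fin n → Exponent
  εᴱ i = 0ᴱ [ i ]≔ 1ℤ

  lookup-ε : ∀ i → lookup (εᴱ i) i ≡ 1ℤ
  lookup-ε i = Vec.lookup∘update i 0ᴱ 1ℤ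

  lookup-ε-≢ : ∀ {i j} → j ≢ i → lookup (εᴱ i) j ≡ 0ℤ
  lookup-ε-≢ {i} {j} p = ≡.trans (Vec.lookup∘update′ p 0ᴱ 1ℤ) (Vec.lookup-replicate j 0ℤ)

  lookup-⊕ : ∀ a b j → lookup (a ⊕ b) j ≡ lookup a j ℤ.+ lookup b j
  lookup-⊕ a b j = Vec.lookup-zipWith ℤ._+_ j a b

  lookup-⊖ : ∀ a j → lookup (⊖ a) j ≡ ℤ.- lookup a j
  lookup-⊖ a j = Vec.lookup-map j (λ z → ℤ.- z) a

  •-x : ∀ w i → w • x i ≋ x (w ⟨$⟩ʳ i)
  •-x w i = ≋-trans (•-monomial w 1ᴷ (εᴱ i)) (monomial-cong K.refl (ext go))
    where
    go : ∀ j → lookup (permuteᴱ w (εᴱ i)) j ≡ lookup (εᴱ (w ⟨$⟩ʳ i)) j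
    go j with toSum (j Fin.≟ w ⟨$⟩ʳ i)
    ... | inj₁ ≡.refl = ≡.trans (permuteᴱ-lookup w (εᴱ i) j)
          (≡.trans (≡.cong (lookup (εᴱ i)) (Perm.inverseˡ w)) (≡.trans (lookup-ε i) (≡.sym (lookup-ε j))))
    ... | inj₂ j≢    = ≡.trans (permuteᴱ-lookup w (εᴱ i) j)
          (≡.trans (lookup-ε-≢ (λ e → j≢ (≡.trans (≡.sym (Perm.inverseʳ w)) (≡.cong (w ⟨$⟩ʳ_) e)))) (≡.sym (lookup-ε-≢ j≢)))

  x-x⁻¹ : ∀ i → x i *ᴸ x⁻¹ i ≋ 1ᴸ
  x-x⁻¹ i = ≋-trans (monomial-* 1ᴷ 1ᴷ (εᴱ i) _) (monomial-cong (K.*-identityˡ 1ᴷ) (ext go))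
    where
    go : ∀ j → lookup (εᴱ i ⊕ (0ᴱ [ i ]≔ -1ℤ)) j ≡ lookup 0ᴱ j
    go j with toSum (j Fin.≟ i)
    ... | inj₁ ≡.refl = ≡.trans (lookup-⊕ (εᴱ i) _ j) (≡.trans (≡.cong₂ ℤ._+_ (lookup-ε i) (Vec.lookup∘update i 0ᴱ -1ℤ))
          (≡.sym (Vec.lookup-replicate j 0ℤ)))
    ... | inj₂ j≢i    = ≡.trans (lookup-⊕ (εᴱ i) _ j) (≡.trans (≡.cong₂ ℤ._+_ (lookup-ε-≢ j≢i)
          (≡.trans (Vec.lookup∘update′ j≢i 0ᴱ -1ℤ) (Vec.lookup-replicate j 0ℤ))) (≡.sym (Vec.lookup-replicate j 0ℤ)))

  regular-≋ : ∀ {d e} → d ≋ e → Regular d → Regular e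
  regular-≋ p rd g q = rd g (≋-trans (𝕃.*-congʳ p) q)

  cancel-regular : ∀ {d} → Regular d → ∀ {f g} → d *ᴸ f ≋ d *ᴸ g → f ≋ g
  cancel-regular {d} rd {f} {g} p = x∙y⁻¹≈ε⇒x≈y f g (rd (f -ᴸ g)
    (≋-trans (x[y-z]≈xy-xz d f g) (x≈y⇒x∙y⁻¹≈ε p)))

  -- The bound is the maximum of the p-th exponents written in the list, so no coefficient has to be
  -- tested for zero. The start value 0 is arbitrary.
  support-bound : ∀ g p → ∃ λ N → ∀ e → N ℤ.< lookup e p → coeff g e ≈ᴷ 0ᴷ
  support-bound []            p = 0ℤ , λ _ _ → K.refl
  support-bound ((k , a) ∷ g) p = lookup a p ℤ.⊔ N , bound
    where
    N = proj₁ (support-bound g p)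
    bound : ∀ e → lookup a p ℤ.⊔ N ℤ.< lookup e p → coeff ((k , a) ∷ g) e ≈ᴷ 0ᴷ
    bound e N<e with a ≟ᴱ e
    ... | yes ≡.refl = contradiction (ℤ.≤-<-trans (ℤ.i≤i⊔j (lookup a p) N) N<e) (ℤ.<-irrefl ≡.refl)
    ... | no _ = K.trans (K.+-identityˡ _)
          (proj₂ (support-bound g p) e (ℤ.≤-<-trans (ℤ.i≤j⊔i (lookup a p) N) N<e))

  -- Following e, v ⊕ e, v ⊕ v ⊕ e, … leads out of the finite support of g.
  vanish-along : ∀ g v p → lookup v p ≡ 1ℤ → ∀ {q} (Q : Exponent → Set q) → (∀ e → Q e → Q (v ⊕ e)) →
                 ∀ κ → (∀ e → Q e → coeff g e ≈ᴷ κ *ᴷ coeff g (v ⊕ e)) → ∀ e → Q e → coeff g e ≈ᴷ 0ᴷ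
  vanish-along g v p v≡1 Q Q-step κ step e Qe =
    let N , outside = support-bound g p
        k , N<e+k   = archimedean N (lookup e p)
    in walk outside k e Qe N<e+k
    where
    walk : ∀ {N} → (∀ e → N ℤ.< lookup e p → coeff g e ≈ᴷ 0ᴷ) →
           ∀ k e → Q e → N ℤ.< lookup e p ℤ.+ + k → coeff g e ≈ᴷ 0ᴷ
    walk {N} outside zero    e Qe N< = outside e (≡.subst (N ℤ.<_) (ℤ.+-identityʳ (lookup e p)) N<)
    walk {N} outside (suc k) e Qe N< = K.trans (step e Qe)
      (K.trans (K.*-congˡ (walk outside k (v ⊕ e) (Q-step e Qe) (≡.subst (N ℤ.<_)
        (≡.trans (+-suc-shift (lookup e p) k) (≡.cong (ℤ._+ + k)
          (≡.sym (≡.trans (lookup-⊕ v e p) (≡.cong (ℤ._+ lookup e p) v≡1))))) N<)))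
      (K.zeroʳ κ))

  binomial : K → Fin n → K → Fin n → Laurent
  binomial k i l j = const k *ᴸ x i -ᴸ const l *ᴸ x j

  coeff-const-x : ∀ k i f e → coeff (const k *ᴸ x i *ᴸ f) e ≈ᴷ k *ᴷ coeff f (⊖ εᴱ i ⊕ e)
  coeff-const-x k i f e = K.trans
    (at (𝕃.*-congʳ (≋-trans (monomial-* k 1ᴷ 0ᴱ (εᴱ i)) (monomial-cong (K.*-identityʳ k) (⊕-identityˡ (εᴱ i))))) e)
    (coeff-monomial-* k (εᴱ i) f e)

  coeff-binomial : ∀ k i l j f e → coeff (binomial k i l j *ᴸ f) e
                                   ≈ᴷ k *ᴷ coeff f (⊖ εᴱ i ⊕ e) K.- l *ᴷ coeff f (⊖ εᴱ j ⊕ e)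
  coeff-binomial k i l j f e = K.trans
    (at (solve 3 (λ a b f → (a :- b) :* f := a :* f :- b :* f) ≋-refl (const k *ᴸ x i) (const l *ᴸ x j) f) e)
    (K.trans (coeff-+ (const k *ᴸ x i *ᴸ f) _ e)
      (K.+-cong (coeff-const-x k i f e)
        (K.trans (coeff-neg (const l *ᴸ x j *ᴸ f) e) (K.-‿cong (coeff-const-x l j f e)))))

  private
    module KR where
      open import Algebra.Properties.Ring K.ring public using (x∙y⁻¹≈ε⇒x≈y; x≈y⇒x∙y⁻¹≈ε; -0#≈0#)

  diffᴱ : Fin n → Fin n → Exponent
  diffᴱ i j = εᴱ i ⊕ ⊖ εᴱ j

  lookup-diff-source : ∀ {i j} → i ≢ j → lookup (diffᴱ i j) i ≡ 1ℤ
  lookup-diff-source {i} {j} i≢j = ≡.trans (lookup-⊕ (εᴱ i) (⊖ εᴱ j) i)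
    (≡.cong₂ ℤ._+_ (lookup-ε i) (≡.trans (lookup-⊖ (εᴱ j) i) (≡.cong (λ z → ℤ.- z) (lookup-ε-≢ i≢j))))

  lookup-diff-target : ∀ {i j} → i ≢ j → lookup (diffᴱ i j) j ≡ -1ℤ
  lookup-diff-target {i} {j} i≢j = ≡.trans (lookup-⊕ (εᴱ i) (⊖ εᴱ j) j)
    (≡.cong₂ ℤ._+_ (lookup-ε-≢ (i≢j ∘ ≡.sym)) (≡.trans (lookup-⊖ (εᴱ j) j) (≡.cong (λ z → ℤ.- z) (lookup-ε j))))

  lookup-diff-other : ∀ {i j p} → p ≢ i → p ≢ j → lookup (diffᴱ i j) p ≡ 0ℤ
  lookup-diff-other {i} {j} {p} p≢i p≢j = ≡.trans (lookup-⊕ (εᴱ i) (⊖ εᴱ j) p)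
    (≡.cong₂ ℤ._+_ (lookup-ε-≢ p≢i) (≡.trans (lookup-⊖ (εᴱ j) p) (≡.cong (λ z → ℤ.- z) (lookup-ε-≢ p≢j))))

  -- The coefficient of the product at ε_i + e involves only the coefficients of g at e and at e +
  -- ε_i - ε_j. If it is zero, the invertible k solves for the former: this is the recursion that
  -- `vanish-along` iterates.
  binomial-step : ∀ {k k⁻¹} → k⁻¹ *ᴷ k ≈ᴷ 1ᴷ → ∀ i l j g e → coeff (binomial k i l j *ᴸ g) (εᴱ i ⊕ e) ≈ᴷ 0ᴷ →
                  coeff g e ≈ᴷ k⁻¹ *ᴷ l *ᴷ coeff g (diffᴱ i j ⊕ e)
  binomial-step {k} {k⁻¹} inv i l j g e z = K.trans (K.sym (K.trans (K.*-congʳ inv) (K.*-identityˡ _)))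
    (K.trans (K.*-assoc k⁻¹ k _) (K.trans (K.*-congˡ kg≈lg) (K.sym (K.*-assoc k⁻¹ l _))))
    where
    kg≈lg : k *ᴷ coeff g e ≈ᴷ l *ᴷ coeff g (diffᴱ i j ⊕ e)
    kg≈lg = K.trans (K.*-congˡ (K.reflexive (≡.cong (coeff g) (≡.sym (⊖⊕-cancel (εᴱ i) e)))))
      (K.trans (KR.x∙y⁻¹≈ε⇒x≈y _ _ (K.trans (K.sym (coeff-binomial k i l j g (εᴱ i ⊕ e))) z))
        (K.*-congˡ (K.reflexive (≡.cong (coeff g)
          (≡.trans (≡.sym (⊕-assoc (⊖ εᴱ j) (εᴱ i) e)) (≡.cong (_⊕ e) (⊕-comm (⊖ εᴱ j) (εᴱ i))))))))

  binomial-regular : ∀ {k k⁻¹} → k⁻¹ *ᴷ k ≈ᴷ 1ᴷ → ∀ {i j} → i ≢ j → ∀ l → Regular (binomial k i l j)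
  binomial-regular {k} {k⁻¹} inv {i} {j} i≢j l g p = mk≋ λ e →
    -- The product vanishes at every exponent, so the path needs no restriction and the predicate is
    -- a trivially true equation.
    vanish-along g (diffᴱ i j) i (lookup-diff-source i≢j) (λ _ → e ≡ e) (λ _ q → q) (k⁻¹ *ᴷ l)
      (λ e _ → binomial-step inv i l j g e (at p (εᴱ i ⊕ e))) e ≡.refl

  -- Phrased through coefficients because a list may contain x_j in terms that cancel.
  FreeOf : Fin n → Laurent → Set r
  FreeOf j f = ∀ e → lookup e j ≢ 0ℤ → coeff f e ≈ᴷ 0ᴷ

  freeOf-binomial-* : ∀ {p} k i l j {f} → i ≢ p → j ≢ p → FreeOf p f → FreeOf p (binomial k i l j *ᴸ f)
  freeOf-binomial-* {p} k i l j {f} i≢p j≢p free e e≢0 = K.trans (coeff-binomial k i l j f e)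
    (K.trans (K.+-cong (zero-term k i i≢p) (K.-‿cong (zero-term l j j≢p))) (K.-‿inverseʳ 0ᴷ))
    where
    zero-term : ∀ k i → i ≢ p → k *ᴷ coeff f (⊖ εᴱ i ⊕ e) ≈ᴷ 0ᴷ
    zero-term k i i≢p = K.trans (K.*-congˡ (free (⊖ εᴱ i ⊕ e) (λ z → e≢0 (≡.trans (≡.sym same) z)))) (K.zeroʳ k)
      where
      same : lookup (⊖ εᴱ i ⊕ e) p ≡ lookup e p
      same = ≡.trans (lookup-⊕ (⊖ εᴱ i) e p) (≡.trans (≡.cong (ℤ._+ lookup e p)
        (≡.trans (lookup-⊖ (εᴱ i) p) (≡.cong (λ z → ℤ.- z) (lookup-ε-≢ (i≢p ∘ ≡.sym))))) (ℤ.+-identityˡ _))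

  -- Divisibility and congruences

  infix 4 _∣_

  _∣_ : Laurent → Laurent → Set (c ⊔ r)
  d ∣ f = ∃ λ q → d *ᴸ q ≋ f

  ∣-≋ : ∀ {d f g} → f ≋ g → d ∣ f → d ∣ g
  ∣-≋ p (q , e) = q , ≋-trans e p

  ∣-+ : ∀ {d f g} → d ∣ f → d ∣ g → d ∣ f +ᴸ g
  ∣-+ {d} (q , e) (q′ , e′) = q +ᴸ q′ , ≋-trans (𝕃.distribˡ d q q′) (𝕃.+-cong e e′)

  ∣-neg : ∀ {d f} → d ∣ f → d ∣ -ᴸ f
  ∣-neg {d} (q , e) = -ᴸ q , ≋-trans (solve 2 (λ d q → d :* :- q := :- (d :* q)) ≋-refl d q) (𝕃.-‿cong e)

  ∣-* : ∀ {d f} g → d ∣ f → d ∣ g *ᴸ f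
  ∣-* {d} g (q , e) = g *ᴸ q , ≋-trans (solve 3 (λ d g q → d :* (g :* q) := g :* (d :* q)) ≋-refl d g q) (𝕃.*-congˡ e)

  ∣-trans-sub : ∀ {d f g h} → d ∣ f -ᴸ g → d ∣ g -ᴸ h → d ∣ f -ᴸ h
  ∣-trans-sub {d} {f} {g} {h} p q =
    ∣-≋ (solve 3 (λ f g h → (f :- g) :+ (g :- h) := f :- h) ≋-refl f g h) (∣-+ p q)

  ∣-sym-sub : ∀ {d f g} → d ∣ f -ᴸ g → d ∣ g -ᴸ f
  ∣-sym-sub {d} {f} {g} p = ∣-≋ (solve 2 (λ f g → :- (f :- g) := g :- f) ≋-refl f g) (∣-neg p)

  ∣-+-sub : ∀ {d f g f′ g′} → d ∣ f -ᴸ g → d ∣ f′ -ᴸ g′ → d ∣ (f +ᴸ f′) -ᴸ (g +ᴸ g′)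
  ∣-+-sub {d} {f} {g} {f′} {g′} p q = ∣-≋
    (solve 4 (λ f g f′ g′ → (f :- g) :+ (f′ :- g′) := (f :+ f′) :- (g :+ g′)) ≋-refl f g f′ g′) (∣-+ p q)

  -- The factor x_j - c x_i.
  root : K → Fin n → Fin n → Laurent
  root c i j = binomial 1ᴷ j c i

  -- Substituting c x_i for x_j fixes h and kills the root. In terms of coefficients: h has none
  -- where the x_j-exponent is nonzero, so those of q propagate upwards from x_j-exponents at least
  -- 0 and downwards from negative ones, in both directions out of the support. Hence q = 0.
  multiple-of-root-freeOf : ∀ {c c⁻¹} → c⁻¹ *ᴷ c ≈ᴷ 1ᴷ → ∀ {i j} → i ≢ j →
                            ∀ {h} → FreeOf j h → root c i j ∣ h → h ≋ 0ᴸ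
  multiple-of-root-freeOf {c} {c⁻¹} inv {i} {j} i≢j {h} free (q , e≋) = begin
    h                    ≈⟨ e≋ ⟨
    root c i j *ᴸ q      ≈⟨ 𝕃.*-congˡ q≋0 ⟩
    root c i j *ᴸ 0ᴸ     ≈⟨ 𝕃.zeroʳ (root c i j) ⟩
    0ᴸ                   ∎
    where
    -- For the downward direction the recursion is solved for the x_i term, which uses that c is
    -- invertible.
    swapped : binomial c i 1ᴷ j *ᴸ q ≋ -ᴸ h
    swapped = ≋-trans (solve 3 (λ a b q → (a :- b) :* q := :- ((b :- a) :* q)) ≋-refl
                (const c *ᴸ x i) (const 1ᴷ *ᴸ x j) q) (𝕃.-‿cong e≋)
    above : ∀ e → 0ℤ ℤ.≤ lookup e j → coeff q e ≈ᴷ 0ᴷ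
    above = vanish-along q (diffᴱ j i) j (lookup-diff-source (i≢j ∘ ≡.sym)) (λ e → 0ℤ ℤ.≤ lookup e j)
      (λ e 0≤ → ≡.subst (0ℤ ℤ.≤_) (≡.sym (≡.trans (lookup-⊕ (diffᴱ j i) e j)
        (≡.cong (ℤ._+ lookup e j) (lookup-diff-source (i≢j ∘ ≡.sym))))) (ℤ.<⇒≤ (ℤ.≤-<-trans 0≤ (i<1+i (lookup e j)))))
      (1ᴷ *ᴷ c)
      (λ e 0≤ → binomial-step (K.*-identityˡ 1ᴷ) j c i q e (K.trans (at e≋ (εᴱ j ⊕ e)) (free (εᴱ j ⊕ e) λ z →
        ℤ.<-irrefl (≡.sym (≡.trans (≡.sym (≡.trans (lookup-⊕ (εᴱ j) e j) (≡.cong (ℤ._+ lookup e j) (lookup-ε j)))) z))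
          (ℤ.≤-<-trans 0≤ (i<1+i (lookup e j))))))
    below : ∀ e → lookup e j ℤ.< 0ℤ → coeff q e ≈ᴷ 0ᴷ
    below = vanish-along q (diffᴱ i j) i (lookup-diff-source i≢j) (λ e → lookup e j ℤ.< 0ℤ)
      (λ e <0 → ≡.subst (ℤ._< 0ℤ) (≡.sym (≡.trans (lookup-⊕ (diffᴱ i j) e j)
        (≡.cong (ℤ._+ lookup e j) (lookup-diff-target i≢j)))) (ℤ.<-trans (-1+i<i (lookup e j)) <0))
      (c⁻¹ *ᴷ 1ᴷ)
      (λ e <0 → binomial-step inv i 1ᴷ j q e (K.trans (at swapped (εᴱ i ⊕ e)) (K.trans (coeff-neg h (εᴱ i ⊕ e))
        (K.trans (K.-‿cong (free (εᴱ i ⊕ e) λ z → ℤ.<-irrefl (≡.trans (≡.sym (≡.trans (lookup-⊕ (εᴱ i) e j)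
          (≡.trans (≡.cong (ℤ._+ lookup e j) (lookup-ε-≢ (i≢j ∘ ≡.sym))) (ℤ.+-identityˡ _)))) z) <0))
          (KR.-0#≈0#)))))
    q≋0 : q ≋ 0ᴸ
    q≋0 = mk≋ go
      where
      go : ∀ e → coeff q e ≈ᴷ 0ᴷ
      go e with lookup e j ℤ.<? 0ℤ
      ... | yes <0 = below e <0
      ... | no ≮0  = above e (ℤ.≮⇒≥ ≮0)

  open import Algebra.Properties.Semiring.Exp K.semiring using (_^_)

  translate : ℤ → Exponent → Exponent → Exponent
  translate z = zipWith λ p q → z ℤ.* p ℤ.+ q

  lookup-translate : ∀ z v a p → lookup (translate z v a) p ≡ z ℤ.* lookup v p ℤ.+ lookup a p
  lookup-translate z v a p = Vec.lookup-zipWith (λ p q → z ℤ.* p ℤ.+ q) p v a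

  open import Algebra.Properties.CommutativeSemigroup K.*-commutativeSemigroup
    using () renaming (interchange to *ᴷ-interchange)

  zpow : K → K → ℤ → K
  zpow c c⁻¹ (+ k)    = c ^ k
  zpow c c⁻¹ -[1+ k ] = c⁻¹ ^ suc k

  1^ : ∀ k → 1ᴷ ^ k ≈ᴷ 1ᴷ
  1^ zero    = K.refl
  1^ (suc k) = K.trans (K.*-identityˡ _) (1^ k)

  zpow-1 : ∀ z → zpow 1ᴷ 1ᴷ z ≈ᴷ 1ᴷ
  zpow-1 (+ k)    = 1^ k
  zpow-1 -[1+ k ] = 1^ (suc k)

  inverse-^ : ∀ {c c⁻¹} → c⁻¹ *ᴷ c ≈ᴷ 1ᴷ → ∀ k → c ^ k *ᴷ c⁻¹ ^ k ≈ᴷ 1ᴷ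
  inverse-^ inv zero = K.*-identityˡ 1ᴷ
  inverse-^ {c} {c⁻¹} inv (suc k) = K.trans
    (*ᴷ-interchange c (c ^ k) c⁻¹ (c⁻¹ ^ k))
    (K.trans (K.*-cong (K.trans (K.*-comm c c⁻¹) inv) (inverse-^ inv k)) (K.*-identityˡ 1ᴷ))

  -- Reduction modulo a root

  module _ {c c⁻¹ : K} (inv : c⁻¹ *ᴷ c ≈ᴷ 1ᴷ) {i j : Fin n} (i≢j : i ≢ j) where

    private
      v : Exponent
      v = diffᴱ i j

      P : Laurent
      P = root c i j

    -- The quotient is k x^a / x_j: one factor x_j is exchanged for c x_i.
    root-step : ∀ k a → P ∣ ((k , a) ∷ []) -ᴸ ((c *ᴷ k , v ⊕ a) ∷ [])
    root-step k a = ((k , b) ∷ []) , (begin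
      P *ᴸ ((k , b) ∷ [])
        ≈⟨ solve 3 (λ p q r → (p :- q) :* r := p :* r :- q :* r) ≋-refl (const 1ᴷ *ᴸ x j) (const c *ᴸ x i) ((k , b) ∷ []) ⟩
      const 1ᴷ *ᴸ x j *ᴸ ((k , b) ∷ []) -ᴸ const c *ᴸ x i *ᴸ ((k , b) ∷ [])
        ≈⟨ 𝕃.+-cong (≋-trans (const-x-* 1ᴷ j) (monomial-cong (K.*-identityˡ k) (⊕⊖-cancel (εᴱ j) a)))
             (𝕃.-‿cong (≋-trans (const-x-* c i) (monomial-cong K.refl (≡.sym (⊕-assoc (εᴱ i) (⊖ εᴱ j) a))))) ⟩
      ((k , a) ∷ []) -ᴸ ((c *ᴷ k , v ⊕ a) ∷ []) ∎)
      where
      b = ⊖ εᴱ j ⊕ a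
      const-x-* : ∀ l p → const l *ᴸ x p *ᴸ ((k , b) ∷ []) ≋ (l *ᴷ k , εᴱ p ⊕ b) ∷ []
      const-x-* l p = ≋-trans
        (𝕃.*-congʳ (≋-trans (monomial-* l 1ᴷ 0ᴱ (εᴱ p)) (monomial-cong (K.*-identityʳ l) (⊕-identityˡ (εᴱ p)))))
        (monomial-* l k (εᴱ p) b)

    private
      up : ∀ d k a → P ∣ ((k , a) ∷ []) -ᴸ ((c ^ d *ᴷ k , translate (+ d) v a) ∷ [])
      up zero    k a = 0ᴸ , (begin
        P *ᴸ 0ᴸ     ≈⟨ 𝕃.zeroʳ P ⟩
        0ᴸ          ≈⟨ 𝕃.-‿inverseʳ _ ⟨
        ((k , a) ∷ []) -ᴸ ((k , a) ∷ [])
          ≈⟨ 𝕃.+-congˡ (𝕃.-‿cong (monomial-cong (K.*-identityˡ k) (ext λ p → ≡.trans (lookup-translate 0ℤ v a p)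
               (≡.trans (≡.cong (ℤ._+ lookup a p) (ℤ.*-zeroˡ (lookup v p))) (ℤ.+-identityˡ _))))) ⟨
        ((k , a) ∷ []) -ᴸ ((1ᴷ *ᴷ k , translate 0ℤ v a) ∷ []) ∎)
      up (suc d) k a = ∣-trans-sub (up d k a) (∣-≋
        (𝕃.+-congˡ (𝕃.-‿cong (monomial-cong (K.sym (K.*-assoc c (c ^ d) k)) (ext λ p →
          ≡.trans (lookup-⊕ v (translate (+ d) v a) p)
          (≡.trans (≡.cong (λ z → lookup v p ℤ.+ z) (lookup-translate (+ d) v a p))
          (≡.trans (combine (+ d) (lookup v p) (lookup a p))
            (≡.sym (lookup-translate (+ suc d) v a p))))))))
        (root-step (c ^ d *ᴷ k) (translate (+ d) v a)))

    monomial-mod-root : ∀ z k a → P ∣ ((k , a) ∷ []) -ᴸ ((zpow c c⁻¹ z *ᴷ k , translate z v a) ∷ [])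
    monomial-mod-root (+ d)    k a = up d k a
    -- A negative shift is a positive shift read backwards, starting from the monomial to be
    -- reached.
    monomial-mod-root -[1+ d ] k a = ∣-sym-sub (∣-≋
      (𝕃.+-congˡ (𝕃.-‿cong (monomial-cong
        (K.trans (K.sym (K.*-assoc _ _ k)) (K.trans (K.*-congʳ (inverse-^ inv (suc d))) (K.*-identityˡ k)))
        (ext λ p → ≡.trans (lookup-translate (+ suc d) v _ p)
          (≡.trans (≡.cong (λ z → + suc d ℤ.* lookup v p ℤ.+ z) (lookup-translate -[1+ d ] v a p))
            (cancel-combine (+ suc d) (lookup v p) (lookup a p)))))))
      (up (suc d) (c⁻¹ ^ suc d *ᴷ k) (translate -[1+ d ] v a)))

    -- Division with remainder by the root. Shifting each monomial by its own x_j-exponent removes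
    -- x_j, which carries out the substitution of c x_i for x_j.
    reduce-mod-root : ∀ f → ∃ λ f₀ → FreeOf j f₀ × P ∣ f -ᴸ f₀
    reduce-mod-root []            = 0ᴸ , (λ _ _ → K.refl) , 0ᴸ , ≋-trans (𝕃.zeroʳ P) (≋-sym (𝕃.-‿inverseʳ 0ᴸ))
    reduce-mod-root ((k , a) ∷ f) = let f₀ , free , d = reduce-mod-root f in
      ((k′ , a′) ∷ []) +ᴸ f₀
      , (λ e e≢0 → K.trans (coeff-+ ((k′ , a′) ∷ []) f₀ e) (K.trans (K.+-cong (monomial-free e e≢0) (free e e≢0)) (K.+-identityˡ 0ᴷ)))
      , ∣-≋ (𝕃.+-congʳ (≋-sym (monomial-cons (k , a) f))) (∣-+-sub (monomial-mod-root (lookup a j) k a) d)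
      where
      k′ = zpow c c⁻¹ (lookup a j) *ᴷ k
      a′ = translate (lookup a j) v a
      a′-j : lookup a′ j ≡ 0ℤ
      a′-j = ≡.trans (lookup-translate (lookup a j) v a j)
        (≡.trans (≡.cong (λ z → lookup a j ℤ.* z ℤ.+ lookup a j) (lookup-diff-target i≢j)) (minus-self (lookup a j)))
      monomial-free : FreeOf j ((k′ , a′) ∷ [])
      monomial-free e e≢0 with a′ ≟ᴱ e
      ... | yes ≡.refl = contradiction a′-j e≢0
      ... | no _ = K.+-identityˡ 0ᴷ

    -- If Q₀ and f₀ are the reductions of Q and f, then P divides Q₀ f₀, which does not involve x_j
    -- and is therefore 0. The binomial Q₀ is regular, so f₀ = 0 and f is a multiple of P.
    root-cancel : ∀ {k k⁻¹} → k⁻¹ *ᴷ k ≈ᴷ 1ᴷ → ∀ {p q l} → p ≢ q → p ≢ j → q ≢ j →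
                  ∀ {Q f} → P ∣ Q -ᴸ binomial k p l q → P ∣ Q *ᴸ f → P ∣ f
    root-cancel {k} k-inv {p} {q} {l} p≢q p≢j q≢j {Q} {f} P∣Q P∣Qf =
      ∣-≋ (≋-trans (𝕃.+-congˡ (𝕃.-‿cong f₀≋0)) (solve 1 (λ f → f :- (f :- f) := f) ≋-refl f)) P∣f-f₀
      where
      Q₀ = binomial k p l q
      f₀ = proj₁ (reduce-mod-root f)
      P∣f-f₀ = proj₂ (proj₂ (reduce-mod-root f))
      P∣Q₀f₀ : P ∣ Q₀ *ᴸ f₀
      P∣Q₀f₀ = ∣-≋
        (solve 4 (λ Q Q₀ f f₀ → Q :* f :+ :- (f :* (Q :- Q₀) :+ Q₀ :* (f :- f₀)) := Q₀ :* f₀) ≋-refl Q Q₀ f f₀)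
        (∣-+ P∣Qf (∣-neg (∣-+ (∣-* f P∣Q) (∣-* Q₀ P∣f-f₀))))
      -- Zero is written as f - f so that the solver identity above needs no constant.
      f₀≋0 : f₀ ≋ f -ᴸ f
      f₀≋0 = ≋-trans (binomial-regular k-inv p≢q l f₀
        (multiple-of-root-freeOf inv i≢j (freeOf-binomial-* k p l q p≢j q≢j (proj₁ (proj₂ (reduce-mod-root f)))) P∣Q₀f₀))
        (≋-sym (𝕃.-‿inverseʳ f))

    -- Modulo x_j - c x_i the other root becomes c x_i - c x_p when q = j, becomes x_q - c² x_i when
    -- p = j, and is unchanged otherwise. The two conditions exclude the same root and the reversed
    -- root x_i - c x_j; the latter reduces to (1 - c²) x_i, which may be zero.
    coprime-roots : ∀ {p q} → p ≢ q → (q ≡ j → p ≢ i) → (p ≡ j → q ≢ i) →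
                    ∀ {f} → P ∣ root c p q *ᴸ f → P ∣ f
    coprime-roots {p} {q} p≢q distinct crossed with toSum (q Fin.≟ j)
    ... | inj₁ ≡.refl = root-cancel inv (distinct ≡.refl ∘ ≡.sym) i≢j p≢q
          (1ᴸ , ≋-trans (𝕃.*-identityʳ P) (solve 3 (λ X Y Z → X :- Y := (X :- Z) :- (Y :- Z)) ≋-refl
            (const 1ᴷ *ᴸ x j) (const c *ᴸ x i) (const c *ᴸ x p)))
    ... | inj₂ q≢j with toSum (p Fin.≟ j)
    ...   | inj₁ ≡.refl = root-cancel (K.*-identityˡ 1ᴷ) {l = c *ᴷ c} (crossed ≡.refl) q≢j i≢j
          (-ᴸ const c , (begin
            P *ᴸ (-ᴸ const c)
              ≈⟨ 𝕃.*-congʳ (𝕃.+-congʳ (𝕃.*-identityˡ (x j))) ⟩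
            (x j -ᴸ const c *ᴸ x i) *ᴸ (-ᴸ const c)
              ≈⟨ solve 4 (λ C X Z W → (X :- C :* Z) :* (:- C) := (W :- C :* X) :- (W :- C :* C :* Z)) ≋-refl
                   (const c) (x j) (x i) (const 1ᴷ *ᴸ x q) ⟩
            root c j q -ᴸ (const 1ᴷ *ᴸ x q -ᴸ const c *ᴸ const c *ᴸ x i)
              ≈⟨ 𝕃.+-congˡ (𝕃.-‿cong (𝕃.+-congˡ (𝕃.-‿cong (𝕃.*-congʳ (const-* c c))))) ⟨
            root c j q -ᴸ binomial 1ᴷ q (c *ᴷ c) i ∎))
    ...   | inj₂ p≢j = root-cancel (K.*-identityˡ 1ᴷ) (p≢q ∘ ≡.sym) q≢j p≢j
          (0ᴸ , ≋-trans (𝕃.zeroʳ P) (≋-sym (𝕃.-‿inverseʳ _)))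

  root-regular : ∀ c {i j} → i ≢ j → Regular (root c i j)
  root-regular c i≢j = binomial-regular (K.*-identityˡ 1ᴷ) (i≢j ∘ ≡.sym) c

-- Divisibility of f - s_i f

module SimpleDifference {c r : Level} (𝕂 : CommutativeRing c r) (m : ℕ) where
  open Laurent 𝕂 (suc m)
  open LaurentProperties 𝕂 (suc m)

  s-lookup : ∀ i a p → lookup (permuteᴱ (s i) a) p ≡ lookup a (s i ⟨$⟩ʳ p)
  s-lookup i a p = ≡.trans (permuteᴱ-lookup (s i) a p) (≡.cong (lookup a) s⁻¹≡s)
    where
    s-s : ∀ p → s i ⟨$⟩ʳ (s i ⟨$⟩ʳ p) ≡ p
    s-s p with toSum (p Fin.≟ inject₁ i)
    ... | inj₁ ≡.refl = ≡.trans (≡.cong (s i ⟨$⟩ʳ_) (s-inject₁ i)) (s-suc i)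
    ... | inj₂ p≢ with toSum (p Fin.≟ suc i)
    ...   | inj₁ ≡.refl = ≡.trans (≡.cong (s i ⟨$⟩ʳ_) (s-suc i)) (s-inject₁ i)
    ...   | inj₂ p≢′    = ≡.trans (≡.cong (s i ⟨$⟩ʳ_) (s-≢ i p≢ p≢′)) (s-≢ i p≢ p≢′)
    s⁻¹≡s : s i ⟨$⟩ˡ p ≡ s i ⟨$⟩ʳ p
    s⁻¹≡s = ≡.trans (≡.cong (s i ⟨$⟩ˡ_) (≡.sym (s-s p))) (Perm.inverseˡ (s i))

  s-permute : ∀ i a → translate (lookup a (suc i) ℤ.- lookup a (inject₁ i)) (diffᴱ (inject₁ i) (suc i)) a ≡ permuteᴱ (s i) a
  s-permute i a = ext λ p → ≡.trans (lookup-translate z (diffᴱ (inject₁ i) (suc i)) a p) (≡.trans (go p) (≡.sym (s-lookup i a p)))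
    where
    z = lookup a (suc i) ℤ.- lookup a (inject₁ i)
    go : ∀ p → z ℤ.* lookup (diffᴱ (inject₁ i) (suc i)) p ℤ.+ lookup a p ≡ lookup a (s i ⟨$⟩ʳ p)
    go p with toSum (p Fin.≟ inject₁ i)
    ... | inj₁ ≡.refl = ≡.trans (≡.cong (λ w → z ℤ.* w ℤ.+ lookup a p) (lookup-diff-source (inject₁≢suc i)))
          (≡.trans (at-source (lookup a p) (lookup a (suc i))) (≡.cong (lookup a) (≡.sym (s-inject₁ i))))
    ... | inj₂ p≢ with toSum (p Fin.≟ suc i)
    ...   | inj₁ ≡.refl = ≡.trans (≡.cong (λ w → z ℤ.* w ℤ.+ lookup a p) (lookup-diff-target (inject₁≢suc i)))
          (≡.trans (at-target (lookup a (inject₁ i)) (lookup a p)) (≡.cong (lookup a) (≡.sym (s-suc i))))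
    ...   | inj₂ p≢′ = ≡.trans (≡.cong (λ w → z ℤ.* w ℤ.+ lookup a p) (lookup-diff-other p≢ p≢′))
          (≡.trans (≡.cong (ℤ._+ lookup a p) (ℤ.*-zeroʳ z)) (≡.trans (ℤ.+-identityˡ _)
            (≡.cong (lookup a) (≡.sym (s-≢ i p≢ p≢′)))))

  -- s_i shifts the exponent of each monomial by a multiple of ε_i - ε_{i+1}, and modulo the root
  -- with c = 1 such a shift changes nothing.
  s-difference : ∀ i f → root K.1# (inject₁ i) (suc i) ∣ f -ᴸ s i • f
  s-difference i []            = 0ᴸ , ≋-trans (𝕃.zeroʳ _)
    (≋-sym (≋-trans (𝕃.+-congˡ (𝕃.-‿cong (•-zero (s i)))) (𝕃.-‿inverseʳ 0ᴸ)))
  s-difference i ((k , a) ∷ f) = ∣-≋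
    (𝕃.+-cong (≋-sym (monomial-cons (k , a) f)) (𝕃.-‿cong (≋-sym
      (≋-trans (•-cong (s i) (monomial-cons (k , a) f)) (≋-trans (•-+ (s i) _ f) (𝕃.+-congʳ (•-monomial (s i) k a)))))))
    (∣-+-sub (∣-≋ (𝕃.+-congˡ (𝕃.-‿cong (monomial-cong (K.trans (K.*-congʳ (zpow-1 z)) (K.*-identityˡ k)) (s-permute i a))))
        (monomial-mod-root (K.*-identityˡ K.1#) (inject₁≢suc i) z k a))
      (s-difference i f))
    where z = lookup a (suc i) ℤ.- lookup a (inject₁ i)

-- The Hecke relations for the operators T_i

module HeckeRelations {c r : Level} (𝕂 : CommutativeRing c r) (m : ℕ)
  (t½ : CommutativeRing.Carrier 𝕂)
  (t½-invertible : Invertible (CommutativeRing._≈_ 𝕂) (CommutativeRing.1# 𝕂) (CommutativeRing._*_ 𝕂) t½) where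

  open Hecke 𝕂 m hiding (module K)
  open LaurentProperties 𝕂 (suc m)
  open IntegerCoefficients Laurent-commutativeRing
  open BraidAlgebra Laurent-commutativeRing
  open import Relation.Binary.Reasoning.Setoid ≋-setoid

  t⁻½ : K.Carrier
  t⁻½ = proj₁ t½-invertible

  A B : Laurent
  A = const t½
  B = const t⁻½

  A*B : A *ᴸ B ≋ 1ᴸ
  A*B = ≋-trans (≋-sym (const-* t½ t⁻½)) (const-cong (proj₂ (proj₂ t½-invertible)))

  Tᵢ : Fin m → Laurent → Laurent
  Tᵢ = T t½ t½-invertible

  -- Indices a, b are arbitrary because the relations also need the images of the expansion of T_i f
  -- under permutations w, which live at the pair w(a), w(b).
  record Expansion (a b : Fin (suc m)) (g f f′ : Laurent) : Set r where
    constructor mkExpansion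
    field
      expansion : (x a -ᴸ x b) *ᴸ g ≋ (B -ᴸ A) *ᴸ x b *ᴸ f +ᴸ (A *ᴸ x a -ᴸ B *ᴸ x b) *ᴸ f′

  open Expansion

  •-sub : ∀ w f g → w • (f -ᴸ g) ≋ w • f -ᴸ w • g
  •-sub w f g = ≋-trans (•-+ w f (-ᴸ g)) (𝕃.+-congˡ (•-neg w g))

  •-const-* : ∀ w k f → w • (const k *ᴸ f) ≋ const k *ᴸ w • f
  •-const-* w k f = ≋-trans (•-* w (const k) f) (𝕃.*-congʳ (•-const w k))

  •-Expansion : ∀ w {a b a′ b′ g f f′} → w ⟨$⟩ʳ a ≡ a′ → w ⟨$⟩ʳ b ≡ b′ →
                Expansion a b g f f′ → Expansion a′ b′ (w • g) (w • f) (w • f′)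
  •-Expansion w {a} {b} {g = g} {f} {f′} ≡.refl ≡.refl (mkExpansion e) = mkExpansion (begin
    (x (w ⟨$⟩ʳ a) -ᴸ x (w ⟨$⟩ʳ b)) *ᴸ w • g
      ≈⟨ 𝕃.*-congʳ (≋-trans (•-sub w (x a) (x b)) (𝕃.+-cong (•-x w a) (𝕃.-‿cong (•-x w b)))) ⟨
    w • (x a -ᴸ x b) *ᴸ w • g
      ≈⟨ •-* w (x a -ᴸ x b) g ⟨
    w • ((x a -ᴸ x b) *ᴸ g)
      ≈⟨ •-cong w e ⟩
    w • ((B -ᴸ A) *ᴸ x b *ᴸ f +ᴸ (A *ᴸ x a -ᴸ B *ᴸ x b) *ᴸ f′)
      ≈⟨ ≋-trans (•-+ w _ _) (𝕃.+-cong
           (≋-trans (•-* w _ f) (𝕃.*-congʳ (≋-trans (•-* w (B -ᴸ A) (x b)) (𝕃.*-cong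
             (≋-trans (•-sub w B A) (𝕃.+-cong (•-const w t⁻½) (𝕃.-‿cong (•-const w t½)))) (•-x w b)))))
           (≋-trans (•-* w _ f′) (𝕃.*-congʳ (≋-trans (•-sub w (A *ᴸ x a) (B *ᴸ x b)) (𝕃.+-cong
             (≋-trans (•-const-* w t½ (x a)) (𝕃.*-congˡ (•-x w a)))
             (𝕃.-‿cong (≋-trans (•-const-* w t⁻½ (x b)) (𝕃.*-congˡ (•-x w b))))))))) ⟩
    (B -ᴸ A) *ᴸ x (w ⟨$⟩ʳ b) *ᴸ w • f +ᴸ (A *ᴸ x (w ⟨$⟩ʳ a) -ᴸ B *ᴸ x (w ⟨$⟩ʳ b)) *ᴸ w • f′ ∎)

  Expansion-≡ : ∀ {a b a′ b′ g f f′} → a ≡ a′ → b ≡ b′ → Expansion a b g f f′ → Expansion a′ b′ g f f′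
  Expansion-≡ ≡.refl ≡.refl e = e

  difference-regular : ∀ {a b} → a ≢ b → Regular (x a -ᴸ x b)
  difference-regular {a} {b} a≢b = regular-≋ (𝕃.+-cong (𝕃.*-identityˡ (x a)) (𝕃.-‿cong (𝕃.*-identityˡ (x b))))
    (root-regular K.1# (a≢b ∘ ≡.sym))

  private
    -- The hypothesis spec has the shape of T-exists, with E = 1 - y_i; multiplying by x_i x_{i+1} makes it polynomial.
    clear-denominators : ∀ {x₁ x₂ g E E′ F F′ f S α β} →
      g *ᴸ (1ᴸ *ᴸ (E *ᴸ E′)) ≋ (-ᴸ (β *ᴸ f) *ᴸ (E *ᴸ E′) +ᴸ (F *ᴸ E′ +ᴸ F′ *ᴸ E) *ᴸ 1ᴸ) *ᴸ 1ᴸ →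
      x₁ *ᴸ E ≋ x₁ -ᴸ x₂ → x₂ *ᴸ E′ ≋ x₂ -ᴸ x₁ →
      x₁ *ᴸ F ≋ (β *ᴸ x₁ -ᴸ α *ᴸ x₂) *ᴸ f → x₂ *ᴸ F′ ≋ (β *ᴸ x₂ -ᴸ α *ᴸ x₁) *ᴸ S →
      (x₂ -ᴸ x₁) *ᴸ ((x₁ -ᴸ x₂) *ᴸ g) ≋
      (x₂ -ᴸ x₁) *ᴸ ((β -ᴸ α) *ᴸ x₂ *ᴸ f +ᴸ (α *ᴸ x₁ -ᴸ β *ᴸ x₂) *ᴸ S)
    clear-denominators {x₁} {x₂} {g} {E} {E′} {F} {F′} {f} {S} {α} {β} spec E≈ E′≈ F≈ F′≈ = begin
      (x₂ -ᴸ x₁) *ᴸ ((x₁ -ᴸ x₂) *ᴸ g)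
        ≈⟨ 𝕃.*-cong E′≈ (𝕃.*-congʳ E≈) ⟨
      (x₂ *ᴸ E′) *ᴸ ((x₁ *ᴸ E) *ᴸ g)
        ≈⟨ solve 5 (λ x₁ x₂ g E E′ → (x₂ :* E′) :* ((x₁ :* E) :* g) := x₁ :* x₂ :* (g :* (E :* E′))) ≋-refl x₁ x₂ g E E′ ⟩
      x₁ *ᴸ x₂ *ᴸ (g *ᴸ (E *ᴸ E′))
        ≈⟨ 𝕃.*-congˡ (≋-trans (𝕃.*-congˡ (≋-sym (𝕃.*-identityˡ _))) (≋-trans spec
             (≋-trans (𝕃.*-identityʳ _) (𝕃.+-congˡ (𝕃.*-identityʳ _))))) ⟩
      x₁ *ᴸ x₂ *ᴸ (-ᴸ (β *ᴸ f) *ᴸ (E *ᴸ E′) +ᴸ (F *ᴸ E′ +ᴸ F′ *ᴸ E))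
        ≈⟨ solve 8 (λ x₁ x₂ E E′ F F′ β f → x₁ :* x₂ :* (:- (β :* f) :* (E :* E′) :+ (F :* E′ :+ F′ :* E))
             := :- (β :* f) :* ((x₁ :* E) :* (x₂ :* E′)) :+ ((x₁ :* F) :* (x₂ :* E′) :+ (x₂ :* F′) :* (x₁ :* E)))
             ≋-refl x₁ x₂ E E′ F F′ β f ⟩
      -ᴸ (β *ᴸ f) *ᴸ ((x₁ *ᴸ E) *ᴸ (x₂ *ᴸ E′)) +ᴸ ((x₁ *ᴸ F) *ᴸ (x₂ *ᴸ E′) +ᴸ (x₂ *ᴸ F′) *ᴸ (x₁ *ᴸ E))
        ≈⟨ 𝕃.+-cong (𝕃.*-congˡ (𝕃.*-cong E≈ E′≈)) (𝕃.+-cong (𝕃.*-cong F≈ E′≈) (𝕃.*-cong F′≈ E≈)) ⟩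
      -ᴸ (β *ᴸ f) *ᴸ ((x₁ -ᴸ x₂) *ᴸ (x₂ -ᴸ x₁))
        +ᴸ ((β *ᴸ x₁ -ᴸ α *ᴸ x₂) *ᴸ f *ᴸ (x₂ -ᴸ x₁) +ᴸ (β *ᴸ x₂ -ᴸ α *ᴸ x₁) *ᴸ S *ᴸ (x₁ -ᴸ x₂))
        ≈⟨ solve 6 (λ x₁ x₂ α β f S →
             :- (β :* f) :* ((x₁ :- x₂) :* (x₂ :- x₁))
               :+ ((β :* x₁ :- α :* x₂) :* f :* (x₂ :- x₁) :+ (β :* x₂ :- α :* x₁) :* S :* (x₁ :- x₂))
             := (x₂ :- x₁) :* ((β :- α) :* x₂ :* f :+ (α :* x₁ :- β :* x₂) :* S)) ≋-refl x₁ x₂ α β f S ⟩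
      (x₂ -ᴸ x₁) *ᴸ ((β -ᴸ α) *ᴸ x₂ *ᴸ f +ᴸ (α *ᴸ x₁ -ᴸ β *ᴸ x₂) *ᴸ S) ∎

  -- The defining fraction has the denominators 1 - y_i and s_i(1 - y_i). Multiplied by x_i and
  -- x_{i+1} they become x_i - x_{i+1} and its negative; the second is regular and is cancelled.
  T-expansion : ∀ i f → Expansion (inject₁ i) (suc i) (Tᵢ i f) f (s i • f)
  T-expansion i f = mkExpansion (cancel-regular (difference-regular (inject₁≢suc i ∘ ≡.sym))
    (clear-denominators (proj₂ (T-exists t½ t½-invertible i f)) E≈ E′≈ F≈ F′≈))
    where
    x₁ = x (inject₁ i)
    x₂ = x (suc i)
    v  = x⁻¹ (inject₁ i)
    E  = 1-y i *ᴸ 1ᴸ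
    F  = (B -ᴸ A *ᴸ y i) *ᴸ f

    x₁y : x₁ *ᴸ y i ≋ x₂
    x₁y = ≋-trans (≋-sym (𝕃.*-assoc x₁ v x₂)) (≋-trans (𝕃.*-congʳ (x-x⁻¹ (inject₁ i))) (𝕃.*-identityˡ x₂))

    E≈ : x₁ *ᴸ E ≋ x₁ -ᴸ x₂
    E≈ = begin
      x₁ *ᴸ (1-y i *ᴸ 1ᴸ)          ≈⟨ 𝕃.*-congˡ (𝕃.*-identityʳ (1-y i)) ⟩
      x₁ *ᴸ (1ᴸ -ᴸ y i)            ≈⟨ solve 3 (λ x o y → x :* (o :- y) := x :* o :- x :* y) ≋-refl x₁ 1ᴸ (y i) ⟩
      x₁ *ᴸ 1ᴸ -ᴸ x₁ *ᴸ y i        ≈⟨ 𝕃.+-cong (𝕃.*-identityʳ x₁) (𝕃.-‿cong x₁y) ⟩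
      x₁ -ᴸ x₂                     ∎

    F≈ : x₁ *ᴸ F ≋ (B *ᴸ x₁ -ᴸ A *ᴸ x₂) *ᴸ f
    F≈ = begin
      x₁ *ᴸ ((B -ᴸ A *ᴸ y i) *ᴸ f)
        ≈⟨ solve 5 (λ x a b y f → x :* ((b :- a :* y) :* f) := (b :* x :- a :* (x :* y)) :* f) ≋-refl x₁ A B (y i) f ⟩
      (B *ᴸ x₁ -ᴸ A *ᴸ (x₁ *ᴸ y i)) *ᴸ f
        ≈⟨ 𝕃.*-congʳ (𝕃.+-congˡ (𝕃.-‿cong (𝕃.*-congˡ x₁y))) ⟩
      (B *ᴸ x₁ -ᴸ A *ᴸ x₂) *ᴸ f ∎

    s-x₁ : s i • x₁ ≋ x₂
    s-x₁ = ≋-trans (•-x (s i) (inject₁ i)) (≋-reflexive (≡.cong x (s-inject₁ i)))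

    s-x₂ : s i • x₂ ≋ x₁
    s-x₂ = ≋-trans (•-x (s i) (suc i)) (≋-reflexive (≡.cong x (s-suc i)))

    E′≈ : x₂ *ᴸ s i • E ≋ x₂ -ᴸ x₁
    E′≈ = begin
      x₂ *ᴸ s i • E          ≈⟨ 𝕃.*-congʳ s-x₁ ⟨
      s i • x₁ *ᴸ s i • E    ≈⟨ •-* (s i) x₁ E ⟨
      s i • (x₁ *ᴸ E)        ≈⟨ •-cong (s i) E≈ ⟩
      s i • (x₁ -ᴸ x₂)       ≈⟨ ≋-trans (•-sub (s i) x₁ x₂) (𝕃.+-cong s-x₁ (𝕃.-‿cong s-x₂)) ⟩
      x₂ -ᴸ x₁               ∎

    F′≈ : x₂ *ᴸ s i • F ≋ (B *ᴸ x₂ -ᴸ A *ᴸ x₁) *ᴸ s i • f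
    F′≈ = begin
      x₂ *ᴸ s i • F          ≈⟨ 𝕃.*-congʳ s-x₁ ⟨
      s i • x₁ *ᴸ s i • F    ≈⟨ •-* (s i) x₁ F ⟨
      s i • (x₁ *ᴸ F)        ≈⟨ •-cong (s i) F≈ ⟩
      s i • ((B *ᴸ x₁ -ᴸ A *ᴸ x₂) *ᴸ f)
        ≈⟨ ≋-trans (•-* (s i) _ f) (𝕃.*-congʳ (≋-trans (•-sub (s i) (B *ᴸ x₁) (A *ᴸ x₂)) (𝕃.+-cong
             (≋-trans (•-const-* (s i) t⁻½ x₁) (𝕃.*-congˡ s-x₁))
             (𝕃.-‿cong (≋-trans (•-const-* (s i) t½ x₂) (𝕃.*-congˡ s-x₂)))))) ⟩
      (B *ᴸ x₂ -ᴸ A *ᴸ x₁) *ᴸ s i • f ∎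

  -- Applying s_i reverses the denominator. The sign is moved to the right so that T_i f and s_i T_i
  -- f stand over the same factor and can be substituted together.
  sT-expansion : ∀ i f → (x (inject₁ i) -ᴸ x (suc i)) *ᴸ s i • Tᵢ i f ≋
    -ᴸ ((B -ᴸ A) *ᴸ x (inject₁ i)) *ᴸ s i • f +ᴸ -ᴸ (A *ᴸ x (suc i) -ᴸ B *ᴸ x (inject₁ i)) *ᴸ f
  sT-expansion i f = begin
    (x₁ -ᴸ x₂) *ᴸ g
      ≈⟨ solve 3 (λ x₁ x₂ g → (x₁ :- x₂) :* g := :- ((x₂ :- x₁) :* g)) ≋-refl x₁ x₂ g ⟩
    -ᴸ ((x₂ -ᴸ x₁) *ᴸ g)
      ≈⟨ 𝕃.-‿cong (≋-trans (expansion (•-Expansion (s i) (s-inject₁ i) (s-suc i) (T-expansion i f)))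
           (𝕃.+-congˡ (𝕃.*-congˡ (s-involutive i f)))) ⟩
    -ᴸ ((B -ᴸ A) *ᴸ x₁ *ᴸ s i • f +ᴸ (A *ᴸ x₂ -ᴸ B *ᴸ x₁) *ᴸ f)
      ≈⟨ solve 4 (λ p q f f′ → :- (p :* f′ :+ q :* f) := :- p :* f′ :+ :- q :* f) ≋-refl
           ((B -ᴸ A) *ᴸ x₁) (A *ᴸ x₂ -ᴸ B *ᴸ x₁) f (s i • f) ⟩
    -ᴸ ((B -ᴸ A) *ᴸ x₁) *ᴸ s i • f +ᴸ -ᴸ (A *ᴸ x₂ -ᴸ B *ᴸ x₁) *ᴸ f ∎
    where
    x₁ = x (inject₁ i)
    x₂ = x (suc i)
    g  = s i • Tᵢ i f

  T-quadratic : ∀ i f → Tᵢ i (Tᵢ i f) ≋ (A -ᴸ B) *ᴸ Tᵢ i f +ᴸ f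
  T-quadratic i f = cancel-regular (regular-* d-regular d-regular) (begin
    d *ᴸ d *ᴸ Tᵢ i W
      ≈⟨ ≋-trans (𝕃.*-assoc d d _) (𝕃.*-congˡ (expansion (T-expansion i W))) ⟩
    d *ᴸ (a *ᴸ W +ᴸ p *ᴸ s i • W)
      ≈⟨ solve 5 (λ d a p W W′ → d :* (a :* W :+ p :* W′) := a :* (d :* W) :+ p :* (d :* W′)) ≋-refl d a p W (s i • W) ⟩
    a *ᴸ (d *ᴸ W) +ᴸ p *ᴸ (d *ᴸ s i • W)
      ≈⟨ 𝕃.+-cong (𝕃.*-congˡ (expansion (T-expansion i f))) (𝕃.*-congˡ (sT-expansion i f)) ⟩
    a *ᴸ (a *ᴸ f +ᴸ p *ᴸ f′) +ᴸ p *ᴸ (-ᴸ ((B -ᴸ A) *ᴸ x₁) *ᴸ f′ +ᴸ -ᴸ (A *ᴸ x₂ -ᴸ B *ᴸ x₁) *ᴸ f)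
      -- Once (A - B) times the expansion of d T_i f is split off, the terms left over combine to A
      -- B d² f, and A B = 1.
      ≈⟨ solve 6 (λ x₁ x₂ A B f f′ → let d = x₁ :- x₂ ; a = (B :- A) :* x₂ ; p = A :* x₁ :- B :* x₂ in
           a :* (a :* f :+ p :* f′) :+ p :* (:- ((B :- A) :* x₁) :* f′ :+ :- (A :* x₂ :- B :* x₁) :* f)
           := d :* ((A :- B) :* (a :* f :+ p :* f′)) :+ A :* B :* (d :* d :* f)) ≋-refl x₁ x₂ A B f f′ ⟩
    d *ᴸ ((A -ᴸ B) *ᴸ (a *ᴸ f +ᴸ p *ᴸ f′)) +ᴸ A *ᴸ B *ᴸ (d *ᴸ d *ᴸ f)
      ≈⟨ 𝕃.+-cong (𝕃.*-congˡ (𝕃.*-congˡ (≋-sym (expansion (T-expansion i f)))))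
           (≋-trans (𝕃.*-congʳ A*B) (𝕃.*-identityˡ _)) ⟩
    d *ᴸ ((A -ᴸ B) *ᴸ (d *ᴸ W)) +ᴸ d *ᴸ d *ᴸ f
      ≈⟨ solve 4 (λ d c W f → d :* (c :* (d :* W)) :+ d :* d :* f := d :* d :* (c :* W :+ f)) ≋-refl d (A -ᴸ B) W f ⟩
    d *ᴸ d *ᴸ ((A -ᴸ B) *ᴸ W +ᴸ f) ∎)
    where
    x₁ = x (inject₁ i)
    x₂ = x (suc i)
    d  = x₁ -ᴸ x₂
    a  = (B -ᴸ A) *ᴸ x₂
    p  = A *ᴸ x₁ -ᴸ B *ᴸ x₂
    f′ = s i • f
    W  = Tᵢ i f
    d-regular : Regular d
    d-regular = difference-regular (inject₁≢suc i)

  -- s_i fixes both variables in the coefficients of T_j, and conversely; the two double expansions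
  -- then agree term by term because s_i and s_j commute.
  T-commute : ∀ i j → suc (toℕ i) ℕ.< toℕ j → ∀ f → Tᵢ i (Tᵢ j f) ≋ Tᵢ j (Tᵢ i f)
  T-commute i j i≪j f = cancel-regular
    (regular-* (difference-regular (inject₁≢suc i)) (difference-regular (inject₁≢suc j)))
    (≋-trans (expand₂ (T-expansion i Z) (T-expansion j f)
        (•-Expansion (s i) (s-far-right i≪j) (s-fix-right (ℕ.<⇒≤ i≪j)) (T-expansion j f)))
      (≋-trans (≋-trans (𝕃.+-congˡ (𝕃.*-congˡ (𝕃.+-congˡ (𝕃.*-congˡ F₁₂≋))))
        (solve 8 (λ a₁ p₁ a₂ p₂ F F₁ F₂ F₁₂ → a₁ :* (a₂ :* F :+ p₂ :* F₂) :+ p₁ :* (a₂ :* F₁ :+ p₂ :* F₁₂)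
           := a₂ :* (a₁ :* F :+ p₁ :* F₁) :+ p₂ :* (a₁ :* F₂ :+ p₁ :* F₁₂)) ≋-refl
           ((B -ᴸ A) *ᴸ x (suc i)) (A *ᴸ x (inject₁ i) -ᴸ B *ᴸ x (suc i))
           ((B -ᴸ A) *ᴸ x (suc j)) (A *ᴸ x (inject₁ j) -ᴸ B *ᴸ x (suc j))
           f (s i • f) (s j • f) (s j • s i • f)))
      (≋-trans (≋-sym (expand₂ (T-expansion j W) (T-expansion i f)
        (•-Expansion (s j) (s-fix-left (ℕ.<⇒≤ i≪j)) (s-far-left i≪j) (T-expansion i f))))
        (𝕃.*-congʳ (𝕃.*-comm _ _)))))
    where
    Z = Tᵢ j f
    W = Tᵢ i f
    F₁₂≋ : s i • s j • f ≋ s j • s i • f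
    F₁₂≋ = ≋-trans (•-∘ (s j) (s i) f) (≋-trans (•-≈ (s-commute i j i≪j) f) (≋-sym (•-∘ (s i) (s j) f)))
    expand₂ : ∀ {a b a′ b′ V Z Z₁ F F₁ F₂ F₁₂} → Expansion a b V Z Z₁ → Expansion a′ b′ Z F F₂ → Expansion a′ b′ Z₁ F₁ F₁₂ →
      (x a -ᴸ x b) *ᴸ (x a′ -ᴸ x b′) *ᴸ V ≋
      (B -ᴸ A) *ᴸ x b *ᴸ ((B -ᴸ A) *ᴸ x b′ *ᴸ F +ᴸ (A *ᴸ x a′ -ᴸ B *ᴸ x b′) *ᴸ F₂)
      +ᴸ (A *ᴸ x a -ᴸ B *ᴸ x b) *ᴸ ((B -ᴸ A) *ᴸ x b′ *ᴸ F₁ +ᴸ (A *ᴸ x a′ -ᴸ B *ᴸ x b′) *ᴸ F₁₂)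
    expand₂ {a} {b} {a′} {b′} {V} {Z} {Z₁} (mkExpansion V≈) (mkExpansion Z≈) (mkExpansion Z₁≈) = ≋-trans
      (solve 3 (λ d d′ V → d :* d′ :* V := d′ :* (d :* V)) ≋-refl (x a -ᴸ x b) (x a′ -ᴸ x b′) V)
      (≋-trans (𝕃.*-congˡ V≈)
      (≋-trans (solve 5 (λ d a p Z Z₁ → d :* (a :* Z :+ p :* Z₁) := a :* (d :* Z) :+ p :* (d :* Z₁)) ≋-refl
        (x a′ -ᴸ x b′) ((B -ᴸ A) *ᴸ x b) (A *ᴸ x a -ᴸ B *ᴸ x b) Z Z₁)
      (𝕃.+-cong (𝕃.*-congˡ Z≈) (𝕃.*-congˡ Z₁≈))))

  -- Up to sign, s_i and s_j permute the three differences of the variables at a, b, d, so d₁² d₂²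
  -- d₃ clears all denominators. What remains is `compare` together with the braid relation of the
  -- transpositions.
  T-braid : ∀ i j → toℕ j ≡ suc (toℕ i) → ∀ f → Tᵢ i (Tᵢ j (Tᵢ i f)) ≋ Tᵢ j (Tᵢ i (Tᵢ j f))
  T-braid i j p f = cancel-regular
    (regular-* (difference-regular b≢d) (regular-* (regular-* (regular-* (difference-regular a≢b) (difference-regular a≢b))
      (difference-regular b≢d)) (difference-regular a≢d)))
    (begin
    d₂ *ᴸ (d₁ *ᴸ d₁ *ᴸ d₂ *ᴸ d₃) *ᴸ Tᵢ i (Tᵢ j (Tᵢ i f))
      ≈⟨ 𝕃.*-assoc d₂ _ _ ⟩
    d₂ *ᴸ (d₁ *ᴸ d₁ *ᴸ d₂ *ᴸ d₃ *ᴸ Tᵢ i (Tᵢ j (Tᵢ i f)))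
      ≈⟨ 𝕃.*-congˡ (expand
           (expansion (T-expansion i (Tᵢ j (Tᵢ i f))))
           (expansion (Tⱼ (Tᵢ i f)))
           (expansion (•-Expansion (s i) (s-suc i) i-fix-d (Tⱼ (Tᵢ i f))))
           (expansion (T-expansion i f))
           (expansion (•-Expansion (s j) j-fix-a j-b (T-expansion i f)))
           (sT-expansion i f)
           (expansion (•-Expansion (s i) (s-inject₁ i) i-fix-d (•-Expansion (s j) j-fix-a j-b (T-expansion i f))))) ⟩
    _
      ≈⟨ compare (x a) (x b) (x d) A B f (s i • f) (s j • f) (s i • s j • f) (s j • s i • f) (s i • s j • s i • f) ⟩
    _
      ≈⟨ 𝕃.*-congˡ (𝕃.+-congˡ (𝕃.+-congˡ (𝕃.*-congˡ (𝕃.+-congˡ (𝕃.*-congˡ F₁₂₁≋))))) ⟩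
    _
      ≈⟨ 𝕃.*-congˡ (expand
           (expansion (Tⱼ (Tᵢ i (Tᵢ j f))))
           (expansion (T-expansion i (Tᵢ j f)))
           (expansion (•-Expansion (s j) j-fix-a j-b (T-expansion i (Tᵢ j f))))
           (expansion (Tⱼ f))
           (expansion (•-Expansion (s i) (s-suc i) i-fix-d (Tⱼ f)))
           sTⱼ
           (expansion (•-Expansion (s j) j-fix-a (s-suc⁺ b≡) (•-Expansion (s i) (s-suc i) i-fix-d (Tⱼ f))))) ⟨
    d₁ *ᴸ (d₂ *ᴸ d₂ *ᴸ d₁ *ᴸ d₃ *ᴸ Tᵢ j (Tᵢ i (Tᵢ j f)))
      ≈⟨ solve 4 (λ d₁ d₂ d₃ V → d₁ :* (d₂ :* d₂ :* d₁ :* d₃ :* V) := d₂ :* (d₁ :* d₁ :* d₂ :* d₃) :* V) ≋-refl d₁ d₂ d₃ _ ⟩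
    d₂ *ᴸ (d₁ *ᴸ d₁ *ᴸ d₂ *ᴸ d₃) *ᴸ Tᵢ j (Tᵢ i (Tᵢ j f)) ∎)
    where
    a = inject₁ i
    b = suc i
    d = suc j
    d₁ = x a -ᴸ x b
    d₂ = x b -ᴸ x d
    d₃ = x a -ᴸ x d
    b≡ : inject₁ j ≡ b
    b≡ = adjacent i j p
    i<j : toℕ i ℕ.< toℕ j
    i<j = ℕ.≤-reflexive (≡.sym p)
    a≢b : a ≢ b
    a≢b = inject₁≢suc i
    b≢d : b ≢ d
    b≢d e = inject₁≢suc j (≡.trans b≡ e)
    a≢d : a ≢ d
    a≢d = inject₁-< i<j
    i-fix-d : s i ⟨$⟩ʳ d ≡ d
    i-fix-d = s-fix-right i<j
    j-fix-a : s j ⟨$⟩ʳ a ≡ a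
    j-fix-a = s-fix-left i<j
    j-b : s j ⟨$⟩ʳ b ≡ d
    j-b = s-inject₁⁺ b≡
    Tⱼ : ∀ g → Expansion b d (Tᵢ j g) g (s j • g)
    Tⱼ g = Expansion-≡ b≡ ≡.refl (T-expansion j g)
    sTⱼ : d₂ *ᴸ s j • Tᵢ j f ≋ -ᴸ ((B -ᴸ A) *ᴸ x b) *ᴸ s j • f +ᴸ -ᴸ (A *ᴸ x d -ᴸ B *ᴸ x b) *ᴸ f
    sTⱼ = ≡.subst (λ b → (x b -ᴸ x d) *ᴸ s j • Tᵢ j f ≋ -ᴸ ((B -ᴸ A) *ᴸ x b) *ᴸ s j • f +ᴸ -ᴸ (A *ᴸ x d -ᴸ B *ᴸ x b) *ᴸ f)
      b≡ (sT-expansion j f)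
    F₁₂₁≋ : s i • s j • s i • f ≋ s j • s i • s j • f
    F₁₂₁≋ = ≋-trans (flatten i j) (≋-trans (•-≈ (s-braid i j p) f) (≋-sym (flatten j i)))
      where
      flatten : ∀ i j → s i • s j • s i • f ≋ (s i ∘ₚ s j ∘ₚ s i) • f
      flatten i j = ≋-trans (•-∘ (s j) (s i) (s i • f)) (•-∘ (s i) (s j ∘ₚ s i) f)

-- Images of the symmetrizers

module Symmetrizers {c r : Level} (𝕂 : CommutativeRing c r) (m : ℕ)
  (t½ : CommutativeRing.Carrier 𝕂)
  (t½-invertible : Invertible (CommutativeRing._≈_ 𝕂) (CommutativeRing.1# 𝕂) (CommutativeRing._*_ 𝕂) t½)
  (k : CommutativeRing.Carrier 𝕂)
  (k-invertible : Invertible (CommutativeRing._≈_ 𝕂) (CommutativeRing.1# 𝕂) (CommutativeRing._*_ 𝕂) k)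
  where

  open Hecke 𝕂 m hiding (module K)
  open LaurentProperties 𝕂 (suc m)
  open HeckeRelations 𝕂 m t½ t½-invertible
  open IntegerCoefficients Laurent-commutativeRing
  open SymmetricGroup using (ℓ; w₀; allPermutations; normalWord; normalWord-length)
  open Quantum 𝕂 m
  open import Algebra.Properties.Semiring.Exp K.semiring using (_^_)
  open import Algebra.Properties.Semiring.Exp 𝕃.semiring using () renaming (_^_ to _^ᴸ_)
  open import Algebra.Properties.CommutativeSemigroup K.*-commutativeSemigroup using (interchange)
  open import Relation.Binary.Reasoning.Setoid ≋-setoid

  k⁻¹ : K.Carrier
  k⁻¹ = proj₁ k-invertible

  u u⁻¹ : Laurent
  u   = const k
  u⁻¹ = const k⁻¹

  open HeckeSymmetrizer Laurent-commutativeRing u u⁻¹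
    (≋-trans (≋-sym (const-* k k⁻¹)) (const-cong (proj₂ (proj₂ k-invertible))))
  private
    module 𝕃Q = Hecke Laurent-commutativeRing 0
    module 𝕃Q! = Quantum Laurent-commutativeRing 0

  Eigen : Laurent → Set r
  Eigen f = ∀ i → Tᵢ i f ≋ u *ᴸ f

  symmetrizerSum : Laurent → Laurent
  symmetrizerSum f = sumᴸ (map (λ w → zpower k k-invertible (+ ℓ w ℤ.- + ℓ (w₀ {suc m})) · T-perm t½ t½-invertible w f)
                               (allPermutations (suc m)))

  zpower-⊖ : ∀ a b → zpower k k-invertible (a ℤ.⊖ b) K.≈ k⁻¹ ^ b K.* k ^ a
  zpower-⊖ a       zero    = K.trans (K.reflexive (≡.cong (zpower k k-invertible) (ℤ.⊖-≥ {a} z≤n))) (K.sym (K.*-identityˡ _))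
  zpower-⊖ zero    (suc b) = K.sym (K.*-identityʳ _)
  zpower-⊖ (suc a) (suc b) = K.trans (K.reflexive (≡.cong (zpower k k-invertible) (ℤ.[1+m]⊖[1+n]≡m⊖n a b)))
    (K.trans (zpower-⊖ a b) (K.sym (K.trans (interchange k⁻¹ (k⁻¹ ^ b) k (k ^ a))
      (K.trans (K.*-congʳ (proj₁ (proj₂ k-invertible))) (K.*-identityˡ _)))))

  const-^ : ∀ j → const (k ^ j) ≋ u ^ᴸ j
  const-^ zero    = ≋-refl
  const-^ (suc j) = ≋-trans (const-* k (k ^ j)) (𝕃.*-congˡ (const-^ j))

  -- The abstract symmetrizer produces quantum integers of the Laurent ring; invertibility is known
  -- for those of 𝕂.
  const-quantum : ∀ j → const (quantum (k K.* k) j) ≋ 𝕃Q.quantum (u *ᴸ u) j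
  const-quantum zero    = const-0
  const-quantum (suc j) = ≋-trans (const-+ _ _) (𝕃.+-cong (const-quantum j) (const-square-^ j))
    where
    const-square-^ : ∀ j → const ((k K.* k) ^ j) ≋ (u *ᴸ u) ^ᴸ j
    const-square-^ zero    = ≋-refl
    const-square-^ (suc j) = ≋-trans (const-* _ _) (𝕃.*-cong (const-* k k) (const-square-^ j))

  const-quantum! : ∀ j → const (quantum! (k K.* k) j) ≋ 𝕃Q!.quantum! (u *ᴸ u) j
  const-quantum! zero    = ≋-refl
  const-quantum! (suc j) = ≋-trans (const-* _ _) (𝕃.*-cong (const-quantum (suc j)) (const-quantum! j))

  module _ (k-k⁻¹ : k K.- k⁻¹ K.≈ t½ K.- t⁻½) where

    T-isHeckeFamily : IsHeckeFamily Tᵢ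
    T-isHeckeFamily = record
      { linear    = λ i → record
        { cong   = T-cong t½ t½-invertible i
        ; +-homo = T-+ t½ t½-invertible i
        ; u-homo = T-* t½ t½-invertible i (•-const (s i) k)
        }
      ; quadratic = λ i f → ≋-trans (T-quadratic i f) (𝕃.+-congʳ (𝕃.*-congʳ (≋-sym u-u⁻¹)))
      ; commute   = T-commute
      ; braid     = T-braid
      }
      where
      const-sub : ∀ a b → const (a K.- b) ≋ const a -ᴸ const b
      const-sub a b = ≋-trans (const-+ a (K.- b)) (𝕃.+-congˡ (const-neg b))
      u-u⁻¹ : u -ᴸ u⁻¹ ≋ A -ᴸ B
      u-u⁻¹ = ≋-trans (≋-sym (const-sub k k⁻¹)) (≋-trans (const-cong k-k⁻¹) (const-sub t½ t⁻½))

    private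
      L : ∀ i → IsLinear (Tᵢ i)
      L = IsHeckeFamily.linear T-isHeckeFamily
      k⁻ᴺ : K.Carrier
      k⁻ᴺ = k⁻¹ ^ ℓ (w₀ {suc m})

    symmetrizerSum-symmetrizer : ∀ f → symmetrizerSum f ≋ const k⁻ᴺ *ᴸ symmetrizer Tᵢ f
    symmetrizerSum-symmetrizer f = begin
      symmetrizerSum f
        ≈⟨ ∑-cong (allPermutations (suc m)) term ⟩
      ∑ (allPermutations (suc m)) (λ w → const k⁻ᴺ *ᴸ φ (normalWord w))
        ≈⟨ ∑-*ˡ (allPermutations (suc m)) (const k⁻ᴺ) (φ ∘ normalWord) ⟩
      const k⁻ᴺ *ᴸ ∑ (allPermutations (suc m)) (φ ∘ normalWord)
        ≡⟨ ≡.cong (const k⁻ᴺ *ᴸ_) (≡.trans (≡.sym (∑-map normalWord (allPermutations (suc m)) φ))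
             (≡.cong (λ ws → ∑ ws φ) (normalWord-allPermutations m))) ⟩
      const k⁻ᴺ *ᴸ ∑ (normalWords m) φ
        ≈⟨ 𝕃.*-congˡ (symmetrizer-words L f) ⟩
      const k⁻ᴺ *ᴸ symmetrizer Tᵢ f ∎
      where
      φ : List (Fin m) → Laurent
      φ w = u ^ᴸ length w *ᴸ foldr Tᵢ f w
      term : ∀ w → zpower k k-invertible (+ ℓ w ℤ.- + ℓ (w₀ {suc m})) · T-perm t½ t½-invertible w f ≋ const k⁻ᴺ *ᴸ φ (normalWord w)
      term w = begin
        const (zpower k k-invertible (+ ℓ w ℤ.- + N)) *ᴸ foldr Tᵢ f (normalWord w)
          ≈⟨ 𝕃.*-congʳ (const-cong (K.trans (K.reflexive (≡.cong (zpower k k-invertible) (ℤ.[+m]-[+n]≡m⊖n (ℓ w) N)))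
               (zpower-⊖ (ℓ w) N))) ⟩
        const (k⁻ᴺ K.* k ^ ℓ w) *ᴸ foldr Tᵢ f (normalWord w)
          ≈⟨ 𝕃.*-congʳ (≋-trans (const-* k⁻ᴺ (k ^ ℓ w)) (𝕃.*-congˡ (≋-trans (const-^ (ℓ w))
               (≋-reflexive (≡.cong (u ^ᴸ_) (≡.sym (normalWord-length w))))))) ⟩
        const k⁻ᴺ *ᴸ u ^ᴸ length (normalWord w) *ᴸ foldr Tᵢ f (normalWord w)
          ≈⟨ 𝕃.*-assoc _ _ _ ⟩
        const k⁻ᴺ *ᴸ φ (normalWord w) ∎
        where N = ℓ (w₀ {suc m})

    symmetrizerSum-eigen : ∀ f → Eigen (symmetrizerSum f)
    symmetrizerSum-eigen f i = begin
      Tᵢ i (symmetrizerSum f)                          ≈⟨ T-cong t½ t½-invertible i (symmetrizerSum-symmetrizer f) ⟩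
      Tᵢ i (const k⁻ᴺ *ᴸ symmetrizer Tᵢ f)             ≈⟨ T-* t½ t½-invertible i (•-const (s i) k⁻ᴺ) _ ⟩
      const k⁻ᴺ *ᴸ Tᵢ i (symmetrizer Tᵢ f)             ≈⟨ 𝕃.*-congˡ (symmetrizer-eigen T-isHeckeFamily f i) ⟩
      const k⁻ᴺ *ᴸ (u *ᴸ symmetrizer Tᵢ f)             ≈⟨ solve 3 (λ a u f → a :* (u :* f) := u :* (a :* f)) ≋-refl (const k⁻ᴺ) u _ ⟩
      u *ᴸ (const k⁻ᴺ *ᴸ symmetrizer Tᵢ f)             ≈⟨ 𝕃.*-congˡ (symmetrizerSum-symmetrizer f) ⟨
      u *ᴸ symmetrizerSum f                            ∎

    symmetrizerSum-scalar : ∀ {f} → Eigen f → symmetrizerSum f ≋ const (k⁻ᴺ K.* quantum! (k K.* k) (suc m)) *ᴸ f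
    symmetrizerSum-scalar {f} e = begin
      symmetrizerSum f                                 ≈⟨ symmetrizerSum-symmetrizer f ⟩
      const k⁻ᴺ *ᴸ symmetrizer Tᵢ f                    ≈⟨ 𝕃.*-congˡ (symmetrizer-scalar L e) ⟩
      const k⁻ᴺ *ᴸ (𝕃Q!.quantum! (u *ᴸ u) (suc m) *ᴸ f)    ≈⟨ 𝕃.*-congˡ (𝕃.*-congʳ (const-quantum! (suc m))) ⟨
      const k⁻ᴺ *ᴸ (const (quantum! (k K.* k) (suc m)) *ᴸ f)    ≈⟨ 𝕃.*-assoc _ _ f ⟨
      const k⁻ᴺ *ᴸ const (quantum! (k K.* k) (suc m)) *ᴸ f      ≈⟨ 𝕃.*-congʳ (const-* k⁻ᴺ (quantum! (k K.* k) (suc m))) ⟨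
      const (k⁻ᴺ K.* quantum! (k K.* k) (suc m)) *ᴸ f           ∎

    module _ (quantum-unit : ∀ j → 1 ℕ.≤ j → j ℕ.≤ suc m → Unit (quantum (k K.* k) j)) where

      private
        quantum!-unit : ∀ j → j ℕ.≤ suc m → Unit (quantum! (k K.* k) j)
        quantum!-unit zero    _ = unit-1
        quantum!-unit (suc j) p = unit-* (quantum-unit (suc j) (s≤s z≤n) p) (quantum!-unit j (ℕ.<⇒≤ p))

        scalar-unit : Unit (k⁻ᴺ K.* quantum! (k K.* k) (suc m))
        scalar-unit = unit-* (unit-^ (unit-inverse k-invertible) (ℓ (w₀ {suc m}))) (quantum!-unit (suc m) ℕ.≤-refl)

      -- On eigenvectors the operator is multiplication by the unit κ, so κ⁻¹ g is a preimage of g.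
      image-eigen : Image symmetrizerSum ≐ Eigen
      image-eigen = (λ { {g} (f , e) i → begin
          Tᵢ i g                          ≈⟨ T-cong t½ t½-invertible i e ⟨
          Tᵢ i (symmetrizerSum f)         ≈⟨ symmetrizerSum-eigen f i ⟩
          u *ᴸ symmetrizerSum f           ≈⟨ 𝕃.*-congˡ e ⟩
          u *ᴸ g                          ∎ })
        , λ {g} e → const κ⁻¹ *ᴸ g , (begin
          symmetrizerSum (const κ⁻¹ *ᴸ g)     ≈⟨ symmetrizerSum-scalar (scaled e) ⟩
          const κ *ᴸ (const κ⁻¹ *ᴸ g)         ≈⟨ 𝕃.*-assoc _ _ g ⟨
          const κ *ᴸ const κ⁻¹ *ᴸ g           ≈⟨ 𝕃.*-congʳ (≋-trans (≋-sym (const-* κ κ⁻¹)) (const-cong (proj₂ (proj₂ scalar-unit)))) ⟩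
          1ᴸ *ᴸ g                             ≈⟨ 𝕃.*-identityˡ g ⟩
          g                                   ∎)
        where
        κ = k⁻ᴺ K.* quantum! (k K.* k) (suc m)
        κ⁻¹ = proj₁ scalar-unit
        scaled : ∀ {g} → Eigen g → Eigen (const κ⁻¹ *ᴸ g)
        scaled {g} e i = begin
          Tᵢ i (const κ⁻¹ *ᴸ g)       ≈⟨ T-* t½ t½-invertible i (•-const (s i) κ⁻¹) g ⟩
          const κ⁻¹ *ᴸ Tᵢ i g         ≈⟨ 𝕃.*-congˡ (e i) ⟩
          const κ⁻¹ *ᴸ (u *ᴸ g)       ≈⟨ solve 3 (λ a u f → a :* (u :* f) := u :* (a :* f)) ≋-refl (const κ⁻¹) u g ⟩
          u *ᴸ (const κ⁻¹ *ᴸ g)       ∎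

-- Products over pairs i < j

module Pairs where
  open SymmetricGroup using (pairs)

  Increasing : ∀ {n} → Fin n × Fin n → Set
  Increasing (i , j) = i Fin.< j

  pairs-increasing : ∀ n → All Increasing (pairs n)
  pairs-increasing zero    = []
  pairs-increasing (suc n) = All.++⁺ (All.map⁺ (All.universal (λ _ → s≤s z≤n) (allFin n)))
                                     (All.map⁺ (All.map s≤s (pairs-increasing n)))

  pairs-unique : ∀ n → Unique (pairs n)
  pairs-unique zero    = []
  pairs-unique (suc n) = Unique.++⁺
    (Unique.map⁺ (λ { ≡.refl → ≡.refl }) (Unique.allFin⁺ n))
    (Unique.map⁺ (λ { ≡.refl → ≡.refl }) (pairs-unique n))
    λ (p , q) → distinct (≡.trans (≡.sym (proj₂ (proj₂ (∈-map⁻ head p)))) (proj₂ (proj₂ (∈-map⁻ shift q))))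
    where
    head : Fin n → Fin (suc n) × Fin (suc n)
    head j = zero , suc j
    shift : Fin n × Fin n → Fin (suc n) × Fin (suc n)
    shift (i , j) = suc i , suc j
    distinct : ∀ {j p} → head j ≢ shift p
    distinct ()

  module _ {c r : Level} (M : CommutativeMonoid c r) where
    open CommutativeMonoid M
    open ListFold M
    open import Algebra.Properties.CommutativeMonoid.Sum M using (sum; sum-permute)
    open import Relation.Binary.Reasoning.Setoid setoid

    fold-tabulate : ∀ {A : Set} {n} (h : Fin n → A) φ → fold (List.tabulate h) φ ≈ sum (φ ∘ h)
    fold-tabulate {n = zero}  h φ = refl
    fold-tabulate {n = suc n} h φ = ∙-congˡ (fold-tabulate (h ∘ suc) φ)

    -- In `∏-s` a transposition that fixes 0 only reorders the factors belonging to the pairs (0 ,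
    -- j).
    fold-permute : ∀ {n} (w : Permutation′ n) φ → fold (allFin n) (λ j → φ (w ⟨$⟩ʳ j)) ≈ fold (allFin n) φ
    fold-permute w φ = trans (fold-tabulate id (λ j → φ (w ⟨$⟩ʳ j))) (trans (sym (sum-permute φ w)) (sym (fold-tabulate id φ)))

    ∏ : ∀ {n} → (Fin n → Fin n → Carrier) → Carrier
    ∏ {n} φ = fold (pairs n) (λ (i , j) → φ i j)

    row : ∀ {n} → (Fin n → Carrier) → Carrier
    row {n} φ = fold (allFin n) φ

    ∏-cong : ∀ {n} {φ ψ : Fin n → Fin n → Carrier} → (∀ i j → φ i j ≈ ψ i j) → ∏ φ ≈ ∏ ψ
    ∏-cong {n} p = fold-cong (pairs n) (λ (i , j) → p i j)

    ∏-suc : ∀ {n} (φ : Fin (suc n) → Fin (suc n) → Carrier) →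
            ∏ φ ≈ row (φ zero ∘ suc) ∙ ∏ (λ i j → φ (suc i) (suc j))
    ∏-suc {n} φ = trans (fold-++ (map (λ j → zero , suc j) (allFin n)) _ _)
      (∙-cong (reflexive (fold-map (λ j → zero , suc j) (allFin n) _))
              (reflexive (fold-map (λ (i , j) → suc i , suc j) (pairs n) _)))

    row-suc : ∀ {n} (φ : Fin (suc n) → Carrier) → row φ ≈ φ zero ∙ row (φ ∘ suc)
    row-suc {n} φ = ∙-congˡ (trans (reflexive (≡.cong (λ js → fold js φ) (≡.sym (List.map-tabulate {n = n} id suc))))
      (reflexive (fold-map suc (allFin n) φ)))

    -- s_i permutes the pairs other than (i , i+1) and reverses that one.
    ∏-s : ∀ {m} (i : Fin m) (φ : Fin (suc m) → Fin (suc m) → Carrier) →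
          ∏ (λ p q → φ (s i ⟨$⟩ʳ p) (s i ⟨$⟩ʳ q)) ∙ φ (inject₁ i) (suc i) ≈ ∏ φ ∙ φ (suc i) (inject₁ i)
    ∏-s {suc m} zero φ = begin
      ∏ (λ p q → φ (σ p) (σ q)) ∙ φ zero (suc zero)
        ≈⟨ ∙-congʳ (trans (split (λ p q → φ (σ p) (σ q))) (∙-cong (∙-congˡ (fold-cong (allFin m) λ _ → refl)) (∙-congˡ (∏-cong {m} λ _ _ → refl)))) ⟩
      φ (suc zero) zero ∙ R₁ ∙ (R₀ ∙ S) ∙ φ zero (suc zero)
        ≈⟨ rearrange (φ (suc zero) zero) R₁ R₀ S (φ zero (suc zero)) ⟩
      φ zero (suc zero) ∙ R₀ ∙ (R₁ ∙ S) ∙ φ (suc zero) zero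
        ≈⟨ ∙-congʳ (split φ) ⟨
      ∏ φ ∙ φ (suc zero) zero ∎
      where
      σ = λ p → s {suc m} zero ⟨$⟩ʳ p
      R₀ = row (λ j → φ zero (suc (suc j)))
      R₁ = row (λ j → φ (suc zero) (suc (suc j)))
      S  = ∏ (λ p q → φ (suc (suc p)) (suc (suc q)))
      split : ∀ (φ : Fin (suc (suc m)) → Fin (suc (suc m)) → Carrier) →
        ∏ φ ≈ φ zero (suc zero) ∙ row (λ j → φ zero (suc (suc j)))
              ∙ (row (λ j → φ (suc zero) (suc (suc j))) ∙ ∏ (λ p q → φ (suc (suc p)) (suc (suc q))))
      split φ = trans (∏-suc φ) (∙-cong (row-suc (φ zero ∘ suc)) (∏-suc (λ p q → φ (suc p) (suc q))))
      rearrange : ∀ a b d e f → a ∙ b ∙ (d ∙ e) ∙ f ≈ f ∙ d ∙ (b ∙ e) ∙ a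
      rearrange a b d e f = begin
        a ∙ b ∙ (d ∙ e) ∙ f   ≈⟨ ∙-congʳ (trans (assoc a b _) (∙-congˡ (trans (sym (assoc b d e)) (trans (∙-congʳ (comm b d)) (assoc d b e))))) ⟩
        a ∙ (d ∙ (b ∙ e)) ∙ f ≈⟨ trans (comm _ f) (∙-congˡ (comm a _)) ⟩
        f ∙ (d ∙ (b ∙ e) ∙ a) ≈⟨ trans (sym (assoc f _ a)) (∙-congʳ (sym (assoc f d _))) ⟩
        f ∙ d ∙ (b ∙ e) ∙ a   ∎
    ∏-s {suc m} (suc i) φ = begin
      ∏ (λ p q → φ (σ p) (σ q)) ∙ φ (suc (inject₁ i)) (suc (suc i))
        ≈⟨ ∙-congʳ (trans (∏-suc (λ p q → φ (σ p) (σ q))) (∙-cong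
             (trans (fold-cong (allFin (suc m)) (λ j → reflexive (≡.cong (φ zero) (σ-suc j)))) (fold-permute (s i) (φ zero ∘ suc)))
             (∏-cong λ p q → reflexive (≡.cong₂ φ (σ-suc p) (σ-suc q))))) ⟩
      row (φ zero ∘ suc) ∙ ∏ (λ p q → φ (suc (s i ⟨$⟩ʳ p)) (suc (s i ⟨$⟩ʳ q))) ∙ φ (suc (inject₁ i)) (suc (suc i))
        ≈⟨ trans (assoc _ _ _) (trans (∙-congˡ (∏-s i (λ p q → φ (suc p) (suc q)))) (sym (assoc _ _ _))) ⟩
      row (φ zero ∘ suc) ∙ ∏ (λ p q → φ (suc p) (suc q)) ∙ φ (suc (suc i)) (suc (inject₁ i))
        ≈⟨ ∙-congʳ (∏-suc φ) ⟨
      ∏ φ ∙ φ (suc (suc i)) (suc (inject₁ i)) ∎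
      where
      σ = λ p → s {suc m} (suc i) ⟨$⟩ʳ p
      σ-suc : ∀ p → σ (suc p) ≡ suc (s i ⟨$⟩ʳ p)
      σ-suc p = Perm.lift₀-transpose (inject₁ i) (suc i) (suc p)

open Pairs

-- Twisted symmetry and the product of all roots

module Roots {c r : Level} (𝕂 : CommutativeRing c r) (m : ℕ) (t : CommutativeRing.Carrier 𝕂)
  (t⁻¹ : CommutativeRing.Carrier 𝕂) (inv : CommutativeRing._≈_ 𝕂 (CommutativeRing._*_ 𝕂 t⁻¹ t) (CommutativeRing.1# 𝕂)) where

  open Hecke 𝕂 m hiding (module K)
  open LaurentProperties 𝕂 (suc m)
  open SymmetricGroup using (pairs)
  open ListFold 𝕃.*-commutativeMonoid
  open import Relation.Binary.Reasoning.Setoid ≋-setoid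

  •-root : ∀ w {i j i′ j′} → w ⟨$⟩ʳ i ≡ i′ → w ⟨$⟩ʳ j ≡ j′ → w • root t i j ≋ root t i′ j′
  •-root w {i} {j} ≡.refl ≡.refl = ≋-trans (•-+ w _ _) (𝕃.+-cong (•-const-x K.1# j)
    (≋-trans (•-neg w _) (𝕃.-‿cong (•-const-x t i))))
    where
    •-const-x : ∀ k p → w • (const k *ᴸ x p) ≋ const k *ᴸ x (w ⟨$⟩ʳ p)
    •-const-x k p = ≋-trans (•-* w (const k) (x p)) (𝕃.*-cong (•-const w k) (•-x w p))

  •-∣ : ∀ w {d f} → d ∣ f → w • d ∣ w • f
  •-∣ w {d} (q , e) = w • q , ≋-trans (≋-sym (•-* w d q)) (•-cong w e)

  ∣-divisor : ∀ {d d′ f} → d ≋ d′ → d ∣ f → d′ ∣ f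
  ∣-divisor p (q , e) = q , ≋-trans (𝕃.*-congʳ (≋-sym p)) e

  Δ : Laurent
  Δ = ∏ 𝕃.*-commutativeMonoid (root t)

  factorᴾ : Fin (suc m) × Fin (suc m) → Laurent
  factorᴾ (i , j) = root t i j

  fold-regular : ∀ {ps} → All Increasing ps → Regular (fold ps factorᴾ)
  fold-regular []         = regular-1
  fold-regular (i<j ∷ ps) = regular-* (root-regular t (Fin.<⇒≢ i<j)) (fold-regular ps)

  Δ-regular : Regular Δ
  Δ-regular = fold-regular (pairs-increasing (suc m))

  -- If f is the first root times g, each other root divides that product and hence g by
  -- coprimality. The list has no repetitions, and reversed pairs cannot occur since all pairs are
  -- increasing.
  fold-∣ : ∀ {ps} → All Increasing ps → Unique ps → ∀ {f} → All (λ p → factorᴾ p ∣ f) ps →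
           fold ps factorᴾ ∣ f
  fold-∣ []           []           {f} []              = f , 𝕃.*-identityˡ f
  fold-∣ (i<j ∷ incr) (new ∷ uniq) {f} ((g , e) ∷ div) =
    let q , e′ = fold-∣ incr uniq (rest incr new div) in q , ≋-trans (𝕃.*-assoc _ _ q) (≋-trans (𝕃.*-congˡ e′) e)
    where
    rest : ∀ {ps} → All Increasing ps → All (_ ≢_) ps → All (λ p → factorᴾ p ∣ f) ps →
           All (λ p → factorᴾ p ∣ g) ps
    rest [] [] [] = []
    rest (p<q ∷ incr) (≢ ∷ new) (d ∷ div) =
      coprime-roots inv (Fin.<⇒≢ p<q) (Fin.<⇒≢ i<j)
        (λ { ≡.refl ≡.refl → ≢ ≡.refl })
        (λ { ≡.refl ≡.refl → Fin.<-asym i<j p<q })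
        (∣-≋ (≋-sym e) d)
      ∷ rest incr new div

  Twisted : Laurent → Set r
  Twisted f = ∀ i → root t (suc i) (inject₁ i) *ᴸ f ≋ root t (inject₁ i) (suc i) *ᴸ s i • f

  -- s_i permutes the factors except x_{i+1} - t x_i, which it reverses.
  Δ-twisted : Twisted Δ
  Δ-twisted i = begin
    root t (suc i) (inject₁ i) *ᴸ Δ               ≈⟨ 𝕃.*-comm _ Δ ⟩
    Δ *ᴸ root t (suc i) (inject₁ i)               ≈⟨ ∏-s 𝕃.*-commutativeMonoid i (root t) ⟨
    ∏ 𝕃.*-commutativeMonoid (λ p q → root t (s i ⟨$⟩ʳ p) (s i ⟨$⟩ʳ q)) *ᴸ root t (inject₁ i) (suc i)
                                                  ≈⟨ 𝕃.*-congʳ (•-fold (pairs (suc m))) ⟨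
    s i • Δ *ᴸ root t (inject₁ i) (suc i)         ≈⟨ 𝕃.*-comm _ _ ⟩
    root t (inject₁ i) (suc i) *ᴸ s i • Δ         ∎
    where
    •-fold : ∀ ps → s i • fold ps (λ (p , q) → root t p q) ≋ fold ps (λ (p , q) → root t (s i ⟨$⟩ʳ p) (s i ⟨$⟩ʳ q))
    •-fold []       = •-const (s i) K.1#
    •-fold (_ ∷ ps) = ≋-trans (•-* (s i) _ _) (𝕃.*-cong (•-root (s i) ≡.refl ≡.refl) (•-fold ps))

  twisted-Δ-* : ∀ {g} → Symmetric g → Twisted (Δ *ᴸ g)
  twisted-Δ-* {g} σ i = begin
    root t (suc i) (inject₁ i) *ᴸ (Δ *ᴸ g)             ≈⟨ 𝕃.*-assoc _ Δ g ⟨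
    root t (suc i) (inject₁ i) *ᴸ Δ *ᴸ g               ≈⟨ 𝕃.*-cong (Δ-twisted i) (≋-sym (σ i)) ⟩
    root t (inject₁ i) (suc i) *ᴸ s i • Δ *ᴸ s i • g   ≈⟨ 𝕃.*-assoc _ _ _ ⟩
    root t (inject₁ i) (suc i) *ᴸ (s i • Δ *ᴸ s i • g) ≈⟨ 𝕃.*-congˡ (•-* (s i) Δ g) ⟨
    root t (inject₁ i) (suc i) *ᴸ s i • (Δ *ᴸ g)       ∎

  module _ {f} (twisted : Twisted f) (adjacent-∣ : ∀ i → root t (inject₁ i) (suc i) ∣ f) where

    -- s_j carries x_j - t x_i to x_{j+1} - t x_i, and the twist transports divisibility along it.
    root-∣ : ∀ {i j} → i Fin.< j → root t i j ∣ f
    root-∣ {i} {j} i<j = go (toℕ j) j ≡.refl i<j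
      where
      go : ∀ n j → toℕ j ≡ n → i Fin.< j → root t i j ∣ f
      go (suc n) (suc j) eq i<j with toSum (i Fin.≟ inject₁ j)
      ... | inj₁ ≡.refl = adjacent-∣ j
      -- The twist shows that the wanted root divides (x_j - t x_{j+1}) f. As i differs from j, that
      -- extra factor is not its reverse and may be dropped.
      ... | inj₂ i≢j = coprime-roots inv (Fin.<⇒≢ i<j) (inject₁≢suc j ∘ ≡.sym)
              (λ e → contradiction e (inject₁≢suc j)) (λ _ → i≢j ∘ ≡.sym)
              (∣-≋ (≋-sym (twisted j)) (∣-* _ (∣-divisor (•-root (s j) (s-≢ j i≢j (Fin.<⇒≢ i<j)) (s-inject₁ j))
                (•-∣ (s j) (go n (inject₁ j) (≡.trans (Fin.toℕ-inject₁ j) (ℕ.suc-injective eq))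
                  (ℕ.≤∧≢⇒< (≡.subst (toℕ i ℕ.≤_) (≡.sym (Fin.toℕ-inject₁ j)) (ℕ.s≤s⁻¹ i<j)) (i≢j ∘ Fin.toℕ-injective)))))))

    -- f and `Δ` satisfy the same twisted symmetry, so cancelling (x_{i+1} - t x_i) s_i Δ leaves an
    -- invariant quotient.
    factor : MultipleBySymmetric Δ f
    factor = g , symmetric , e
      where
      divides = fold-∣ (pairs-increasing (suc m)) (pairs-unique (suc m)) (All.map root-∣ (pairs-increasing (suc m)))
      g = proj₁ divides
      e = proj₂ divides
      symmetric : Symmetric g
      symmetric i = ≋-sym (cancel-regular (regular-* (root-regular t (inject₁≢suc i)) (regular-• (s i) Δ-regular)) (begin
        root t (inject₁ i) (suc i) *ᴸ s i • Δ *ᴸ g           ≈⟨ 𝕃.*-congʳ (Δ-twisted i) ⟨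
        root t (suc i) (inject₁ i) *ᴸ Δ *ᴸ g                 ≈⟨ ≋-trans (𝕃.*-assoc _ Δ g) (𝕃.*-congˡ e) ⟩
        root t (suc i) (inject₁ i) *ᴸ f                      ≈⟨ twisted i ⟩
        root t (inject₁ i) (suc i) *ᴸ s i • f                ≈⟨ 𝕃.*-congˡ (≋-trans (•-cong (s i) (≋-sym e)) (•-* (s i) Δ g)) ⟩
        root t (inject₁ i) (suc i) *ᴸ (s i • Δ *ᴸ s i • g)   ≈⟨ 𝕃.*-assoc _ _ _ ⟨
        root t (inject₁ i) (suc i) *ᴸ s i • Δ *ᴸ s i • g     ∎))

-- Multiplication by a regular element as a module isomorphism

module Multiplication {c r : Level} (𝕂 : CommutativeRing c r) (m : ℕ) where
  open Hecke 𝕂 m hiding (module K)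
  open LaurentProperties 𝕂 (suc m)
  open IntegerCoefficients Laurent-commutativeRing

  multiplication-isIsomorphism : ∀ {P Q : Laurent → Set r} (P-sub : IsSubmodule P) (Q-sub : IsSubmodule Q) {h} →
    Regular h → (into : ∀ f → P f → Q (h *ᴸ f)) → (∀ g → Q g → ∃ λ f → P f × h *ᴸ f ≋ g) →
    IsModuleIsomorphism (Module.rawModule (submodule P-sub)) (Module.rawModule (submodule Q-sub))
      (λ (f , p) → h *ᴸ f , into f p)
  multiplication-isIsomorphism P-sub Q-sub {h} h-regular into onto = record
    { isModuleMonomorphism = record
      { isModuleHomomorphism = record
        { isBimoduleHomomorphism = record
          { +ᴹ-isGroupHomomorphism = record
            { isMonoidHomomorphism = record
              { isMagmaHomomorphism = record
                { isRelHomomorphism = record { cong = 𝕃.*-congˡ }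
                ; homo = λ (f , _) (g , _) → 𝕃.distribˡ h f g }
              ; ε-homo = 𝕃.zeroʳ h }
            ; ⁻¹-homo = λ (f , _) → solve 2 (λ h f → h :* :- f := :- (h :* f)) ≋-refl h f }
          ; *ₗ-homo = λ (g , _) (f , _) → swap g f
          ; *ᵣ-homo = λ (g , _) (f , _) → swap g f
          } }
      ; injective = cancel-regular h-regular }
    ; surjective = λ (g , q) → let f , p , e = onto g q in (f , p) , λ z≋f → ≋-trans (𝕃.*-congˡ z≋f) e
    }
    where
    swap : ∀ g f → h *ᴸ (g *ᴸ f) ≋ g *ᴸ (h *ᴸ f)
    swap g f = solve 3 (λ h g f → h :* (g :* f) := g :* (h :* f)) ≋-refl h g f

-- Antisymmetric polynomials, the case t = 1

module Alternants {c r : Level} (𝕂 : CommutativeRing c r) (m : ℕ) where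
  open Hecke 𝕂 m hiding (module K)
  open LaurentProperties 𝕂 (suc m)
  open SimpleDifference 𝕂 m
  open IntegerCoefficients Laurent-commutativeRing
  open SymmetricGroup using (pairs)
  open ListFold 𝕃.*-commutativeMonoid
  open Multiplication 𝕂 m
  open Quantum 𝕂 m using (Unit)
  open Roots 𝕂 m K.1# K.1# (K.*-identityˡ K.1#)
  open import Relation.Binary.Reasoning.Setoid ≋-setoid

  root-1 : ∀ i j → root K.1# i j ≋ x j -ᴸ x i
  root-1 i j = 𝕃.+-cong (𝕃.*-identityˡ (x j)) (𝕃.-‿cong (𝕃.*-identityˡ (x i)))

  Δ≋aρ : Δ ≋ aρ
  Δ≋aρ = fold-cong (pairs (suc m)) λ (i , j) → root-1 i j

  antisymmetric-twisted : ∀ {f} → Antisymmetric f → Twisted f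
  antisymmetric-twisted {f} p i = begin
    root K.1# (suc i) (inject₁ i) *ᴸ f      ≈⟨ 𝕃.*-congʳ (root-1 (suc i) (inject₁ i)) ⟩
    (x₁ -ᴸ x₂) *ᴸ f                         ≈⟨ solve 3 (λ x₁ x₂ f → (x₁ :- x₂) :* f := (x₂ :- x₁) :* (:- f)) ≋-refl x₁ x₂ f ⟩
    (x₂ -ᴸ x₁) *ᴸ (-ᴸ f)                    ≈⟨ 𝕃.*-cong (root-1 (inject₁ i) (suc i)) (p i) ⟨
    root K.1# (inject₁ i) (suc i) *ᴸ s i • f ∎
    where
    x₁ = x (inject₁ i)
    x₂ = x (suc i)

  twisted-antisymmetric : ∀ {f} → Twisted f → Antisymmetric f
  twisted-antisymmetric {f} p i = cancel-regular (root-regular K.1# (inject₁≢suc i)) (begin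
    root K.1# (inject₁ i) (suc i) *ᴸ s i • f   ≈⟨ p i ⟨
    root K.1# (suc i) (inject₁ i) *ᴸ f         ≈⟨ 𝕃.*-congʳ (root-1 (suc i) (inject₁ i)) ⟩
    (x₁ -ᴸ x₂) *ᴸ f                            ≈⟨ solve 3 (λ x₁ x₂ f → (x₁ :- x₂) :* f := (x₂ :- x₁) :* (:- f)) ≋-refl x₁ x₂ f ⟩
    (x₂ -ᴸ x₁) *ᴸ (-ᴸ f)                       ≈⟨ 𝕃.*-congʳ (root-1 (inject₁ i) (suc i)) ⟨
    root K.1# (inject₁ i) (suc i) *ᴸ (-ᴸ f)    ∎)
    where
    x₁ = x (inject₁ i)
    x₂ = x (suc i)

  aρ-*-antisymmetric : ∀ f → Symmetric f → Antisymmetric (aρ *ᴸ f)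
  aρ-*-antisymmetric f σ i = ≋-trans (•-cong (s i) (𝕃.*-congʳ (≋-sym Δ≋aρ)))
    (≋-trans (twisted-antisymmetric (twisted-Δ-* σ) i) (𝕃.-‿cong (𝕃.*-congʳ Δ≋aρ)))

  module _ (2-unit : Unit (K.1# K.+ K.1#)) where

    -- Here f - s_i f = 2 f, so halving the general divisibility of f - s_i f gives that of f.
    antisymmetric-factor : ∀ f → Antisymmetric f → ∃ λ g → Symmetric g × aρ *ᴸ g ≋ f
    antisymmetric-factor f p =
      let g , σ , e = factor (antisymmetric-twisted p) divides in g , σ , ≋-trans (𝕃.*-congʳ (≋-sym Δ≋aρ)) e
      where
      ½ᴸ = const (proj₁ 2-unit)
      half-double : ½ᴸ *ᴸ (f +ᴸ f) ≋ f
      half-double = begin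
        ½ᴸ *ᴸ (f +ᴸ f)               ≈⟨ 𝕃.*-congˡ (𝕃.+-cong (𝕃.*-identityˡ f) (𝕃.*-identityˡ f)) ⟨
        ½ᴸ *ᴸ (1ᴸ *ᴸ f +ᴸ 1ᴸ *ᴸ f)   ≈⟨ solve 3 (λ h o f → h :* (o :* f :+ o :* f) := h :* (o :+ o) :* f) ≋-refl ½ᴸ 1ᴸ f ⟩
        ½ᴸ *ᴸ (1ᴸ +ᴸ 1ᴸ) *ᴸ f        ≈⟨ 𝕃.*-congʳ (≋-trans (𝕃.*-congˡ (≋-sym (const-+ K.1# K.1#)))
                                         (≋-trans (≋-sym (const-* _ _)) (const-cong (proj₁ (proj₂ 2-unit))))) ⟩
        1ᴸ *ᴸ f                      ≈⟨ 𝕃.*-identityˡ f ⟩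
        f                            ∎
      divides : ∀ i → root K.1# (inject₁ i) (suc i) ∣ f
      divides i = ∣-≋ half-double (∣-* ½ᴸ (∣-≋ (𝕃.+-congˡ (≋-trans (𝕃.-‿cong (p i))
        (solve 1 (λ f → :- (:- f) := f) ≋-refl f))) (s-difference i f)))

    aρ-isIsomorphism : IsModuleIsomorphism (Module.rawModule Symmetric-module) (Module.rawModule Antisymmetric-module)
      (λ (f , p) → aρ *ᴸ f , aρ-*-antisymmetric f p)
    aρ-isIsomorphism = multiplication-isIsomorphism symmetric-isSubmodule antisymmetric-isSubmodule
      (regular-≋ Δ≋aρ Δ-regular) aρ-*-antisymmetric antisymmetric-factor

-- Bosonic and fermionic polynomials

module Eigenspaces {c r : Level} (𝕂 : CommutativeRing c r) (m : ℕ)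
  (t½ : CommutativeRing.Carrier 𝕂)
  (t½-invertible : Invertible (CommutativeRing._≈_ 𝕂) (CommutativeRing.1# 𝕂) (CommutativeRing._*_ 𝕂) t½) where

  open Hecke 𝕂 m hiding (module K)
  open LaurentProperties 𝕂 (suc m)
  open SimpleDifference 𝕂 m
  open HeckeRelations 𝕂 m t½ t½-invertible
  open IntegerCoefficients Laurent-commutativeRing
  open SymmetricGroup using (pairs)
  open ListFold 𝕃.*-commutativeMonoid
  open Multiplication 𝕂 m
  open Quantum 𝕂 m using (Unit; unit-*; unit-≈; unit-inverse; unit-^; quantum-cong; quantum-inverse)
  open import Algebra.Properties.Ring 𝕃.ring using (x∙y⁻¹≈ε⇒x≈y; x≈y⇒x∙y⁻¹≈ε; +-inverseˡ-unique)
  open import Algebra.Properties.Ring K.ring using (-‿distribˡ-*; -‿distribʳ-*; -‿involutive)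
  open import Relation.Binary.Reasoning.Setoid ≋-setoid

  private
    t t⁻¹ : K.Carrier
    t   = t½ K.* t½
    t⁻¹ = t⁻½ K.* t⁻½

    t⁻¹*t : t⁻¹ K.* t K.≈ K.1#
    t⁻¹*t = proj₁ (proj₂ (unit-* t½-invertible t½-invertible))

  open Roots 𝕂 m t t⁻¹ t⁻¹*t

  private
    Bos Fer : Laurent → Set r
    Bos = Bosonic t½ t½-invertible
    Fer = Fermionic t½ t½-invertible

    Aρ′ : Laurent
    Aρ′ = Aρ t½ t½-invertible

  -- Both outer factors are regular, so the bosonic condition at i and invariance under s_i imply
  -- each other. The same formula shows that (T_i - t^½) f inherits a factor from f - s_i f.
  T-A : ∀ i f → (x (inject₁ i) -ᴸ x (suc i)) *ᴸ (Tᵢ i f -ᴸ A *ᴸ f) ≋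
                binomial t⁻½ (suc i) t½ (inject₁ i) *ᴸ (f -ᴸ s i • f)
  T-A i f = begin
    (x₁ -ᴸ x₂) *ᴸ (Tᵢ i f -ᴸ A *ᴸ f)
      ≈⟨ solve 4 (λ d T A f → d :* (T :- A :* f) := d :* T :- d :* A :* f) ≋-refl (x₁ -ᴸ x₂) (Tᵢ i f) A f ⟩
    (x₁ -ᴸ x₂) *ᴸ Tᵢ i f -ᴸ (x₁ -ᴸ x₂) *ᴸ A *ᴸ f
      ≈⟨ 𝕃.+-congʳ (Expansion.expansion (T-expansion i f)) ⟩
    (B -ᴸ A) *ᴸ x₂ *ᴸ f +ᴸ (A *ᴸ x₁ -ᴸ B *ᴸ x₂) *ᴸ s i • f -ᴸ (x₁ -ᴸ x₂) *ᴸ A *ᴸ f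
      ≈⟨ solve 6 (λ x₁ x₂ A B f f′ → (B :- A) :* x₂ :* f :+ (A :* x₁ :- B :* x₂) :* f′ :- (x₁ :- x₂) :* A :* f
           := (B :* x₂ :- A :* x₁) :* (f :- f′)) ≋-refl x₁ x₂ A B f (s i • f) ⟩
    (B *ᴸ x₂ -ᴸ A *ᴸ x₁) *ᴸ (f -ᴸ s i • f) ∎
    where
    x₁ = x (inject₁ i)
    x₂ = x (suc i)

  bosonic≐symmetric : Bos ≐ Symmetric
  bosonic≐symmetric = (λ {f} b i → sub-zero (binomial-regular {k⁻¹ = t½} (proj₂ (proj₂ t½-invertible)) (inject₁≢suc i ∘ ≡.sym) t½ _ (begin
      binomial t⁻½ (suc i) t½ (inject₁ i) *ᴸ (f -ᴸ s i • f)         ≈⟨ T-A i f ⟨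
      (x (inject₁ i) -ᴸ x (suc i)) *ᴸ (Tᵢ i f -ᴸ A *ᴸ f)            ≈⟨ 𝕃.*-congˡ (≋-trans (𝕃.+-congʳ (b i)) (𝕃.-‿inverseʳ _)) ⟩
      (x (inject₁ i) -ᴸ x (suc i)) *ᴸ 0ᴸ                            ≈⟨ 𝕃.zeroʳ _ ⟩
      0ᴸ                                                            ∎)))
    , λ {f} σ i → ≋-sym (sub-zero (difference-regular (inject₁≢suc i) _ (begin
      (x (inject₁ i) -ᴸ x (suc i)) *ᴸ (Tᵢ i f -ᴸ A *ᴸ f)            ≈⟨ T-A i f ⟩
      binomial t⁻½ (suc i) t½ (inject₁ i) *ᴸ (f -ᴸ s i • f)         ≈⟨ 𝕃.*-congˡ (≋-trans (𝕃.+-congˡ (𝕃.-‿cong (σ i))) (𝕃.-‿inverseʳ f)) ⟩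
      binomial t⁻½ (suc i) t½ (inject₁ i) *ᴸ 0ᴸ                     ≈⟨ 𝕃.zeroʳ _ ⟩
      0ᴸ                                                            ∎)))
    where
    sub-zero : ∀ {f g} → f -ᴸ g ≋ 0ᴸ → g ≋ f
    sub-zero p = ≋-sym (x∙y⁻¹≈ε⇒x≈y _ _ p)

  Δ≋Aρ : Δ ≋ Aρ′
  Δ≋Aρ = fold-cong (pairs (suc m)) λ (i , j) → 𝕃.+-congʳ (𝕃.*-identityˡ (x j))

  Aρ-regular : Regular Aρ′
  Aρ-regular = regular-≋ Δ≋Aρ Δ-regular

  private
    A*A : const t ≋ A *ᴸ A
    A*A = const-* t½ t½

    A*binomial : ∀ i j → A *ᴸ (B *ᴸ x j -ᴸ A *ᴸ x i) ≋ root t i j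
    A*binomial i j = begin
      A *ᴸ (B *ᴸ x j -ᴸ A *ᴸ x i)
        ≈⟨ solve 4 (λ A B y z → A :* (B :* y :- A :* z) := A :* B :* y :- A :* A :* z) ≋-refl A B (x j) (x i) ⟩
      A *ᴸ B *ᴸ x j -ᴸ A *ᴸ A *ᴸ x i
        ≈⟨ 𝕃.+-cong (𝕃.*-congʳ A*B) (𝕃.-‿cong (𝕃.*-congʳ (≋-sym A*A))) ⟩
      root t i j ∎

    A-cancel : ∀ {f g} → A *ᴸ f ≋ A *ᴸ g → f ≋ g
    A-cancel {f} {g} p = begin
      f                  ≈⟨ B*A f ⟨
      B *ᴸ (A *ᴸ f)      ≈⟨ 𝕃.*-congˡ p ⟩
      B *ᴸ (A *ᴸ g)      ≈⟨ B*A g ⟩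
      g                  ∎
      where
      B*A : ∀ f → B *ᴸ (A *ᴸ f) ≋ f
      B*A f = ≋-trans (solve 3 (λ A B f → B :* (A :* f) := A :* B :* f) ≋-refl A B f)
        (≋-trans (𝕃.*-congʳ A*B) (𝕃.*-identityˡ f))

  T+B : ∀ i f → (x (inject₁ i) -ᴸ x (suc i)) *ᴸ (A *ᴸ (Tᵢ i f +ᴸ B *ᴸ f)) ≋
                root t (suc i) (inject₁ i) *ᴸ f -ᴸ root t (inject₁ i) (suc i) *ᴸ s i • f
  T+B i f = begin
    (x₁ -ᴸ x₂) *ᴸ (A *ᴸ (Tᵢ i f +ᴸ B *ᴸ f))
      ≈⟨ solve 5 (λ d A B T f → d :* (A :* (T :+ B :* f)) := A :* (d :* T :+ d :* B :* f)) ≋-refl (x₁ -ᴸ x₂) A B (Tᵢ i f) f ⟩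
    A *ᴸ ((x₁ -ᴸ x₂) *ᴸ Tᵢ i f +ᴸ (x₁ -ᴸ x₂) *ᴸ B *ᴸ f)
      ≈⟨ 𝕃.*-congˡ (𝕃.+-congʳ (Expansion.expansion (T-expansion i f))) ⟩
    A *ᴸ ((B -ᴸ A) *ᴸ x₂ *ᴸ f +ᴸ (A *ᴸ x₁ -ᴸ B *ᴸ x₂) *ᴸ s i • f +ᴸ (x₁ -ᴸ x₂) *ᴸ B *ᴸ f)
      ≈⟨ solve 6 (λ x₁ x₂ A B f f′ → A :* ((B :- A) :* x₂ :* f :+ (A :* x₁ :- B :* x₂) :* f′ :+ (x₁ :- x₂) :* B :* f)
           := A :* (B :* x₁ :- A :* x₂) :* f :- A :* (B :* x₂ :- A :* x₁) :* f′) ≋-refl x₁ x₂ A B f (s i • f) ⟩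
    A *ᴸ (B *ᴸ x₁ -ᴸ A *ᴸ x₂) *ᴸ f -ᴸ A *ᴸ (B *ᴸ x₂ -ᴸ A *ᴸ x₁) *ᴸ s i • f
      ≈⟨ 𝕃.+-cong (𝕃.*-congʳ (A*binomial (suc i) (inject₁ i))) (𝕃.-‿cong (𝕃.*-congʳ (A*binomial (inject₁ i) (suc i)))) ⟩
    root t (suc i) (inject₁ i) *ᴸ f -ᴸ root t (inject₁ i) (suc i) *ᴸ s i • f ∎
    where
    x₁ = x (inject₁ i)
    x₂ = x (suc i)

  fermionic-twisted : ∀ {f} → Fer f → Twisted f
  fermionic-twisted {f} p i = x∙y⁻¹≈ε⇒x≈y _ _ (begin
    root t (suc i) (inject₁ i) *ᴸ f -ᴸ root t (inject₁ i) (suc i) *ᴸ s i • f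
      ≈⟨ T+B i f ⟨
    (x (inject₁ i) -ᴸ x (suc i)) *ᴸ (A *ᴸ (Tᵢ i f +ᴸ B *ᴸ f))
      ≈⟨ 𝕃.*-congˡ (𝕃.*-congˡ (≋-trans (𝕃.+-congʳ (p i)) (𝕃.-‿inverseˡ (B *ᴸ f)))) ⟩
    (x (inject₁ i) -ᴸ x (suc i)) *ᴸ (A *ᴸ 0ᴸ)
      ≈⟨ ≋-trans (𝕃.*-congˡ (𝕃.zeroʳ A)) (𝕃.zeroʳ _) ⟩
    0ᴸ ∎)

  twisted-fermionic : ∀ {f} → Twisted f → Fer f
  twisted-fermionic {f} p i = +-inverseˡ-unique _ _ (A-cancel (≋-trans (difference-regular (inject₁≢suc i) _
    (≋-trans (T+B i f) (x≈y⇒x∙y⁻¹≈ε (p i)))) (≋-sym (𝕃.zeroʳ A))))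

  Aρ-*-fermionic : ∀ f → Symmetric f → Fer (Aρ′ *ᴸ f)
  Aρ-*-fermionic f σ = twisted-fermionic λ i → ≋-trans (𝕃.*-congˡ Aρf≋) (≋-trans (twisted-Δ-* σ i)
    (𝕃.*-congˡ (•-cong (s i) (≋-sym Aρf≋))))
    where
    Aρf≋ : Aρ′ *ᴸ f ≋ Δ *ᴸ f
    Aρf≋ = 𝕃.*-congʳ (≋-sym Δ≋Aρ)

  module _ (quantum-unit : ∀ k → 1 ≤ k → k ≤ suc m → Unit (quantum t k)) where

    private
      -- 1 + t is the quantum integer [2]; an index in `Fin m` guarantees n ≥ 2, so the assumption
      -- covers it.
      1+t-unit : Fin m → Unit (K.1# K.+ t)
      1+t-unit i = unit-≈ (K.+-cong (K.+-identityˡ K.1#) (K.*-identityʳ t)) (quantum-unit 2 (s≤s z≤n) (s≤s (Fin-nonempty i)))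
        where
        Fin-nonempty : ∀ {n} → Fin n → 1 ≤ n
        Fin-nonempty {suc n} _ = s≤s z≤n

    -- T_i f - t^½ f is always a multiple of x_{i+1} - t x_i, and equals -(t^½ + t^{-½}) f when f is fermionic.
    fermionic-∣ : ∀ {f} → Fer f → ∀ i → root t (inject₁ i) (suc i) ∣ f
    fermionic-∣ {f} p i = ∣-≋ recover (∣-* κ (q , ≋-sym A[T-A]))
      where
      x₁ = x (inject₁ i)
      x₂ = x (suc i)
      κ  = const (proj₁ (1+t-unit i))
      q  = proj₁ (s-difference i f)
      T-A≋ : Tᵢ i f -ᴸ A *ᴸ f ≋ -ᴸ (binomial t⁻½ (suc i) t½ (inject₁ i) *ᴸ q)
      T-A≋ = cancel-regular (difference-regular (inject₁≢suc i)) (begin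
        (x₁ -ᴸ x₂) *ᴸ (Tᵢ i f -ᴸ A *ᴸ f)          ≈⟨ T-A i f ⟩
        Q *ᴸ (f -ᴸ s i • f)                       ≈⟨ 𝕃.*-congˡ (proj₂ (s-difference i f)) ⟨
        Q *ᴸ (root K.1# (inject₁ i) (suc i) *ᴸ q) ≈⟨ 𝕃.*-congˡ (𝕃.*-congʳ (𝕃.+-cong (𝕃.*-identityˡ x₂) (𝕃.-‿cong (𝕃.*-identityˡ x₁)))) ⟩
        Q *ᴸ ((x₂ -ᴸ x₁) *ᴸ q)                    ≈⟨ solve 4 (λ x₁ x₂ Q q → Q :* ((x₂ :- x₁) :* q) := (x₁ :- x₂) :* (:- (Q :* q))) ≋-refl x₁ x₂ Q q ⟩
        (x₁ -ᴸ x₂) *ᴸ (-ᴸ (Q *ᴸ q))               ∎)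
        where Q = binomial t⁻½ (suc i) t½ (inject₁ i)
      A[T-A] : -ᴸ (A *ᴸ (Tᵢ i f -ᴸ A *ᴸ f)) ≋ root t (inject₁ i) (suc i) *ᴸ q
      A[T-A] = begin
        -ᴸ (A *ᴸ (Tᵢ i f -ᴸ A *ᴸ f))     ≈⟨ 𝕃.-‿cong (𝕃.*-congˡ T-A≋) ⟩
        -ᴸ (A *ᴸ (-ᴸ (Q *ᴸ q)))          ≈⟨ solve 3 (λ A Q q → :- (A :* (:- (Q :* q))) := A :* Q :* q) ≋-refl A Q q ⟩
        A *ᴸ Q *ᴸ q                      ≈⟨ 𝕃.*-congʳ (A*binomial (inject₁ i) (suc i)) ⟩
        root t (inject₁ i) (suc i) *ᴸ q  ∎
        where Q = binomial t⁻½ (suc i) t½ (inject₁ i)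
      recover : κ *ᴸ (-ᴸ (A *ᴸ (Tᵢ i f -ᴸ A *ᴸ f))) ≋ f
      recover = begin
        κ *ᴸ (-ᴸ (A *ᴸ (Tᵢ i f -ᴸ A *ᴸ f)))
          ≈⟨ 𝕃.*-congˡ (𝕃.-‿cong (𝕃.*-congˡ (𝕃.+-congʳ (p i)))) ⟩
        κ *ᴸ (-ᴸ (A *ᴸ (-ᴸ (B *ᴸ f) -ᴸ A *ᴸ f)))
          ≈⟨ solve 4 (λ κ A B f → κ :* (:- (A :* (:- (B :* f) :- A :* f))) := κ :* (A :* B :+ A :* A) :* f) ≋-refl κ A B f ⟩
        κ *ᴸ (A *ᴸ B +ᴸ A *ᴸ A) *ᴸ f
          ≈⟨ 𝕃.*-congʳ (𝕃.*-congˡ (≋-trans (𝕃.+-cong A*B (≋-sym A*A)) (≋-sym (const-+ K.1# t)))) ⟩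
        κ *ᴸ const (K.1# K.+ t) *ᴸ f
          ≈⟨ 𝕃.*-congʳ (≋-trans (≋-sym (const-* _ _)) (const-cong (proj₁ (proj₂ (1+t-unit i))))) ⟩
        1ᴸ *ᴸ f
          ≈⟨ 𝕃.*-identityˡ f ⟩
        f ∎

    fermionic-factor : ∀ f → Fer f → MultipleBySymmetric Aρ′ f
    fermionic-factor f p =
      let g , σ , e = factor (fermionic-twisted p) (fermionic-∣ p) in g , σ , ≋-trans (𝕃.*-congʳ (≋-sym Δ≋Aρ)) e

    fermionic≐multiples : Fer ≐ MultipleBySymmetric Aρ′
    fermionic≐multiples = fermionic-factor _
      , λ { (g , σ , e) i → ≋-trans (T-cong t½ t½-invertible i (≋-sym e))
            (≋-trans (Aρ-*-fermionic g σ i) (𝕃.-‿cong (𝕃.*-congˡ e))) }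

    Aρ-*-into : ∀ f → Bos f → Fer (Aρ′ *ᴸ f)
    Aρ-*-into f b = Aρ-*-fermionic f (proj₁ bosonic≐symmetric b)

    Aρ-isIsomorphism : IsModuleIsomorphism (Module.rawModule (Bosonic-module t½ t½-invertible))
      (Module.rawModule (Fermionic-module t½ t½-invertible)) (λ (f , p) → Aρ′ *ᴸ f , Aρ-*-into f p)
    Aρ-isIsomorphism = multiplication-isIsomorphism (bosonic-isSubmodule t½ t½-invertible) (fermionic-isSubmodule t½ t½-invertible)
      Aρ-regular Aρ-*-into λ g p → let f , σ , e = fermionic-factor g p in f , proj₂ bosonic≐symmetric σ , e

    image-𝟏₀ : Image (𝟏₀ t½ t½-invertible) ≐ Bos
    image-𝟏₀ = Symmetrizers.image-eigen 𝕂 m t½ t½-invertible t½ t½-invertible K.refl quantum-unit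

    image-ε₀ : Image (ε₀ t½ t½-invertible) ≐ Fer
    image-ε₀ = (λ im i → ≋-trans (proj₁ image≐ im i) (neg-const _))
             , (λ p → proj₂ image≐ λ i → ≋-trans (p i) (≋-sym (neg-const _)))
      where
      neg-const : ∀ f → const (K.- t⁻½) *ᴸ f ≋ -ᴸ (B *ᴸ f)
      neg-const f = ≋-trans (𝕃.*-congʳ (const-neg t⁻½)) (solve 2 (λ b f → :- b :* f := :- (b :* f)) ≋-refl B f)
      square : t⁻½ K.* t⁻½ K.≈ (K.- t⁻½) K.* (K.- t⁻½)
      square = K.sym (K.trans (K.sym (-‿distribˡ-* _ _)) (K.trans (K.-‿cong (K.sym (-‿distribʳ-* _ _))) (-‿involutive _)))
      units : ∀ j → 1 ≤ j → j ≤ suc m → Unit (quantum ((K.- t⁻½) K.* (K.- t⁻½)) j)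
      units (suc j) 1≤j j≤ = unit-≈ (K.trans (quantum-inverse (K.trans (K.*-comm t t⁻¹) t⁻¹*t) j) (quantum-cong square (suc j)))
        (unit-* (unit-^ (unit-inverse (unit-* t½-invertible t½-invertible)) j) (quantum-unit (suc j) 1≤j j≤))
      image≐ = Symmetrizers.image-eigen 𝕂 m t½ t½-invertible (K.- t⁻½) (-t⁻½-invertible t½ t½-invertible)
        (K.trans (K.+-congˡ (-‿involutive t½)) (K.+-comm _ _)) units

-- All sequences involved are constant and each difference evaluates to 0, so the proof of 0 < ε is
-- itself the required bound.
2-invertible : ℂˣ (CommutativeRing._+_ ℂ-commutativeRing (CommutativeRing.1# ℂ-commutativeRing) (CommutativeRing.1# ℂ-commutativeRing))
2-invertible = half
  , (mk≈ʳ (λ _ ε>0 → 0 , λ _ _ → ε>0) , mk≈ʳ (λ _ ε>0 → 0 , λ _ _ → ε>0))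
  , (mk≈ʳ (λ _ ε>0 → 0 , λ _ _ → ε>0) , mk≈ʳ (λ _ ε>0 → 0 , λ _ _ → ε>0))
  where
  half : ℂ
  half = record { re = fromℚ ½ ; im = fromℚ 0ℚ }

theorem4p4 : (m : ℕ) (q t½ : ℂ) (q∈ℂˣ : ℂˣ q) (t½∈ℂˣ : ℂˣ t½) →
    let open Hecke ℂ-commutativeRing m in
    (∀ k → 1 ≤ k → k ≤ suc m → ℂˣ (quantum (t½ *ᶜ t½) k)) →
    ((Image (𝟏₀ t½ t½∈ℂˣ) ≐ Bosonic t½ t½∈ℂˣ) × (Bosonic t½ t½∈ℂˣ ≐ Symmetric)) ×
    ((Image (ε₀ t½ t½∈ℂˣ) ≐ Fermionic t½ t½∈ℂˣ) × (Fermionic t½ t½∈ℂˣ ≐ MultipleBySymmetric (Aρ t½ t½∈ℂˣ))) ×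
    Σ (∀ f → Symmetric f → Antisymmetric (aρ *ᴸ f)) (λ into →
    IsModuleIsomorphism (Module.rawModule Symmetric-module) (Module.rawModule Antisymmetric-module)
    (λ (f , p) → aρ *ᴸ f , into f p)) ×
    Σ (∀ f → Bosonic t½ t½∈ℂˣ f → Fermionic t½ t½∈ℂˣ (Aρ t½ t½∈ℂˣ *ᴸ f)) (λ into →
    IsModuleIsomorphism (Module.rawModule (Bosonic-module t½ t½∈ℂˣ)) (Module.rawModule (Fermionic-module t½ t½∈ℂˣ))
    (λ (f , p) → Aρ t½ t½∈ℂˣ *ᴸ f , into f p))
theorem4p4 m q t½ q∈ℂˣ t½∈ℂˣ units =
  (image-𝟏₀ units , bosonic≐symmetric)
  , (image-ε₀ units , fermionic≐multiples units)
  , (aρ-*-antisymmetric , aρ-isIsomorphism 2-invertible)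
  , (Aρ-*-into units , Aρ-isIsomorphism units)
  where
  open Alternants ℂ-commutativeRing m
  open Eigenspaces ℂ-commutativeRing m t½ t½∈ℂˣ
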